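{- For every $m\ge 0$, $A_m^{\mathrm{mix}}=[q^m]\,C_{\mathrm{mix}}(q)H_{\mathrm{mix}}(q)^m$.
   Context: $A_n^{\mathrm{mix}}:=108^n[z^n]\,{}_2F_1(\tfrac16,\tfrac13;1;z)^3$. Let $\chi_3$ be the nontrivial Dirichlet character mod $3$. Put $u(q):=q\prod_{n\ge1}(1-q^{3n})^{12}/(1-q^n)^{12}$, $t(q):=u/(1+27u)^2$, $H_{\mathrm{mix}}(q):=q/t(q)$, and $C_{\mathrm{mix}}(q):=1+\sum_{n\ge1}\bigl(3\sum_{d\mid n}\chi_3(d)d^4-27\sum_{d\mid n}\chi_3(n/d)d^4\bigr)q^n$ (i.e. $3E_{5,\chi_0,\chi_3}-27E_{5,\chi_3,\chi_0}$). -}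

module Defs where

open import Data.Nat as ℕ using (ℕ; zero; suc; _∸_; _!; _%_)
open import Data.Nat.Properties using (_!*_!≢0)
open import Data.Nat.Divisibility using (_∣?_)
open import Data.Integer as ℤ using (ℤ; +_; -_; 0ℤ; 1ℤ)
open import Data.Rational as ℚ using (ℚ; 0ℚ; 1ℚ)
open import Data.Vec using (Vec; []; _∷_; head)
open import Relation.Nullary using (yes; no)

Σℤ : ℕ → (ℕ → ℤ) → ℤ
Σℤ zero    f = 0ℤ
Σℤ (suc n) f = Σℤ n f ℤ.+ f n

Σℚ : ℕ → (ℕ → ℚ) → ℚ
Σℚ zero    f = 0ℚ
Σℚ (suc n) f = Σℚ n f ℚ.+ f n

Πℚ : ℕ → (ℕ → ℚ) → ℚ
Πℚ zero    f = 1ℚ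
Πℚ (suc n) f = Πℚ n f ℚ.* f n

-- Formal power series, given by their coefficient sequences

Ser : Set
Ser = ℕ → ℤ

SerQ : Set
SerQ = ℕ → ℚ

δ : ℕ → ℕ → ℤ
δ m n with m ℕ.≟ n
... | yes _ = 1ℤ
... | no  _ = 0ℤ

oneS : Ser
oneS n = δ n 0

qS : Ser
qS n = δ n 1

_⊕_ : Ser → Ser → Ser
(f ⊕ g) n = f n ℤ.+ g n

_·_ : ℤ → Ser → Ser
(c · f) n = c ℤ.* f n

_⊛_ : Ser → Ser → Ser
(f ⊛ g) n = Σℤ (suc n) (λ k → f k ℤ.* g (n ∸ k))

_^S_ : Ser → ℕ → Ser
f ^S zero  = oneS
f ^S suc m = f ⊛ (f ^S m)

ΠS : ℕ → (ℕ → Ser) → Ser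
ΠS zero    f = oneS
ΠS (suc N) f = ΠS N f ⊛ f N

_⊛Q_ : SerQ → SerQ → SerQ
(f ⊛Q g) n = Σℚ (suc n) (λ k → f k ℚ.* g (n ∸ k))

-- Multiplicative inverse of a series f with constant term f 0 = 1:
-- b 0 = 1,  b n = - Σ_{k=1}^{n} f k * b (n-k).
-- invVec f n = [b n, b (n-1), ..., b 0].
private
  dot : Ser → ℕ → ∀ {n} → Vec ℤ n → ℤ
  dot f j []       = 0ℤ
  dot f j (b ∷ bs) = f j ℤ.* b ℤ.+ dot f (suc j) bs

  invVec : Ser → (n : ℕ) → Vec ℤ (suc n)
  invVec f zero    = 1ℤ ∷ []
  invVec f (suc n) = let bs = invVec f n in (- dot f 1 bs) ∷ bs

inv1 : Ser → Ser
inv1 f n = head (invVec f n)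

oneMinusQ : ℕ → Ser
oneMinusQ j n = δ n 0 ℤ.- δ n j

-- u(q) = q ∏_{n≥1} (1-q^{3n})^12 / (1-q^n)^12.
-- The infinite product has constant term 1 and its factor of index k
-- is ≡ 1 mod q^k, so its q^n-coefficient equals that of the finite
-- product over k = 1..n.

etaFactor : ℕ → Ser
etaFactor i = (oneMinusQ (3 ℕ.* suc i) ^S 12) ⊛ inv1 (oneMinusQ (suc i) ^S 12)

uOverQ : Ser
uOverQ n = ΠS n etaFactor n

uS : Ser
uS = qS ⊛ uOverQ

tS : Ser
tS = uS ⊛ inv1 ((oneS ⊕ ((+ 27) · uS)) ^S 2)

-- H_mix(q) = q / t(q) = 1 / (t(q)/q)   (t has zero constant term and
-- t/q has constant term 1)
Hmix : Ser
Hmix = inv1 (λ n → tS (suc n))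

-- C_mix(q) = 3 E_{5,χ0,χ3} - 27 E_{5,χ3,χ0}

χ₃ : ℕ → ℤ
χ₃ n with n % 3
... | 0 = 0ℤ
... | 1 = 1ℤ
... | _ = - 1ℤ

divSum : ℕ → (ℕ → ℕ → ℤ) → ℤ
divSum n g = Σℤ n term
  where
  term : ℕ → ℤ
  term i with suc i ∣? n
  ... | yes _ = g (suc i) (n ℕ./ suc i)
  ... | no  _ = 0ℤ

Cmix : Ser
Cmix zero = 1ℤ
Cmix n@(suc _) =
  ((+ 3) ℤ.* divSum n (λ d e → χ₃ d ℤ.* (+ (d ℕ.^ 4))))
  ℤ.- ((+ 27) ℤ.* divSum n (λ d e → χ₃ e ℤ.* (+ (d ℕ.^ 4))))

-- 2F1(a,b;1;z) = Σ_k (a)_k (b)_k / (k!)^2 z^k   (since (1)_k = k!)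

poch : ℚ → ℕ → ℚ
poch a k = Πℚ k (λ j → a ℚ.+ ((+ j) ℚ./ 1))

hyp2F1c1 : ℚ → ℚ → SerQ
hyp2F1c1 a b k = poch a k ℚ.* poch b k ℚ.*
                 ((1ℤ ℚ./ (k ! ℕ.* k !)) {{k !* k !≢0}})

Fmix : SerQ
Fmix = hyp2F1c1 (1ℤ ℚ./ 6) (1ℤ ℚ./ 3)

Amix : ℕ → ℚ
Amix n = ((+ (108 ℕ.^ n)) ℚ./ 1) ℚ.* (Fmix ⊛Q (Fmix ⊛Q Fmix)) n

{-# OPTIONS --safe #-}

-- By Lagrange inversion, [q^m] C H^m is the m-th coefficient of C/(θt/t) as a power series in t = q/H, where
-- θ = q d/dq. The claim is therefore C = a³ θt/t with a = ₂F₁(1/6,1/3;1;108t). Here a = 1 + 6 Σ χ₃(d) q^n,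
-- summed over d ∣ n, the cubic theta function. Quadratic relations between Lambert series,
--   a² = θu/u,  3 θa = a G + 27 V,  3 θG = G² - 27 a V,  θV = (G + a²) V,
-- show that V = u B with B = a³ - 27 V and that a satisfies the hypergeometric equation in t; two further ones
-- evaluate the Eisenstein series of weight 5 as a² B and a² V. Each relation is proved by Liouville's method:
-- the coefficients of a product of two Lambert series are sums over a x + b y = n, which are rearranged through
-- (a, b, x, y) ↦ (a - b, b, x, x + y).

module Submission where

open import Defs renaming (_⊕_ to infixl 6 _⊕_; _⊛_ to infixl 7 _⊛_; _·_ to infixr 8 _·_; _^S_ to infixr 9 _^S_; _⊛Q_ to infixr 7 _⊛Q_)
open import Algebra.Bundles using (CommutativeRing)
import Algebra.Properties.Group
import Algebra.Solver.Ring
import Algebra.Solver.Ring.AlmostCommutativeRing as ACR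
open import Data.Bool using (T)
open import Data.Fin using (zero; suc; #_)
open import Data.Integer as ℤ using (ℤ; -_; 0ℤ; 1ℤ; _+_; _*_; _-_)
import Data.Integer.Properties as ℤ
import Data.Integer.Solver
open import Data.Integer.Tactic.RingSolver using (solve-∀)
import Data.Maybe
open import Data.Maybe using (just; is-just)
open import Data.Nat as ℕ using (ℕ; zero; suc; _∸_; _!; z≤n; s≤s)
import Data.Nat.DivMod as ℕ
open import Data.Nat.Divisibility using (_∣?_; divides)
open import Data.Nat.Induction using (<-rec)
import Data.Nat.Properties as ℕ
import Data.Nat.Tactic.RingSolver as ℕ-Solver
open import Data.Product using (_,_)
open import Data.Rational as ℚ using (ℚ; 1ℚ; _/_; toℚᵘ)
import Data.Rational.Properties as ℚ
import Data.Rational.Solver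
open import Data.Rational.Unnormalised as ℚᵘ using (mkℚᵘ; *≡*)
import Data.Rational.Unnormalised.Properties as ℚᵘ
open import Data.Sum using (inj₁; inj₂; [_,_]′)
open import Data.Vec using (Vec; []; _∷_; lookup; map)
open import Data.Vec.Properties using (lookup-map)
open import Relation.Binary.PropositionalEquality hiding ([_])
open import Relation.Binary.Structures using (IsEquivalence)
open import Relation.Nullary using (yes; no; contradiction)
open import Relation.Nullary.Decidable using (dec⇒maybe)
open ≡-Reasoning

-- Finite sums

-- For modular forms of level 3 such relations follow from the finite dimension of their spaces.
-- Here each relation has a finite certificate instead: polynomial weights for every pair of
-- residues modulo 3, whose validity is a computation with normal forms. A certificate needs both
-- factors of a product to carry their residues on the same variable, on a and b or on x and y. This
-- is why some series are wanted in two forms, once with the residue of a and once with that of x.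
--
-- The product u enters the algebra only through θu/u. Hence V = u B is obtained from uniqueness:
-- both sides solve θf = (G + a²) f, and a solution of this equation is determined by its
-- coefficient of q.
--
-- All series keep integer coefficients: what is cancelled is a nonzero integer or, up to a power of
-- q, a series with constant term 1. Rational numbers appear only when the recurrence of the integer
-- coefficients is compared with the hypergeometric one.

Σ-cong : ∀ n {f g : ℕ → ℤ} → (∀ i → f i ≡ g i) → Σℤ n f ≡ Σℤ n g
Σ-cong zero    e = refl
Σ-cong (suc n) e = cong₂ _+_ (Σ-cong n e) (e n)

Σ-cong< : ∀ n {f g : ℕ → ℤ} → (∀ i → i ℕ.< n → f i ≡ g i) → Σℤ n f ≡ Σℤ n g
Σ-cong< zero    e = refl
Σ-cong< (suc n) e = cong₂ _+_ (Σ-cong< n (λ i i<n → e i (ℕ.m<n⇒m<1+n i<n))) (e n ℕ.≤-refl)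

Σ-0 : ∀ n {f : ℕ → ℤ} → (∀ i → f i ≡ 0ℤ) → Σℤ n f ≡ 0ℤ
Σ-0 zero    e = refl
Σ-0 (suc n) e = cong₂ _+_ (Σ-0 n e) (e n)

Σ-+ : ∀ n (f g : ℕ → ℤ) → Σℤ n (λ i → f i + g i) ≡ Σℤ n f + Σℤ n g
Σ-+ zero    f g = refl
Σ-+ (suc n) f g = trans (cong (_+ (f n + g n)) (Σ-+ n f g)) (interchange (Σℤ n f) (Σℤ n g) (f n) (g n))
  where
  interchange : ∀ a b c d → a + b + (c + d) ≡ a + c + (b + d)
  interchange = solve-∀

Σ-*ˡ : ∀ n c (f : ℕ → ℤ) → Σℤ n (λ i → c * f i) ≡ c * Σℤ n f
Σ-*ˡ zero    c f = sym (ℤ.*-zeroʳ c)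
Σ-*ˡ (suc n) c f = trans (cong (_+ c * f n) (Σ-*ˡ n c f)) (sym (ℤ.*-distribˡ-+ c (Σℤ n f) (f n)))

Σ-*ʳ : ∀ n c (f : ℕ → ℤ) → Σℤ n (λ i → f i * c) ≡ Σℤ n f * c
Σ-*ʳ zero    c f = refl
Σ-*ʳ (suc n) c f = trans (cong (_+ f n * c) (Σ-*ʳ n c f)) (sym (ℤ.*-distribʳ-+ c (Σℤ n f) (f n)))

Σ-swap : ∀ m n (F : ℕ → ℕ → ℤ) → Σℤ m (λ i → Σℤ n (F i)) ≡ Σℤ n (λ j → Σℤ m (λ i → F i j))
Σ-swap zero    n F = sym (Σ-0 n (λ _ → refl))
Σ-swap (suc m) n F = trans (cong (_+ Σℤ n (F m)) (Σ-swap m n F))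
  (sym (Σ-+ n (λ j → Σℤ m (λ i → F i j)) (F m)))

Σ-first : ∀ n (f : ℕ → ℤ) → Σℤ (suc n) f ≡ f 0 + Σℤ n (λ i → f (suc i))
Σ-first zero    f = trans (ℤ.+-identityˡ (f 0)) (sym (ℤ.+-identityʳ (f 0)))
Σ-first (suc n) f = trans (cong (_+ f (suc n)) (Σ-first n f)) (ℤ.+-assoc (f 0) _ (f (suc n)))

Σ-extend : ∀ {n m} {f : ℕ → ℤ} → n ℕ.≤ m → (∀ i → n ℕ.≤ i → f i ≡ 0ℤ) → Σℤ m f ≡ Σℤ n f
Σ-extend {n} {zero}  z≤n e = refl
Σ-extend {n} {suc m} {f} n≤ e with ℕ.m≤n⇒m<n∨m≡n n≤
... | inj₂ refl = refl
... | inj₁ (s≤s n≤m) = trans (cong₂ _+_ (Σ-extend n≤m e) (e m n≤m)) (ℤ.+-identityʳ (Σℤ n f))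

anti : (ℕ → ℕ → ℤ) → ℕ → ℤ
anti F n = Σℤ (suc n) (λ k → F k (n ∸ k))

anti-first : ∀ F n → anti F (suc n) ≡ F 0 (suc n) + anti (λ i → F (suc i)) n
anti-first F n = Σ-first (suc n) (λ k → F k (suc n ∸ k))

anti-cong : ∀ {F G : ℕ → ℕ → ℤ} → (∀ i j → F i j ≡ G i j) → ∀ n → anti F n ≡ anti G n
anti-cong e n = Σ-cong (suc n) (λ k → e k (n ∸ k))

anti-0 : ∀ {F : ℕ → ℕ → ℤ} → (∀ i j → F i j ≡ 0ℤ) → ∀ n → anti F n ≡ 0ℤ
anti-0 e n = Σ-0 (suc n) (λ k → e k (n ∸ k))

anti-last : ∀ F n → anti F (suc n) ≡ anti (λ i j → F i (suc j)) n + F (suc n) 0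
anti-last F zero    = refl
anti-last F (suc n) = begin
  anti F (2 ℕ.+ n)
    ≡⟨ anti-first F (suc n) ⟩
  F 0 (2 ℕ.+ n) + anti (λ i → F (suc i)) (suc n)
    ≡⟨ cong (F 0 (2 ℕ.+ n) +_) (anti-last (λ i → F (suc i)) n) ⟩
  F 0 (2 ℕ.+ n) + (anti (λ i j → F (suc i) (suc j)) n + F (2 ℕ.+ n) 0)
    ≡⟨ ℤ.+-assoc (F 0 (2 ℕ.+ n)) _ _ ⟨
  F 0 (2 ℕ.+ n) + anti (λ i j → F (suc i) (suc j)) n + F (2 ℕ.+ n) 0
    ≡⟨ cong (_+ F (2 ℕ.+ n) 0) (anti-first (λ i j → F i (suc j)) n) ⟨
  anti (λ i j → F i (suc j)) (suc n) + F (2 ℕ.+ n) 0 ∎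

anti-flip : ∀ F n → anti F n ≡ anti (λ i j → F j i) n
anti-flip F zero    = refl
anti-flip F (suc n) = begin
  anti F (suc n)                                  ≡⟨ anti-first F n ⟩
  F 0 (suc n) + anti (λ i → F (suc i)) n          ≡⟨ cong (F 0 (suc n) +_) (anti-flip (λ i → F (suc i)) n) ⟩
  F 0 (suc n) + anti (λ i j → F (suc j) i) n      ≡⟨ ℤ.+-comm (F 0 (suc n)) _ ⟩
  anti (λ i j → F (suc j) i) n + F 0 (suc n)      ≡⟨ anti-last (λ i j → F j i) n ⟨
  anti (λ i j → F j i) (suc n)                    ∎

-- The summand is a difference of neighbouring values of `Φ` on the next antidiagonal, so only the
-- two ends survive. This evaluates the diagonal parts in Liouville's method.
anti-telescope : ∀ (Φ : ℕ → ℕ → ℤ) n →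
  anti (λ i j → Φ (suc i) j - Φ i (suc j)) n ≡ Φ (suc n) 0 - Φ 0 (suc n)
anti-telescope Φ zero    = ℤ.+-identityˡ _
anti-telescope Φ (suc n) = trans (anti-first (λ i j → Φ (suc i) j - Φ i (suc j)) n)
  (trans (cong (Φ 1 (suc n) - Φ 0 (2 ℕ.+ n) +_) (anti-telescope (λ i → Φ (suc i)) n))
         (collapse (Φ 1 (suc n)) (Φ 0 (2 ℕ.+ n)) (Φ (2 ℕ.+ n) 0)))
  where
  collapse : ∀ x y z → x - y + (z - x) ≡ z - y
  collapse = solve-∀

Σ² : ℕ → (ℕ → ℕ → ℤ) → ℤ
Σ² B F = Σℤ B (λ i → Σℤ B (F i))

Σ²-cong : ∀ B {F G : ℕ → ℕ → ℤ} → (∀ i j → F i j ≡ G i j) → Σ² B F ≡ Σ² B G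
Σ²-cong B e = Σ-cong B (λ i → Σ-cong B (e i))

Σ²-+ : ∀ B (F G : ℕ → ℕ → ℤ) → Σ² B (λ i j → F i j + G i j) ≡ Σ² B F + Σ² B G
Σ²-+ B F G = trans (Σ-cong B (λ i → Σ-+ B (F i) (G i))) (Σ-+ B _ _)

-- The hypothesis cuts the square down to the triangle `i + j < B`. The induction splits off the row
-- `i = 0`; in the other rows the last column vanishes, which leaves a square of the smaller side.
Σ²-antidiagonals : ∀ B (F : ℕ → ℕ → ℤ) → (∀ i j → B ℕ.≤ i ℕ.+ j → F i j ≡ 0ℤ) →
  Σ² B F ≡ Σℤ B (anti F)
Σ²-antidiagonals zero    F e = refl
Σ²-antidiagonals (suc B) F e = begin
  Σ² (suc B) F
    ≡⟨ Σ-first B (λ i → Σℤ (suc B) (F i)) ⟩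
  Σℤ (suc B) (F 0) + Σℤ B (λ i → Σℤ (suc B) (F (suc i)))
    ≡⟨ cong₂ _+_ (Σ-first B (F 0)) (Σ-cong B (λ i →
         trans (cong (Σℤ B (F (suc i)) +_) (e (suc i) B (s≤s (ℕ.m≤n+m B i)))) (ℤ.+-identityʳ _))) ⟩
  F 0 0 + Σℤ B (λ j → F 0 (suc j)) + Σ² B (λ i → F (suc i))
    ≡⟨ cong (F 0 0 + Σℤ B (λ j → F 0 (suc j)) +_)
         (Σ²-antidiagonals B (λ i → F (suc i)) (λ i j B≤ → e (suc i) j (s≤s B≤))) ⟩
  F 0 0 + Σℤ B (λ j → F 0 (suc j)) + Σℤ B (anti (λ i → F (suc i)))
    ≡⟨ ℤ.+-assoc (F 0 0) _ _ ⟩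
  F 0 0 + (Σℤ B (λ j → F 0 (suc j)) + Σℤ B (anti (λ i → F (suc i))))
    ≡⟨ cong₂ _+_ (sym (ℤ.+-identityˡ (F 0 0)))
         (sym (trans (Σ-cong B (anti-first F)) (Σ-+ B (λ j → F 0 (suc j)) _))) ⟩
  anti F 0 + Σℤ B (λ m → anti F (suc m))
    ≡⟨ Σ-first B (anti F) ⟨
  Σℤ (suc B) (anti F) ∎

-- The cases `i > j`, `i = j` and `i < j`, with the difference as a new index. The reindexed sums
-- still run over the whole square and overshoot; the hypotheses make the additional terms zero.
Σ²-trichotomy : ∀ B (F : ℕ → ℕ → ℤ) →
  (∀ i j → B ℕ.≤ i → F i j ≡ 0ℤ) → (∀ i j → B ℕ.≤ j → F i j ≡ 0ℤ) →
  Σ² B F ≡ Σ² B (λ i j → F (i ℕ.+ suc j) j) + Σℤ B (λ i → F i i) + Σ² B (λ i j → F j (i ℕ.+ suc j))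
Σ²-trichotomy zero    F e₁ e₂ = refl
Σ²-trichotomy (suc B) F e₁ e₂ = begin
  Σ² (suc B) F
    ≡⟨ Σ-first B (λ i → Σℤ (suc B) (F i)) ⟩
  Σℤ (suc B) (F 0) + Σℤ B (λ i → Σℤ (suc B) (F (suc i)))
    ≡⟨ cong₂ _+_ (Σ-first B (F 0)) (trans (Σ-cong B (λ i → Σ-first B (F (suc i)))) (Σ-+ B (λ i → F (suc i) 0) _)) ⟩
  F 0 0 + R + (C + Σ² B F')
    ≡⟨ cong (λ z → F 0 0 + R + (C + z)) (Σ²-trichotomy B F'
         (λ i j B≤ → e₁ (suc i) (suc j) (s≤s B≤)) (λ i j B≤ → e₂ (suc i) (suc j) (s≤s B≤))) ⟩
  F 0 0 + R + (C + (X + Y + Z))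
    ≡⟨ regroup (F 0 0) R C X Y Z ⟩
  C + X + (F 0 0 + Y) + (R + Z)
    ≡⟨ cong₂ _+_ (cong₂ _+_ (sym (below (λ i j → F i j) (λ i j → e₁ i j))) (sym (Σ-first B (λ i → F i i))))
         (sym (below (λ i j → F j i) (λ i j → e₂ j i))) ⟩
  Σ² (suc B) (λ i j → F (i ℕ.+ suc j) j) + Σℤ (suc B) (λ i → F i i) + Σ² (suc B) (λ i j → F j (i ℕ.+ suc j)) ∎
  where
  F' : ℕ → ℕ → ℤ
  F' i j = F (suc i) (suc j)
  R = Σℤ B (λ j → F 0 (suc j))
  C = Σℤ B (λ i → F (suc i) 0)
  X = Σ² B (λ i j → F' (i ℕ.+ suc j) j)
  Y = Σℤ B (λ i → F' i i)
  Z = Σ² B (λ i j → F' j (i ℕ.+ suc j))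
  regroup : ∀ f r c x y z → f + r + (c + (x + y + z)) ≡ c + x + (f + y) + (r + z)
  regroup = solve-∀
  -- The terms with `j = 0` are split off. The terms with `i = B` have first index above `B` and
  -- vanish, which brings both remaining sums to the bound `B`.
  below : ∀ (K : ℕ → ℕ → ℤ) → (∀ i j → suc B ℕ.≤ i → K i j ≡ 0ℤ) →
    Σ² (suc B) (λ i j → K (i ℕ.+ suc j) j) ≡
    Σℤ B (λ i → K (suc i) 0) + Σ² B (λ i j → K (suc (i ℕ.+ suc j)) (suc j))
  below K e = begin
    Σ² (suc B) (λ i j → K (i ℕ.+ suc j) j)
      ≡⟨ Σ-cong (suc B) (λ i → Σ-first B (λ j → K (i ℕ.+ suc j) j)) ⟩
    Σℤ (suc B) (λ i → K (i ℕ.+ 1) 0 + Σℤ B (λ j → K (i ℕ.+ suc (suc j)) (suc j)))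
      ≡⟨ Σ-+ (suc B) (λ i → K (i ℕ.+ 1) 0) _ ⟩
    Σℤ (suc B) (λ i → K (i ℕ.+ 1) 0) + Σℤ (suc B) (λ i → Σℤ B (λ j → K (i ℕ.+ suc (suc j)) (suc j)))
      ≡⟨ cong₂ _+_ (drop (λ i → K (i ℕ.+ 1) 0) (e _ 0 (ℕ.≤-reflexive (ℕ.+-comm 1 B))))
           (drop (λ i → Σℤ B (λ j → K (i ℕ.+ suc (suc j)) (suc j)))
             (Σ-0 B (λ j → e _ (suc j) (subst (suc B ℕ.≤_) (sym (ℕ.+-suc B (suc j))) (s≤s (ℕ.m≤m+n B (suc j))))))) ⟩
    Σℤ B (λ i → K (i ℕ.+ 1) 0) + Σℤ B (λ i → Σℤ B (λ j → K (i ℕ.+ suc (suc j)) (suc j)))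
      ≡⟨ cong₂ _+_ (Σ-cong B (λ i → cong (λ k → K k 0) (ℕ.+-comm i 1)))
           (Σ²-cong B (λ i j → cong (λ k → K k (suc j)) (ℕ.+-suc i (suc j)))) ⟩
    Σℤ B (λ i → K (suc i) 0) + Σ² B (λ i j → K (suc (i ℕ.+ suc j)) (suc j)) ∎
    where
    drop : ∀ (g : ℕ → ℤ) → g B ≡ 0ℤ → Σℤ (suc B) g ≡ Σℤ B g
    drop g z = trans (cong (Σℤ B g +_) z) (ℤ.+-identityʳ _)

δ-same : ∀ m → δ m m ≡ 1ℤ
δ-same m with m ℕ.≟ m
... | yes _ = refl
... | no ≢ = contradiction refl ≢

δ-distinct : ∀ {m n} → m ≢ n → δ m n ≡ 0ℤ
δ-distinct {m} {n} ≢ with m ℕ.≟ n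
... | yes e = contradiction e ≢
... | no _ = refl

δ-suc : ∀ m n → δ (suc m) (suc n) ≡ δ m n
δ-suc m n with m ℕ.≟ n
... | yes refl = δ-same (suc m)
... | no ≢ = δ-distinct (λ e → ≢ (ℕ.suc-injective e))

δ-sym : ∀ m n → δ m n ≡ δ n m
δ-sym m n with m ℕ.≟ n
... | yes refl = sym (δ-same m)
... | no ≢ = sym (δ-distinct (λ e → ≢ (sym e)))

δ-⊛ : ∀ p r n → anti (λ i j → δ p i * δ r j) n ≡ δ (p ℕ.+ r) n
δ-⊛ zero    r zero    = trans (ℤ.+-identityˡ _) (ℤ.*-identityˡ _)
δ-⊛ zero    r (suc n) = trans (anti-first (λ i j → δ 0 i * δ r j) n)
  (trans (cong₂ _+_ (ℤ.*-identityˡ (δ r (suc n))) (anti-0 (λ i j → refl) n)) (ℤ.+-identityʳ _))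
δ-⊛ (suc p) r zero    = refl
δ-⊛ (suc p) r (suc n) = trans (anti-first (λ i j → δ (suc p) i * δ r j) n)
  (trans (ℤ.+-identityˡ _)
  (trans (anti-cong (λ i j → cong (_* δ r j) (δ-suc p i)) n)
  (trans (δ-⊛ p r n) (sym (δ-suc (p ℕ.+ r) n)))))

-- The ring of formal power series

infix  4 _≐_
infix 8 ⊖_

-- A record around pointwise equality lets unification recover the two series from the type of a
-- proof.
record _≐_ (f g : Ser) : Set where
  constructor pointwise
  field coeff : ∀ n → f n ≡ g n
open _≐_ public

zeroS : Ser
zeroS _ = 0ℤ

⊖_ : Ser → Ser
(⊖ f) n = - f n

shift : Ser → Ser
shift f n = f (suc n)

⊛-suc : ∀ f g n → (f ⊛ g) (suc n) ≡ f 0 * g (suc n) + (shift f ⊛ g) n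
⊛-suc f g n = anti-first (λ i j → f i * g j) n

⊛-zero : ∀ f g → (f ⊛ g) 0 ≡ f 0 * g 0
⊛-zero f g = ℤ.+-identityˡ (f 0 * g 0)

⊛-cong : ∀ {f f′ g g′} → f ≐ f′ → g ≐ g′ → f ⊛ g ≐ f′ ⊛ g′
⊛-cong p q .coeff = anti-cong (λ i j → cong₂ _*_ (coeff p i) (coeff q j))

⊛-comm : ∀ f g → f ⊛ g ≐ g ⊛ f
⊛-comm f g .coeff n = trans (anti-flip (λ i j → f i * g j) n)
  (anti-cong (λ i j → ℤ.*-comm (f j) (g i)) n)

⊛-distribʳ : ∀ h f g → (f ⊕ g) ⊛ h ≐ f ⊛ h ⊕ g ⊛ h
⊛-distribʳ h f g .coeff n = trans (anti-cong (λ i j → ℤ.*-distribʳ-+ (h j) (f i) (g i)) n)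
  (Σ-+ (suc n) (λ k → f k * h (n ∸ k)) _)

⊛-distribˡ : ∀ h f g → h ⊛ (f ⊕ g) ≐ h ⊛ f ⊕ h ⊛ g
⊛-distribˡ h f g .coeff n = trans (anti-cong (λ i j → ℤ.*-distribˡ-+ (h i) (f j) (g j)) n)
  (Σ-+ (suc n) (λ k → h k * f (n ∸ k)) _)

·-⊛ : ∀ c f g → (c · f) ⊛ g ≐ c · (f ⊛ g)
·-⊛ c f g .coeff n = trans (anti-cong (λ i j → ℤ.*-assoc c (f i) (g j)) n)
  (Σ-*ˡ (suc n) c (λ k → f k * g (n ∸ k)))

⊛-assoc : ∀ f g h → (f ⊛ g) ⊛ h ≐ f ⊛ (g ⊛ h)
⊛-assoc f g h .coeff n = go n f
  where
  -- `f` varies in the induction, because the recursion for a product continues with `shift f`.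
  go : ∀ n f → ((f ⊛ g) ⊛ h) n ≡ (f ⊛ (g ⊛ h)) n
  go zero f = begin
    ((f ⊛ g) ⊛ h) 0          ≡⟨ trans (⊛-zero (f ⊛ g) h) (cong (_* h 0) (⊛-zero f g)) ⟩
    f 0 * g 0 * h 0          ≡⟨ ℤ.*-assoc (f 0) (g 0) (h 0) ⟩
    f 0 * (g 0 * h 0)        ≡⟨ trans (⊛-zero f (g ⊛ h)) (cong (f 0 *_) (⊛-zero g h)) ⟨
    (f ⊛ (g ⊛ h)) 0          ∎
  go (suc n) f = begin
    ((f ⊛ g) ⊛ h) (suc n)
      ≡⟨ ⊛-suc (f ⊛ g) h n ⟩
    (f ⊛ g) 0 * h (suc n) + (shift (f ⊛ g) ⊛ h) n
      ≡⟨ cong₂ _+_ (cong (_* h (suc n)) (⊛-zero f g))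
           (anti-cong (λ i j → cong (_* h j) (⊛-suc f g i)) n) ⟩
    f 0 * g 0 * h (suc n) + ((f 0 · shift g ⊕ shift f ⊛ g) ⊛ h) n
      ≡⟨ cong₂ _+_ (ℤ.*-assoc (f 0) (g 0) (h (suc n))) (trans (coeff (⊛-distribʳ h (f 0 · shift g) (shift f ⊛ g)) n)
           (cong₂ _+_ (coeff (·-⊛ (f 0) (shift g) h) n) (go n (shift f)))) ⟩
    f 0 * (g 0 * h (suc n)) + (f 0 * (shift g ⊛ h) n + (shift f ⊛ (g ⊛ h)) n)
      ≡⟨ factor (f 0) _ _ _ ⟩
    f 0 * (g 0 * h (suc n) + (shift g ⊛ h) n) + (shift f ⊛ (g ⊛ h)) n
      ≡⟨ cong (λ z → f 0 * z + (shift f ⊛ (g ⊛ h)) n) (⊛-suc g h n) ⟨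
    f 0 * (g ⊛ h) (suc n) + (shift f ⊛ (g ⊛ h)) n
      ≡⟨ ⊛-suc f (g ⊛ h) n ⟨
    (f ⊛ (g ⊛ h)) (suc n) ∎
    where
    factor : ∀ a x y z → a * x + (a * y + z) ≡ a * (x + y) + z
    factor = solve-∀

⊛-identityˡ : ∀ f → oneS ⊛ f ≐ f
⊛-identityˡ f .coeff zero    = trans (ℤ.+-identityˡ _) (ℤ.*-identityˡ (f 0))
⊛-identityˡ f .coeff (suc n) = trans (⊛-suc oneS f n)
  (trans (cong₂ _+_ (ℤ.*-identityˡ (f (suc n))) (anti-0 (λ _ _ → refl) n)) (ℤ.+-identityʳ _))

≐-isEquivalence : IsEquivalence _≐_
≐-isEquivalence = record
  { refl  = pointwise (λ _ → refl)
  ; sym   = λ p → pointwise (λ n → sym (coeff p n))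
  ; trans = λ p q → pointwise (λ n → trans (coeff p n) (coeff q n))
  }

Ser-ring : CommutativeRing _ _
Ser-ring = record
  { Carrier = Ser ; _≈_ = _≐_ ; _+_ = _⊕_ ; _*_ = _⊛_ ; -_ = ⊖_ ; 0# = zeroS ; 1# = oneS
  ; isCommutativeRing = record
    { isRing = record
      { +-isAbelianGroup = record
        { isGroup = record
          { isMonoid = record
            { isSemigroup = record
              { isMagma = record
                { isEquivalence = ≐-isEquivalence
                ; ∙-cong = λ p q → pointwise (λ n → cong₂ _+_ (coeff p n) (coeff q n)) }
              ; assoc = λ f g h → pointwise (λ n → ℤ.+-assoc (f n) (g n) (h n)) }
            ; identity = (λ f → pointwise (λ n → ℤ.+-identityˡ (f n))) , (λ f → pointwise (λ n → ℤ.+-identityʳ (f n))) }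
          ; inverse = (λ f → pointwise (λ n → ℤ.+-inverseˡ (f n))) , (λ f → pointwise (λ n → ℤ.+-inverseʳ (f n)))
          ; ⁻¹-cong = λ p → pointwise (λ n → cong -_ (coeff p n)) }
        ; comm = λ f g → pointwise (λ n → ℤ.+-comm (f n) (g n)) }
      ; *-cong = ⊛-cong
      ; *-assoc = ⊛-assoc
      ; *-identity = ⊛-identityˡ , (λ f → IsEquivalence.trans ≐-isEquivalence (⊛-comm f oneS) (⊛-identityˡ f))
      ; distrib = ⊛-distribˡ , ⊛-distribʳ }
    ; *-comm = ⊛-comm } }

module Ring = CommutativeRing Ser-ring

⊛-congˡ : ∀ h {f g} → f ≐ g → h ⊛ f ≐ h ⊛ g
⊛-congˡ h p .coeff = anti-cong (λ i j → cong (h i *_) (coeff p j))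

⊛-congʳ : ∀ h {f g} → f ≐ g → f ⊛ h ≐ g ⊛ h
⊛-congʳ h p .coeff = anti-cong (λ i j → cong (_* h j) (coeff p i))

-- Equality of series is not decidable, so the solver takes its coefficients from the integers,
-- embedded as constant series.
scalar-ring-morphism : CommutativeRing.rawRing ℤ.+-*-commutativeRing ACR.-Raw-AlmostCommutative⟶ ACR.fromCommutativeRing Ser-ring
scalar-ring-morphism = record
  { ⟦_⟧    = λ c → c · oneS
  ; +-homo = λ c d → pointwise (λ n → ℤ.*-distribʳ-+ (oneS n) c d)
  ; *-homo = λ c d → Ring.sym (Ring.trans (·-⊛ c oneS (d · oneS)) (pointwise (λ n →
      trans (cong (c *_) (coeff (⊛-identityˡ (d · oneS)) n)) (sym (ℤ.*-assoc c d (oneS n))))))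
  ; -‿homo = λ c → pointwise (λ n → sym (ℤ.neg-distribˡ-* c (oneS n)))
  ; 0-homo = pointwise (λ n → refl)
  ; 1-homo = pointwise (λ n → ℤ.*-identityˡ (oneS n))
  }

module Solver = Algebra.Solver.Ring (CommutativeRing.rawRing ℤ.+-*-commutativeRing) (ACR.fromCommutativeRing Ser-ring)
  scalar-ring-morphism (λ c d → Data.Maybe.map (λ p → pointwise (λ n → cong (λ e → e * oneS n) p)) (dec⇒maybe (c ℤ.≟ d)))

κ : ℤ → Ser
κ c = c · oneS

infixr 8 _•_
-- Scaling as a product with a constant series is visible to the ring solver, unlike the
-- coefficientwise `_·_`.
_•_ : ℤ → Ser → Ser
c • f = κ c ⊛ f

·-• : ∀ c f → c · f ≐ c • f
·-• c f = Ring.sym (Ring.trans (·-⊛ c oneS f) (pointwise (λ n → cong (c *_) (coeff (⊛-identityˡ f) n))))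

·-cong : ∀ c {f g} → f ≐ g → c · f ≐ c · g
·-cong c e .coeff n = cong (c *_) (coeff e n)

⊕-congˡ : ∀ h {f g} → f ≐ g → h ⊕ f ≐ h ⊕ g
⊕-congˡ h e .coeff n = cong (h n +_) (coeff e n)

⊕-congʳ : ∀ h {f g} → f ≐ g → f ⊕ h ≐ g ⊕ h
⊕-congʳ h e .coeff n = cong (_+ h n) (coeff e n)

•-cong : ∀ c {f g} → f ≐ g → c • f ≐ c • g
•-cong c = ⊛-congˡ (κ c)

•-cancel : ∀ c .{{_ : ℕ.NonZero c}} f g → (ℤ.+ c) • f ≐ (ℤ.+ c) • g → f ≐ g
•-cancel (suc c) f g e .coeff n = ℤ.*-cancelˡ-≡ (ℤ.+ suc c) (f n) (g n)
  (trans (coeff (·-• (ℤ.+ suc c) f) n) (trans (coeff e n) (sym (coeff (·-• (ℤ.+ suc c) g) n))))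

-- The derivation q d/dq and multiplicative inverses

D : Ser → Ser
D f n = ℤ.+ n * f n

D-cong : ∀ {f g} → f ≐ g → D f ≐ D g
D-cong p .coeff n = cong (ℤ.+ n *_) (coeff p n)

D-⊕ : ∀ f g → D (f ⊕ g) ≐ D f ⊕ D g
D-⊕ f g .coeff n = ℤ.*-distribˡ-+ (ℤ.+ n) (f n) (g n)

D-· : ∀ c f → D (c · f) ≐ c · D f
D-· c f .coeff n = rearrange (ℤ.+ n) c (f n)
  where
  rearrange : ∀ n c x → n * (c * x) ≡ c * (n * x)
  rearrange = solve-∀

D-⊛ : ∀ f g → D (f ⊛ g) ≐ D f ⊛ g ⊕ f ⊛ D g
D-⊛ f g .coeff n = trans (sym (Σ-*ˡ (suc n) (ℤ.+ n) _)) (trans (Σ-cong< (suc n) leibniz) (Σ-+ (suc n) _ _))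
  where
  expand : ∀ i j x y → (i + j) * (x * y) ≡ i * x * y + x * (j * y)
  expand = solve-∀
  leibniz : ∀ k → k ℕ.< suc n →
    ℤ.+ n * (f k * g (n ∸ k)) ≡ ℤ.+ k * f k * g (n ∸ k) + f k * (ℤ.+ (n ∸ k) * g (n ∸ k))
  leibniz k k≤n = trans (cong (λ m → ℤ.+ m * (f k * g (n ∸ k))) (sym (ℕ.m+[n∸m]≡n (ℕ.s≤s⁻¹ k≤n))))
    (expand (ℤ.+ k) (ℤ.+ (n ∸ k)) (f k) (g (n ∸ k)))

-- dot and invVec are private to Defs; unification recovers  dot f j (invVec f m)  from the
-- unfolding of inv1 f (2 + m), with the literal 2 generalised to j.
mutual
  tailDot : ℕ → Ser → ℕ → ℤ
  tailDot = _

  inv1-unfold : ∀ f m → inv1 f (suc (suc m)) ≡ - (f 1 * inv1 f (suc m) + tailDot 2 f m)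
  inv1-unfold f m with 2
  ... | j = refl

tailDot-anti : ∀ j f m → tailDot j f m ≡ anti (λ i k → f (j ℕ.+ i) * inv1 f k) m
tailDot-anti j f zero = trans (ℤ.+-comm (f j * 1ℤ) 0ℤ) (cong (λ i → 0ℤ + f i * 1ℤ) (sym (ℕ.+-identityʳ j)))
tailDot-anti j f (suc m) = begin
  f j * inv1 f (suc m) + tailDot (suc j) f m
    ≡⟨ cong₂ _+_ (cong (λ i → f i * inv1 f (suc m)) (sym (ℕ.+-identityʳ j))) (tailDot-anti (suc j) f m) ⟩
  f (j ℕ.+ 0) * inv1 f (suc m) + anti (λ i k → f (suc j ℕ.+ i) * inv1 f k) m
    ≡⟨ cong (f (j ℕ.+ 0) * inv1 f (suc m) +_) (anti-cong (λ i k → cong (λ e → f e * inv1 f k) (sym (ℕ.+-suc j i))) m) ⟩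
  f (j ℕ.+ 0) * inv1 f (suc m) + anti (λ i k → f (j ℕ.+ suc i) * inv1 f k) m
    ≡⟨ anti-first (λ i k → f (j ℕ.+ i) * inv1 f k) m ⟨
  anti (λ i k → f (j ℕ.+ i) * inv1 f k) (suc m) ∎

inv1-inverse : ∀ f → f 0 ≡ 1ℤ → f ⊛ inv1 f ≐ oneS
inv1-inverse f f₀ .coeff zero    = trans (⊛-zero f (inv1 f)) (cong (_* 1ℤ) f₀)
inv1-inverse f f₀ .coeff (suc m) = begin
  (f ⊛ inv1 f) (suc m)
    ≡⟨ ⊛-suc f (inv1 f) m ⟩
  f 0 * - (tailDot 1 f m) + anti (λ i k → f (suc i) * inv1 f k) m
    ≡⟨ cong₂ _+_ (trans (cong (_* - (tailDot 1 f m)) f₀) (ℤ.*-identityˡ _)) (sym (tailDot-anti 1 f m)) ⟩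
  - (tailDot 1 f m) + tailDot 1 f m
    ≡⟨ ℤ.+-inverseˡ (tailDot 1 f m) ⟩
  0ℤ ∎

⊛-cancelˡ : ∀ f {g h} → f 0 ≡ 1ℤ → f ⊛ g ≐ f ⊛ h → g ≐ h
⊛-cancelˡ f {g} {h} f₀ e = Ring.trans (Ring.sym (retract g)) (Ring.trans (⊛-congˡ (inv1 f) e) (retract h))
  where
  retract : ∀ g → inv1 f ⊛ (f ⊛ g) ≐ g
  retract g = Ring.trans (Ring.sym (⊛-assoc (inv1 f) f g))
    (Ring.trans (⊛-congʳ g (Ring.trans (⊛-comm (inv1 f) f) (inv1-inverse f f₀))) (⊛-identityˡ g))

-- Lambert series

-- Both sides vanish unless `m = n`. It pulls a factor that depends only on the exponent out of the
-- sum for a coefficient; with the identity for `φ` this yields the derivative.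
δ-weight : ∀ m n (φ : ℕ → ℤ) x → δ m n * (φ m * x) ≡ φ n * (δ m n * x)
δ-weight m n φ x with m ℕ.≟ n
... | yes refl = trans (ℤ.*-identityˡ (φ m * x)) (cong (φ m *_) (sym (ℤ.*-identityˡ x)))
... | no _ = sym (ℤ.*-zeroʳ (φ n))

δ-> : ∀ {m n} → n ℕ.< m → ∀ x → δ m n * x ≡ 0ℤ
δ-> n<m x = cong (_* x) (δ-distinct (λ e → ℕ.<⇒≢ n<m (sym e)))

Σ²-extend : ∀ {n B} {F : ℕ → ℕ → ℤ} → n ℕ.≤ B → (∀ i j → n ℕ.≤ i → F i j ≡ 0ℤ) → (∀ i j → n ℕ.≤ j → F i j ≡ 0ℤ) →
  Σ² B F ≡ Σ² n F
Σ²-extend {n} {B} {F} n≤B e₁ e₂ = trans (Σ-cong B (λ i → Σ-extend n≤B (e₂ i)))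
  (Σ-extend n≤B (λ i n≤i → Σ-0 n (λ j → e₁ i j n≤i)))

Σ²-product : ∀ B (F G : ℕ → ℕ → ℤ) →
  Σ² B F * Σ² B G ≡ Σ² B (λ i j → Σ² B (λ k l → F i k * G j l))
Σ²-product B F G = trans (Σ-product _ _) (Σ²-cong B (λ i j → Σ-product (F i) (G j)))
  where
  Σ-product : ∀ f g → Σℤ B f * Σℤ B g ≡ Σ² B (λ i j → f i * g j)
  Σ-product f g = trans (sym (Σ-*ʳ B (Σℤ B g) f)) (Σ-cong B (λ i → sym (Σ-*ˡ B (f i) g)))

Σ²-transpose : ∀ B (F : ℕ → ℕ → ℤ) → Σ² B F ≡ Σ² B (λ i j → F j i)
Σ²-transpose B F = Σ-swap B B F

Σ²-swap : ∀ B (F : ℕ → ℕ → ℕ → ℕ → ℤ) →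
  Σ² B (λ i j → Σ² B (λ k l → F i j k l)) ≡ Σ² B (λ k l → Σ² B (λ i j → F i j k l))
Σ²-swap B F = begin
  Σ² B (λ i j → Σ² B (F i j))
    ≡⟨ Σ-cong B (λ i → Σ-swap B B (λ j k → Σℤ B (F i j k))) ⟩
  Σ² B (λ i k → Σ² B (λ j l → F i j k l))
    ≡⟨ Σ-swap B B _ ⟩
  Σ² B (λ k i → Σ² B (λ j l → F i j k l))
    ≡⟨ Σ²-cong B (λ k i → Σ-swap B B (λ j l → F i j k l)) ⟩
  Σ² B (λ k i → Σ² B (λ l j → F i j k l))
    ≡⟨ Σ-cong B (λ k → Σ-swap B B (λ i l → Σℤ B (λ j → F i j k l))) ⟩
  Σ² B (λ k l → Σ² B (λ i j → F i j k l)) ∎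

-- The series Σ f(a, x) q^(a x) over a, x ≥ 1. Since a x = n forces a, x ≤ n, a box of side `n`
-- suffices.
lambert : (ℕ → ℕ → ℤ) → Ser
lambert f n = Σ² n (λ i k → δ (suc i ℕ.* suc k) n * f (suc i) (suc k))

-- The two factors of a product contribute coefficients of different exponents up to `n`; a common
-- box is what allows their sums to be interchanged.
lambert-box : ∀ f {n B} → n ℕ.≤ B → Σ² B (λ i k → δ (suc i ℕ.* suc k) n * f (suc i) (suc k)) ≡ lambert f n
lambert-box f n≤B = Σ²-extend n≤B
  (λ i k n≤i → δ-> (ℕ.≤-trans (s≤s n≤i) (ℕ.m≤m*n (suc i) (suc k))) _)
  (λ i k n≤k → δ-> (ℕ.≤-trans (s≤s n≤k) (ℕ.m≤n*m (suc k) (suc i))) _)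

lambert-cong : ∀ f g → (∀ i k → f (suc i) (suc k) ≡ g (suc i) (suc k)) → lambert f ≐ lambert g
lambert-cong f g e .coeff n = Σ²-cong n (λ i k → cong (δ (suc i ℕ.* suc k) n *_) (e i k))

lambert-⊕ : ∀ f g → lambert (λ a x → f a x + g a x) ≐ lambert f ⊕ lambert g
lambert-⊕ f g .coeff n = trans (Σ²-cong n (λ i k → ℤ.*-distribˡ-+ (δ (suc i ℕ.* suc k) n) _ _)) (Σ²-+ n _ _)

lambert-· : ∀ c f → lambert (λ a x → c * f a x) ≐ c · lambert f
lambert-· c f .coeff n = trans (Σ-cong n (λ i → trans (Σ-cong n (λ k → δ-weight (suc i ℕ.* suc k) n (λ _ → c) _)) (Σ-*ˡ n c _))) (Σ-*ˡ n c _)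

lambert-D : ∀ f → lambert (λ a x → ℤ.+ (a ℕ.* x) * f a x) ≐ D (lambert f)
lambert-D f .coeff n = trans (Σ-cong n (λ i → trans (Σ-cong n (λ k → δ-weight (suc i ℕ.* suc k) n ℤ.+_ _)) (Σ-*ˡ n (ℤ.+ n) _))) (Σ-*ˡ n (ℤ.+ n) _)

lambert-transpose : ∀ f → lambert (λ a x → f x a) ≐ lambert f
lambert-transpose f .coeff n = trans (Σ²-transpose n _)
  (Σ²-cong n (λ i k → cong (λ m → δ m n * f (suc i) (suc k)) (ℕ.*-comm (suc k) (suc i))))

quadratic : (ℕ → ℕ → ℕ → ℕ → ℤ) → Ser
quadratic h n = Σ² n (λ i j → Σ² n (λ k l →
  δ (suc i ℕ.* suc k ℕ.+ suc j ℕ.* suc l) n * h (suc i) (suc j) (suc k) (suc l)))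

quadratic-cong : ∀ f g → (∀ a b x y → f a b x y ≡ g a b x y) → quadratic f ≐ quadratic g
quadratic-cong f g e .coeff n = Σ²-cong n (λ i j → Σ²-cong n (λ k l →
  cong (δ (suc i ℕ.* suc k ℕ.+ suc j ℕ.* suc l) n *_) (e _ _ _ _)))

quadratic-⊕ : ∀ f g → quadratic (λ a b x y → f a b x y + g a b x y) ≐ quadratic f ⊕ quadratic g
quadratic-⊕ f g .coeff n = trans (Σ²-cong n (λ i j → trans (Σ²-cong n (λ k l →
  ℤ.*-distribˡ-+ (δ (suc i ℕ.* suc k ℕ.+ suc j ℕ.* suc l) n) _ _)) (Σ²-+ n _ _))) (Σ²-+ n _ _)

quadratic-· : ∀ c f → quadratic (λ a b x y → c * f a b x y) ≐ c · quadratic f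
quadratic-· c f .coeff n = trans (Σ²-cong n (λ i j → trans (Σ-cong n (λ k → trans (Σ-cong n (λ l →
  δ-weight (suc i ℕ.* suc k ℕ.+ suc j ℕ.* suc l) n (λ _ → c) _)) (Σ-*ˡ n c _))) (Σ-*ˡ n c _)))
  (trans (Σ-cong n (λ i → Σ-*ˡ n c _)) (Σ-*ˡ n c _))

anti-Σ² : ∀ B (F : ℕ → ℕ → ℕ → ℕ → ℤ) n → anti (λ m r → Σ² B (F m r)) n ≡ Σ² B (λ i j → anti (λ m r → F m r i j) n)
anti-Σ² B F n = trans (Σ-swap (suc n) B _) (Σ-cong B (λ i → Σ-swap (suc n) B _))

lambert-⊛ : ∀ f g → lambert f ⊛ lambert g ≐ quadratic (λ a b x y → f a x * g b y)
lambert-⊛ f g .coeff n = begin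
  anti (λ m r → lambert f m * lambert g r) n
    ≡⟨ Σ-cong< (suc n) (λ k k≤n → cong₂ _*_ (sym (lambert-box f (ℕ.s≤s⁻¹ k≤n))) (sym (lambert-box g (ℕ.m∸n≤m n k)))) ⟩
  anti (λ m r → Σ² n (A m) * Σ² n (B r)) n
    ≡⟨ anti-cong (λ m r → Σ²-product n (A m) (B r)) n ⟩
  anti (λ m r → Σ² n (λ i j → Σ² n (λ k l → A m i k * B r j l))) n
    ≡⟨ anti-Σ² n (λ m r i j → Σ² n (λ k l → A m i k * B r j l)) n ⟩
  Σ² n (λ i j → anti (λ m r → Σ² n (λ k l → A m i k * B r j l)) n)
    ≡⟨ Σ²-cong n (λ i j → anti-Σ² n (λ m r k l → A m i k * B r j l) n) ⟩
  Σ² n (λ i j → Σ² n (λ k l → anti (λ m r → A m i k * B r j l) n))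
    ≡⟨ Σ²-cong n (λ i j → Σ²-cong n (λ k l → monomials (suc i ℕ.* suc k) (suc j ℕ.* suc l) (f (suc i) (suc k)) (g (suc j) (suc l)))) ⟩
  quadratic (λ a b x y → f a x * g b y) n ∎
  where
  A B : ℕ → ℕ → ℕ → ℤ
  A m i k = δ (suc i ℕ.* suc k) m * f (suc i) (suc k)
  B r j l = δ (suc j ℕ.* suc l) r * g (suc j) (suc l)
  interchange : ∀ a b c d → a * b * (c * d) ≡ a * c * (b * d)
  interchange = solve-∀
  monomials : ∀ p r x y → anti (λ m s → δ p m * x * (δ r s * y)) n ≡ δ (p ℕ.+ r) n * (x * y)
  monomials p r x y = trans (anti-cong (λ m s → interchange (δ p m) x (δ r s) y) n)
    (trans (Σ-*ʳ (suc n) (x * y) _) (cong (_* (x * y)) (δ-⊛ p r n)))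

-- Liouville's rearrangement of sums over a x + b y = n

middle : (ℕ → ℕ → ℕ → ℕ → ℤ) → Ser
middle h n = Σ² n (λ i j → Σ² n (λ k l →
  δ ((suc i ℕ.+ suc j) ℕ.* suc k ℕ.+ suc j ℕ.* suc l) n * h (suc i) (suc j) (suc k) (suc l)))

middle-0 : ∀ {h} → (∀ a b x y → h a b x y ≡ 0ℤ) → ∀ n → middle h n ≡ 0ℤ
middle-0 e n = Σ-0 n (λ i → Σ-0 n (λ j → Σ-0 n (λ k → Σ-0 n (λ l →
  trans (cong (δ ((suc i ℕ.+ suc j) ℕ.* suc k ℕ.+ suc j ℕ.* suc l) n *_) (e _ _ _ _)) (ℤ.*-zeroʳ (δ ((suc i ℕ.+ suc j) ℕ.* suc k ℕ.+ suc j ℕ.* suc l) n))))))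

Σ²²-+ : ∀ B (F G : ℕ → ℕ → ℕ → ℕ → ℤ) →
  Σ² B (λ i j → Σ² B (λ k l → F i j k l + G i j k l)) ≡
  Σ² B (λ i j → Σ² B (F i j)) + Σ² B (λ i j → Σ² B (G i j))
Σ²²-+ B F G = trans (Σ²-cong B (λ i j → Σ²-+ B (F i j) (G i j))) (Σ²-+ B _ _)

middle-+ : ∀ f g n → middle (λ a b x y → f a b x y + g a b x y) n ≡ middle f n + middle g n
middle-+ f g n = trans (Σ²-cong n (λ i j → Σ²-cong n (λ k l →
  ℤ.*-distribˡ-+ (δ ((suc i ℕ.+ suc j) ℕ.* suc k ℕ.+ suc j ℕ.* suc l) n) _ _))) (Σ²²-+ n _ _)

diagonal-a diagonal-x : (ℕ → ℕ → ℕ → ℕ → ℤ) → Ser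
diagonal-a h n = Σℤ n (λ i → Σ² n (λ k l → δ (suc i ℕ.* suc k ℕ.+ suc i ℕ.* suc l) n * h (suc i) (suc i) (suc k) (suc l)))
diagonal-x h n = Σℤ n (λ k → Σ² n (λ i j → δ (suc i ℕ.* suc k ℕ.+ suc j ℕ.* suc k) n * h (suc i) (suc j) (suc k) (suc k)))

m≤suc*suc+ : ∀ {n} i k r → n ℕ.≤ i → n ℕ.< suc i ℕ.* suc k ℕ.+ r
m≤suc*suc+ i k r n≤i = ℕ.≤-trans (s≤s n≤i) (ℕ.≤-trans (ℕ.m≤m*n (suc i) (suc k)) (ℕ.m≤m+n _ r))

-- Split by comparing the first two variables: if the first is larger, it is written `a + b`; the
-- opposite case is brought to the same exponent by exchanging the two terms a x and b y.
quadratic-a : ∀ h n → quadratic h n ≡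
  middle (λ a b x y → h (a ℕ.+ b) b x y + h b (a ℕ.+ b) y x) n + diagonal-a h n
quadratic-a h n = begin
  quadratic h n
    ≡⟨ Σ²-trichotomy n _
         (λ i j n≤i → Σ-0 n (λ k → Σ-0 n (λ l → δ-> (m≤suc*suc+ i k (suc j ℕ.* suc l) n≤i) _)))
         (λ i j n≤j → Σ-0 n (λ k → Σ-0 n (λ l → δ-> (subst (n ℕ.<_) (ℕ.+-comm (suc j ℕ.* suc l) _) (m≤suc*suc+ j l (suc i ℕ.* suc k) n≤j)) _))) ⟩
  middle (λ a b x y → h (a ℕ.+ b) b x y) n + diagonal-a h n +
    Σ² n (λ i j → Σ² n (λ k l → δ (suc j ℕ.* suc k ℕ.+ (suc i ℕ.+ suc j) ℕ.* suc l) n * h (suc j) (suc i ℕ.+ suc j) (suc k) (suc l)))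
    ≡⟨ cong (middle (λ a b x y → h (a ℕ.+ b) b x y) n + diagonal-a h n +_)
         (Σ²-cong n (λ i j → trans (Σ²-transpose n _) (Σ²-cong n (λ k l →
           cong (λ m → δ m n * h (suc j) (suc i ℕ.+ suc j) (suc l) (suc k)) (ℕ.+-comm (suc j ℕ.* suc l) _))))) ⟩
  middle (λ a b x y → h (a ℕ.+ b) b x y) n + diagonal-a h n + middle (λ a b x y → h b (a ℕ.+ b) y x) n
    ≡⟨ exchange (middle (λ a b x y → h (a ℕ.+ b) b x y) n) _ _ ⟩
  middle (λ a b x y → h (a ℕ.+ b) b x y) n + middle (λ a b x y → h b (a ℕ.+ b) y x) n + diagonal-a h n
    ≡⟨ cong (_+ diagonal-a h n) (middle-+ (λ a b x y → h (a ℕ.+ b) b x y) (λ a b x y → h b (a ℕ.+ b) y x) n) ⟨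
  middle (λ a b x y → h (a ℕ.+ b) b x y + h b (a ℕ.+ b) y x) n + diagonal-a h n ∎
  where
  exchange : ∀ x y z → x + y + z ≡ x + z + y
  exchange = solve-∀

-- Split by comparing the last two variables. Now `x` names the smaller of them, `y` their
-- difference and `b` the cofactor of the larger one, so that a x + b (y + x) becomes (a + b) x + b
-- y.
quadratic-x : ∀ h n → quadratic h n ≡
  middle (λ a b x y → h a b x (y ℕ.+ x) + h b a (y ℕ.+ x) x) n + diagonal-x h n
quadratic-x h n = begin
  quadratic h n
    ≡⟨ Σ²-swap n _ ⟩
  Σ² n (λ k l → Σ² n (λ i j → F i j k l))
    ≡⟨ Σ²-trichotomy n _
         (λ k l n≤k → Σ-0 n (λ i → Σ-0 n (λ j → δ-> (subst (n ℕ.<_) (cong (ℕ._+ suc j ℕ.* suc l) (ℕ.*-comm (suc k) (suc i)))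
           (m≤suc*suc+ k i (suc j ℕ.* suc l) n≤k)) _)))
         (λ k l n≤l → Σ-0 n (λ i → Σ-0 n (λ j → δ-> (subst (n ℕ.<_)
           (trans (cong (ℕ._+ suc i ℕ.* suc k) (ℕ.*-comm (suc l) (suc j))) (ℕ.+-comm (suc j ℕ.* suc l) (suc i ℕ.* suc k)))
           (m≤suc*suc+ l j (suc i ℕ.* suc k) n≤l)) _))) ⟩
  Σ² n (λ k l → Σ² n (λ i j → F i j (k ℕ.+ suc l) l)) + diagonal-x h n + Σ² n (λ k l → Σ² n (λ i j → F i j l (k ℕ.+ suc l)))
    ≡⟨ cong₂ _+_ (cong (_+ diagonal-x h n) below) above ⟩
  middle (λ a b x y → h b a (y ℕ.+ x) x) n + diagonal-x h n + middle (λ a b x y → h a b x (y ℕ.+ x)) n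
    ≡⟨ rotate (middle (λ a b x y → h b a (y ℕ.+ x) x) n) _ _ ⟩
  middle (λ a b x y → h a b x (y ℕ.+ x)) n + middle (λ a b x y → h b a (y ℕ.+ x) x) n + diagonal-x h n
    ≡⟨ cong (_+ diagonal-x h n) (middle-+ (λ a b x y → h a b x (y ℕ.+ x)) (λ a b x y → h b a (y ℕ.+ x) x) n) ⟨
  middle (λ a b x y → h a b x (y ℕ.+ x) + h b a (y ℕ.+ x) x) n + diagonal-x h n ∎
  where
  F : ℕ → ℕ → ℕ → ℕ → ℤ
  F i j k l = δ (suc i ℕ.* suc k ℕ.+ suc j ℕ.* suc l) n * h (suc i) (suc j) (suc k) (suc l)
  rotate : ∀ x y z → x + y + z ≡ z + x + y
  rotate = solve-∀
  exponent : ∀ a b x y → b ℕ.* (y ℕ.+ x) ℕ.+ a ℕ.* x ≡ (a ℕ.+ b) ℕ.* x ℕ.+ b ℕ.* y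
  exponent = ℕ-Solver.solve-∀
  exponent′ : ∀ a b x y → a ℕ.* x ℕ.+ b ℕ.* (y ℕ.+ x) ≡ (a ℕ.+ b) ℕ.* x ℕ.+ b ℕ.* y
  exponent′ = ℕ-Solver.solve-∀
  below : Σ² n (λ k l → Σ² n (λ i j → F i j (k ℕ.+ suc l) l)) ≡ middle (λ a b x y → h b a (y ℕ.+ x) x) n
  below = begin
    Σ² n (λ k l → Σ² n (λ i j → F i j (k ℕ.+ suc l) l))
      ≡⟨ Σ²-transpose n _ ⟩
    Σ² n (λ k l → Σ² n (λ i j → F i j (l ℕ.+ suc k) k))
      ≡⟨ Σ²-swap n (λ k l i j → F i j (l ℕ.+ suc k) k) ⟩
    Σ² n (λ i j → Σ² n (λ k l → F i j (l ℕ.+ suc k) k))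
      ≡⟨ Σ²-transpose n _ ⟩
    Σ² n (λ i j → Σ² n (λ k l → F j i (l ℕ.+ suc k) k))
      ≡⟨ Σ²-cong n (λ i j → Σ²-cong n (λ k l → cong (λ m → δ m n * h (suc j) (suc i) (suc l ℕ.+ suc k) (suc k))
           (exponent (suc i) (suc j) (suc k) (suc l)))) ⟩
    middle (λ a b x y → h b a (y ℕ.+ x) x) n ∎
  above : Σ² n (λ k l → Σ² n (λ i j → F i j l (k ℕ.+ suc l))) ≡ middle (λ a b x y → h a b x (y ℕ.+ x)) n
  above = begin
    Σ² n (λ k l → Σ² n (λ i j → F i j l (k ℕ.+ suc l)))
      ≡⟨ Σ²-transpose n _ ⟩
    Σ² n (λ k l → Σ² n (λ i j → F i j k (l ℕ.+ suc k)))
      ≡⟨ Σ²-swap n (λ k l i j → F i j k (l ℕ.+ suc k)) ⟩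
    Σ² n (λ i j → Σ² n (λ k l → F i j k (l ℕ.+ suc k)))
      ≡⟨ Σ²-cong n (λ i j → Σ²-cong n (λ k l → cong (λ m → δ m n * h (suc i) (suc j) (suc k) (suc l ℕ.+ suc k))
           (exponent′ (suc i) (suc j) (suc k) (suc l)))) ⟩
    middle (λ a b x y → h a b x (y ℕ.+ x)) n ∎

antidiagonal-row : ∀ n a (p Φ : ℕ → ℕ → ℤ) →
  (∀ k l → p (suc k) (suc l) ≡ Φ (suc k) l - Φ k (suc l)) →
  Σ² n (λ k l → δ (suc a ℕ.* suc k ℕ.+ suc a ℕ.* suc l) n * p (suc k) (suc l)) ≡
  Σℤ n (λ e → δ (suc a ℕ.* suc e) n * (Φ e 0 - Φ 0 e))
antidiagonal-row n a p Φ pΦ = begin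
  Σ² n F
    ≡⟨ Σ²-antidiagonals n F (λ k l n≤ → δ-> (large k l n≤) _) ⟩
  Σℤ n (anti F)
    ≡⟨ Σ-cong n (λ m → trans (Σ-cong< (suc m) (λ k k≤m → cong₂ _*_ (cong (λ s → δ s n) (level k (m ∸ k) m (ℕ.m+[n∸m]≡n (ℕ.s≤s⁻¹ k≤m))))
         (pΦ k (m ∸ k))))
         (trans (Σ-*ˡ (suc m) (δ (suc a ℕ.* suc (suc m)) n) _) (cong (δ (suc a ℕ.* suc (suc m)) n *_) (anti-telescope Φ m)))) ⟩
  Σℤ n (λ m → G (suc m))
    ≡⟨ trans (cong (_+ Σℤ n (λ m → G (suc m))) G₀) (ℤ.+-identityˡ _) ⟨
  G 0 + Σℤ n (λ m → G (suc m))
    ≡⟨ Σ-first n G ⟨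
  Σℤ (suc n) G
    ≡⟨ trans (cong (Σℤ n G +_) (δ-> (ℕ.m≤n*m (suc n) (suc a)) _)) (ℤ.+-identityʳ _) ⟩
  Σℤ n G ∎
  where
  F : ℕ → ℕ → ℤ
  F k l = δ (suc a ℕ.* suc k ℕ.+ suc a ℕ.* suc l) n * p (suc k) (suc l)
  G : ℕ → ℤ
  G e = δ (suc a ℕ.* suc e) n * (Φ e 0 - Φ 0 e)
  -- The index `e` stands for x + y = e + 1. Two positive numbers never add up to 1, but the Lambert
  -- form includes that value; its two boundary terms cancel.
  G₀ : G 0 ≡ 0ℤ
  G₀ = trans (cong (δ (suc a ℕ.* 1) n *_) (ℤ.+-inverseʳ (Φ 0 0))) (ℤ.*-zeroʳ (δ (suc a ℕ.* 1) n))
  sum : ∀ k l → suc a ℕ.* suc k ℕ.+ suc a ℕ.* suc l ≡ suc a ℕ.* suc (suc (k ℕ.+ l))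
  sum k l = trans (sym (ℕ.*-distribˡ-+ (suc a) (suc k) (suc l))) (cong (λ s → suc a ℕ.* suc s) (ℕ.+-suc k l))
  level : ∀ k l m → k ℕ.+ l ≡ m → suc a ℕ.* suc k ℕ.+ suc a ℕ.* suc l ≡ suc a ℕ.* suc (suc m)
  level k l m refl = sum k l
  large : ∀ k l → n ℕ.≤ k ℕ.+ l → n ℕ.< suc a ℕ.* suc k ℕ.+ suc a ℕ.* suc l
  large k l n≤ = subst (n ℕ.<_) (sym (sum k l)) (ℕ.≤-trans (s≤s (ℕ.m≤n⇒m≤1+n n≤)) (ℕ.m≤n*m (suc (suc (k ℕ.+ l))) (suc a)))

-- The diagonal a = b contributes the two ends of the telescoped sum over x + y = const, the
-- diagonal x = y those of the sum over a + b = const. The ends lie one below that constant, hence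
-- `pred`.
boundary : (Φ Ψ : ℕ → ℕ → ℕ → ℤ) → ℕ → ℕ → ℤ
boundary Φ Ψ a x = (Φ a (ℕ.pred x) 0 - Φ a 0 (ℕ.pred x)) + (Ψ x (ℕ.pred a) 0 - Ψ x 0 (ℕ.pred a))

-- The substitutions (a, b, x, y) ↦ (a + b, b, x, y) and (a, b, x, y) ↦ (a, b, x, y + x) send the exponent
-- a x + b y to the same form (a + b) x + b y, so the parts off the diagonals a = b and x = y can be cancelled
-- against each other.
quadratic-lambert : ∀ (f h : ℕ → ℕ → ℕ → ℕ → ℤ) (Φ Ψ : ℕ → ℕ → ℕ → ℤ) →
  (∀ a b x y → f (a ℕ.+ b) b x y + f b (a ℕ.+ b) y x + (h a b x (y ℕ.+ x) + h b a (y ℕ.+ x) x) ≡ 0ℤ) →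
  (∀ a k l → f a a (suc k) (suc l) ≡ Φ a (suc k) l - Φ a k (suc l)) →
  (∀ x i j → h (suc i) (suc j) x x ≡ Ψ x (suc i) j - Ψ x i (suc j)) →
  quadratic (λ a b x y → f a b x y + h a b x y) ≐
  lambert (boundary Φ Ψ)
quadratic-lambert f h Φ Ψ cancel fΦ hΨ = pointwise (λ n → begin
  quadratic (λ a b x y → f a b x y + h a b x y) n
    ≡⟨ coeff (quadratic-⊕ f h) n ⟩
  quadratic f n + quadratic h n
    ≡⟨ cong₂ _+_ (quadratic-a f n) (quadratic-x h n) ⟩
  middle f⁺ n + diagonal-a f n + (middle h⁺ n + diagonal-x h n)
    ≡⟨ regroup (middle f⁺ n) (diagonal-a f n) (middle h⁺ n) (diagonal-x h n) ⟩
  middle f⁺ n + middle h⁺ n + (diagonal-a f n + diagonal-x h n)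
    ≡⟨ cong (_+ (diagonal-a f n + diagonal-x h n)) (trans (sym (middle-+ f⁺ h⁺ n)) (middle-0 cancel n)) ⟩
  0ℤ + (diagonal-a f n + diagonal-x h n)
    ≡⟨ ℤ.+-identityˡ (diagonal-a f n + diagonal-x h n) ⟩
  diagonal-a f n + diagonal-x h n
    ≡⟨ cong₂ _+_ (row-a n) (row-x n) ⟩
  lambert φ n + lambert ψ n
    ≡⟨ coeff (lambert-⊕ φ ψ) n ⟨
  lambert (λ a x → φ a x + ψ a x) n ∎)
  where
  f⁺ h⁺ : ℕ → ℕ → ℕ → ℕ → ℤ
  f⁺ a b x y = f (a ℕ.+ b) b x y + f b (a ℕ.+ b) y x
  h⁺ a b x y = h a b x (y ℕ.+ x) + h b a (y ℕ.+ x) x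
  φ ψ : ℕ → ℕ → ℤ
  φ a x = Φ a (ℕ.pred x) 0 - Φ a 0 (ℕ.pred x)
  ψ a x = Ψ x (ℕ.pred a) 0 - Ψ x 0 (ℕ.pred a)
  regroup : ∀ m d m′ d′ → m + d + (m′ + d′) ≡ m + m′ + (d + d′)
  regroup = solve-∀
  row-a : ∀ n → diagonal-a f n ≡ lambert φ n
  row-a n = Σ-cong n (λ i → antidiagonal-row n i (f (suc i) (suc i)) (Φ (suc i)) (fΦ (suc i)))
  row-x : ∀ n → diagonal-x h n ≡ lambert ψ n
  row-x n = trans (Σ-cong n (λ k → trans
      (Σ²-cong n (λ i j → cong₂ (λ u v → δ (u ℕ.+ v) n * h (suc i) (suc j) (suc k) (suc k))
        (ℕ.*-comm (suc i) (suc k)) (ℕ.*-comm (suc j) (suc k))))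
      (antidiagonal-row n k (λ i j → h i j (suc k) (suc k)) (Ψ (suc k)) (hΨ (suc k)))))
    (coeff (lambert-transpose ψ) n)

-- Weights depending on residues modulo 3

-- With constructors for the residues, `next` and `_⊞_` compute, and a table indexed by residues
-- reduces to a closed polynomial in each case.
data Residue : Set where
  r0 r1 r2 : Residue

next : Residue → Residue
next r0 = r1
next r1 = r2
next r2 = r0

ρ : ℕ → Residue
ρ zero    = r0
ρ (suc n) = next (ρ n)

_⊞_ : Residue → Residue → Residue
r0 ⊞ s = s
r1 ⊞ s = next s
r2 ⊞ s = next (next s)

next-⊞ : ∀ r s → next (r ⊞ s) ≡ next r ⊞ s
next-⊞ r0 s  = refl
next-⊞ r1 s  = refl
next-⊞ r2 r0 = refl
next-⊞ r2 r1 = refl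
next-⊞ r2 r2 = refl

ρ-+ : ∀ m n → ρ (m ℕ.+ n) ≡ ρ m ⊞ ρ n
ρ-+ zero    n = refl
ρ-+ (suc m) n = trans (cong next (ρ-+ m n)) (next-⊞ (ρ m) (ρ n))

-- A record and not a function: by eta, a placeholder of this type expands into its cases, which are
-- then filled one by one.
record ∀-Residue (Q : Residue → Set) : Set where
  constructor residues
  field
    at-r0 : Q r0
    at-r1 : Q r1
    at-r2 : Q r2

at : ∀ {Q} → ∀-Residue Q → ∀ r → Q r
at (residues q _ _) r0 = q
at (residues _ q _) r1 = q
at (residues _ _ q) r2 = q

-- Polynomial identities decided by normal forms

module Polynomials where
  open Data.Integer.Solver.+-*-Solver public
    using (Polynomial; op; [+]; [*]; con; var; _:^_; :-_; _:+_; _:*_; _:-_; ⟦_⟧)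
  open Data.Integer.Solver.+-*-Solver using (normalise; _≟N_; ⟦_⟧N-cong; correct)

  -- Substitution acts on syntax, so that weights at shifted arguments such as a + b or x + 1 are
  -- again polynomials with a normal form.
  _[_] : ∀ {m n} → Polynomial m → Vec (Polynomial n) m → Polynomial n
  op o p q [ σ ] = op o (p [ σ ]) (q [ σ ])
  con c    [ σ ] = con c
  var i    [ σ ] = lookup σ i
  (p :^ k) [ σ ] = (p [ σ ]) :^ k
  (:- p)   [ σ ] = :- (p [ σ ])

  ⟦⟧-[] : ∀ {m n} (p : Polynomial m) (σ : Vec (Polynomial n) m) (v : Vec ℤ n) →
    ⟦ p [ σ ] ⟧ v ≡ ⟦ p ⟧ (map (λ u → ⟦ u ⟧ v) σ)
  ⟦⟧-[] (op [+] p q) σ v = cong₂ _+_ (⟦⟧-[] p σ v) (⟦⟧-[] q σ v)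
  ⟦⟧-[] (op [*] p q) σ v = cong₂ _*_ (⟦⟧-[] p σ v) (⟦⟧-[] q σ v)
  ⟦⟧-[] (con c)      σ v = refl
  ⟦⟧-[] (var i)      σ v = sym (lookup-map i (λ u → ⟦ u ⟧ v) σ)
  -- The power operation of the solver's semantics is reached as the value of a one-variable
  -- polynomial.
  ⟦⟧-[] (p :^ k)     σ v = cong (λ x → ⟦ var {1} zero :^ k ⟧ (x ∷ [])) (⟦⟧-[] p σ v)
  ⟦⟧-[] (:- p)       σ v = cong -_ (⟦⟧-[] p σ v)

  infix 4 _≟≟_
  -- The field reduces to the unit type once the normal forms agree, so a placeholder of this type
  -- is filled by evaluation.
  record _≟≟_ {n} (p q : Polynomial n) : Set where
    constructor decided
    field same-normal-form : T (is-just (normalise p ≟N normalise q))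

  sound : ∀ {n} {p q : Polynomial n} → p ≟≟ q → ∀ v → ⟦ p ⟧ v ≡ ⟦ q ⟧ v
  sound {p = p} {q} (decided eq) v with normalise p ≟N normalise q
  ... | just e = trans (sym (correct p v)) (trans (⟦ e ⟧N-cong v) (correct q v))

module _ where
  open Polynomials

  X Y : Polynomial 2
  X = var zero
  Y = var (suc zero)

  ⌜_⌝ : ℕ → Polynomial 2
  ⌜ n ⌝ = con (ℤ.+ n)

  value : Polynomial 2 → ℕ → ℕ → ℤ
  value p m n = ⟦ p ⟧ (ℤ.+ m ∷ ℤ.+ n ∷ [])

  substituted : ∀ p u v m n {k l} → ⟦ u ⟧ (ℤ.+ m ∷ ℤ.+ n ∷ []) ≡ ℤ.+ k → ⟦ v ⟧ (ℤ.+ m ∷ ℤ.+ n ∷ []) ≡ ℤ.+ l →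
    value (p [ u ∷ v ∷ [] ]) m n ≡ value p k l
  substituted p u v m n e₁ e₂ = trans (⟦⟧-[] p (u ∷ v ∷ []) _) (cong₂ (λ x y → ⟦ p ⟧ (x ∷ y ∷ [])) e₁ e₂)

  ⁺X ⁺Y : Polynomial 2
  ⁺X = ⌜ 1 ⌝ :+ X
  ⁺Y = ⌜ 1 ⌝ :+ Y

  Table : Set
  Table = Residue → Residue → Polynomial 2

  table : (p₀₀ p₀₁ p₀₂ p₁₀ p₁₁ p₁₂ p₂₀ p₂₁ p₂₂ : Polynomial 2) → Table
  table p₀₀ p₀₁ p₀₂ p₁₀ p₁₁ p₁₂ p₂₀ p₂₁ p₂₂ = λ where
    r0 r0 → p₀₀
    r0 r1 → p₀₁
    r0 r2 → p₀₂
    r1 r0 → p₁₀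
    r1 r1 → p₁₁
    r1 r2 → p₁₂
    r2 r0 → p₂₀
    r2 r1 → p₂₁
    r2 r2 → p₂₂

  column : (p₀ p₁ p₂ : Polynomial 2) → Residue → Polynomial 2
  column p₀ p₁ p₂ = λ where
    r0 → p₀
    r1 → p₁
    r2 → p₂

  ∀-Residue² : (Residue → Residue → Set) → Set
  ∀-Residue² Q = ∀-Residue (λ r → ∀-Residue (Q r))

  Λ : Table → Ser
  Λ w = lambert (λ a x → value (w (ρ a) (ρ x)) a x)

  -- Every hypothesis is a closed statement decided by normalisation: h is the part of g = f + h to which the
  -- second substitution of quadratic-lambert is applied, and Φ, Ψ are discrete antiderivatives of f along
  -- x + y = const and of h along a + b = const.
  quadratic-x-table : (g h Φ : Table) (Ψ w : Residue → Polynomial 2) →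
    let f = λ r s → g r s :- h r s in
    ∀-Residue² (λ r s → f r s [ X :+ Y ∷ Y ∷ [] ] :+ f s r [ Y ∷ X :+ Y ∷ [] ] :+
                         (h r (s ⊞ r) [ X ∷ Y ∷ [] ] :+ h (s ⊞ r) r [ Y ∷ X ∷ [] ]) ≟≟ ⌜ 0 ⌝) →
    ∀-Residue² (λ r s → f (next r) (next s) [ X ∷ X ∷ [] ] ≟≟ Φ (next r) s [ X ∷ ⁺Y ∷ [] ] :- Φ r (next s) [ X ∷ Y ∷ [] ]) →
    ∀-Residue (λ r → h r r [ ⁺X ∷ ⁺Y ∷ [] ] ≟≟ Ψ r [ ⁺X ∷ Y ∷ [] ] :- Ψ r [ X ∷ ⁺Y ∷ [] ]) →
    ∀-Residue (λ r → (Φ r r0 [ ⁺X ∷ Y ∷ [] ] :- Φ r0 r [ ⁺X ∷ ⌜ 0 ⌝ ∷ [] ]) :+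
                     (Ψ (next r) [ X ∷ ⌜ 0 ⌝ ∷ [] ] :- Ψ (next r) [ ⌜ 0 ⌝ ∷ X ∷ [] ]) ≟≟ w (next r) [ ⁺X ∷ ⁺Y ∷ [] ]) →
    quadratic (λ a b x y → value (g (ρ x) (ρ y)) a b) ≐ Λ (λ _ s → w s)
  quadratic-x-table g h Φ Ψ w cancel fΦ hΨ total = Ring.trans
    (quadratic-cong (λ a b x y → value (g (ρ x) (ρ y)) a b)
      (λ a b x y → value (f (ρ x) (ρ y)) a b + value (h (ρ x) (ρ y)) a b)
      (λ a b x y → complement (value (g (ρ x) (ρ y)) a b) (value (h (ρ x) (ρ y)) a b)))
    (Ring.trans
      (quadratic-lambert (λ a b x y → value (f (ρ x) (ρ y)) a b) (λ a b x y → value (h (ρ x) (ρ y)) a b)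
        (λ a k l → value (Φ (ρ k) (ρ l)) a k) (λ x i j → value (Ψ (ρ x)) i j)
        (λ a b x y → trans
          (cong₂ _+_ (sym (cong₂ _+_ (substituted (f (ρ x) (ρ y)) (X :+ Y) Y a b refl refl)
                                     (substituted (f (ρ y) (ρ x)) Y (X :+ Y) a b refl refl)))
            (trans (cong (λ s → value (h (ρ x) s) a b + value (h s (ρ x)) b a) (ρ-+ y x))
              (sym (cong₂ _+_ (substituted (h (ρ x) (ρ y ⊞ ρ x)) X Y a b refl refl)
                              (substituted (h (ρ y ⊞ ρ x) (ρ x)) Y X a b refl refl)))))
          (sound (at (at cancel (ρ x)) (ρ y)) (ℤ.+ a ∷ ℤ.+ b ∷ [])))
        (λ a k l → trans (sym (substituted (f (next (ρ k)) (next (ρ l))) X X a k refl refl))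
          (trans (sound (at (at fΦ (ρ k)) (ρ l)) (ℤ.+ a ∷ ℤ.+ k ∷ []))
            (cong₂ _-_ (substituted (Φ (next (ρ k)) (ρ l)) X ⁺Y a k refl refl)
                       (substituted (Φ (ρ k) (next (ρ l))) X Y a k refl refl))))
        (λ x i j → trans (sym (substituted (h (ρ x) (ρ x)) ⁺X ⁺Y i j refl refl))
          (trans (sound (at hΨ (ρ x)) (ℤ.+ i ∷ ℤ.+ j ∷ []))
            (cong₂ _-_ (substituted (Ψ (ρ x)) ⁺X Y i j refl refl) (substituted (Ψ (ρ x)) X ⁺Y i j refl refl)))))
      (lambert-cong (boundary (λ a k l → value (Φ (ρ k) (ρ l)) a k) (λ x i j → value (Ψ (ρ x)) i j))
        (λ a x → value (w (ρ x)) a x) (λ d e → trans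
        (sym (cong₂ _+_
          (cong₂ _-_ (substituted (Φ (ρ e) r0) ⁺X Y d e refl refl) (substituted (Φ r0 (ρ e)) ⁺X ⌜ 0 ⌝ d e refl refl))
          (cong₂ _-_ (substituted (Ψ (next (ρ e))) X ⌜ 0 ⌝ d e refl refl) (substituted (Ψ (next (ρ e))) ⌜ 0 ⌝ X d e refl refl))))
        (trans (sound (at total (ρ e)) (ℤ.+ d ∷ ℤ.+ e ∷ []))
          (substituted (w (next (ρ e))) ⁺X ⁺Y d e refl refl)))))
    where
    f : Table
    f r s = g r s :- h r s
    complement : ∀ g h → g ≡ g + - h + h
    complement = solve-∀

  -- The counterpart for weights in the residues of a and b. Here `f` is constant along x + y =
  -- const, so its antiderivative is linear and only `Ψ` has to be supplied; the factor `Y` in the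
  -- last hypothesis counts the solutions of x + y = Y + 1.
  quadratic-a-table : (g h Ψ : Table) (w : Residue → Polynomial 2) →
    let f = λ r s → g r s :- h r s in
    ∀-Residue² (λ r s → f (r ⊞ s) s [ X :+ Y ∷ Y ∷ [] ] :+ f s (r ⊞ s) [ Y ∷ X :+ Y ∷ [] ] :+
                         (h r s [ X ∷ Y ∷ [] ] :+ h s r [ Y ∷ X ∷ [] ]) ≟≟ ⌜ 0 ⌝) →
    ∀-Residue² (λ r s → h (next r) (next s) [ ⁺X ∷ ⁺Y ∷ [] ] ≟≟ Ψ (next r) s [ ⁺X ∷ Y ∷ [] ] :- Ψ r (next s) [ X ∷ ⁺Y ∷ [] ]) →
    ∀-Residue (λ r → f (next r) (next r) [ ⁺X ∷ ⁺X ∷ [] ] :* Y :+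
                     (Ψ r r0 [ X ∷ ⌜ 0 ⌝ ∷ [] ] :- Ψ r0 r [ ⌜ 0 ⌝ ∷ X ∷ [] ]) ≟≟ w (next r) [ ⁺X ∷ ⁺Y ∷ [] ]) →
    quadratic (λ a b x y → value (g (ρ a) (ρ b)) a b) ≐ Λ (λ r _ → w r)
  quadratic-a-table g h Ψ w cancel hΨ total = Ring.trans
    (quadratic-cong (λ a b x y → value (g (ρ a) (ρ b)) a b)
      (λ a b x y → value (f (ρ a) (ρ b)) a b + value (h (ρ a) (ρ b)) a b)
      (λ a b x y → complement (value (g (ρ a) (ρ b)) a b) (value (h (ρ a) (ρ b)) a b)))
    (Ring.trans
      (quadratic-lambert (λ a b x y → value (f (ρ a) (ρ b)) a b) (λ a b x y → value (h (ρ a) (ρ b)) a b)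
        (λ a k l → value (f (ρ a) (ρ a)) a a * ℤ.+ k) (λ x i j → value (Ψ (ρ i) (ρ j)) i j)
        (λ a b x y → trans
          (cong₂ _+_
            (trans (cong (λ r → value (f r (ρ b)) (a ℕ.+ b) b + value (f (ρ b) r) b (a ℕ.+ b)) (ρ-+ a b))
              (sym (cong₂ _+_ (substituted (f (ρ a ⊞ ρ b) (ρ b)) (X :+ Y) Y a b refl refl)
                              (substituted (f (ρ b) (ρ a ⊞ ρ b)) Y (X :+ Y) a b refl refl))))
            (sym (cong₂ _+_ (substituted (h (ρ a) (ρ b)) X Y a b refl refl)
                            (substituted (h (ρ b) (ρ a)) Y X a b refl refl))))
          (sound (at (at cancel (ρ a)) (ρ b)) (ℤ.+ a ∷ ℤ.+ b ∷ [])))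
        (λ a k l → increment (value (f (ρ a) (ρ a)) a a) (ℤ.+ k))
        (λ x i j → trans (sym (substituted (h (next (ρ i)) (next (ρ j))) ⁺X ⁺Y i j refl refl))
          (trans (sound (at (at hΨ (ρ i)) (ρ j)) (ℤ.+ i ∷ ℤ.+ j ∷ []))
            (cong₂ _-_ (substituted (Ψ (next (ρ i)) (ρ j)) ⁺X Y i j refl refl)
                       (substituted (Ψ (ρ i) (next (ρ j))) X ⁺Y i j refl refl)))))
      (lambert-cong (boundary (λ a k l → value (f (ρ a) (ρ a)) a a * ℤ.+ k) (λ x i j → value (Ψ (ρ i) (ρ j)) i j))
        (λ a x → value (w (ρ a)) a x) (λ d e → trans
        (cong₂ _+_
          (trans (minus-0 (value (f (next (ρ d)) (next (ρ d))) (suc d) (suc d)) (ℤ.+ e))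
            (cong (_* ℤ.+ e) (sym (substituted (f (next (ρ d)) (next (ρ d))) ⁺X ⁺X d e refl refl))))
          (sym (cong₂ _-_ (substituted (Ψ (ρ d) r0) X ⌜ 0 ⌝ d e refl refl) (substituted (Ψ r0 (ρ d)) ⌜ 0 ⌝ X d e refl refl))))
        (trans (sound (at total (ρ d)) (ℤ.+ d ∷ ℤ.+ e ∷ []))
          (substituted (w (next (ρ d))) ⁺X ⁺Y d e refl refl)))))
    where
    f : Table
    f r s = g r s :- h r s
    complement : ∀ g h → g ≡ g + - h + h
    complement = solve-∀
    increment : ∀ c k → c ≡ c * (1ℤ + k) - c * k
    increment = solve-∀
    minus-0 : ∀ c k → c * k - c * 0ℤ ≡ c * k
    minus-0 = solve-∀

  -- Besides the character χ: ν is the principal character modulo 3, ζ the indicator of the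
  -- multiples of 3, and ψ(n) = -(ω^n + ω^(-n)) for a primitive cube root of unity ω. Thus ν = 1 - ζ
  -- and ψ = 1 - 3 ζ.
  χ ν ψ ζ : Residue → ℤ
  χ r0 = 0ℤ
  χ r1 = 1ℤ
  χ r2 = - 1ℤ
  ν r0 = 0ℤ
  ν r1 = 1ℤ
  ν r2 = 1ℤ
  ψ r0 = - (ℤ.+ 2)
  ψ r1 = 1ℤ
  ψ r2 = 1ℤ
  ζ r0 = 1ℤ
  ζ r1 = 0ℤ
  ζ r2 = 0ℤ

  X² X³ X⁴ Y² Y³ : Polynomial 2
  X² = X :* X
  X³ = X² :* X
  X⁴ = X³ :* X
  Y² = Y :* Y
  Y³ = Y² :* Y

  by-a by-x : (Residue → Polynomial 2) → Table
  by-a w r _ = w r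
  by-x w _ s = w s

  χ₀ χ₂ χ₄ ν₁ ψ₁ ζ₁ : Residue → Polynomial 2
  χ₀ r = con (χ r)
  χ₂ r = con (χ r) :* X²
  χ₄ r = con (χ r) :* X⁴
  ν₁ r = con (ν r) :* X
  ψ₁ r = con (ψ r) :* X
  ζ₁ r = con (ζ r) :* X

  Λ-⊕ : ∀ p q → Λ (λ r s → p r s :+ q r s) ≐ Λ p ⊕ Λ q
  Λ-⊕ p q = lambert-⊕ (λ a x → value (p (ρ a) (ρ x)) a x) (λ a x → value (q (ρ a) (ρ x)) a x)

  Λ-· : ∀ c p → Λ (λ r s → con c :* p r s) ≐ c · Λ p
  Λ-· c p = lambert-· c (λ a x → value (p (ρ a) (ρ x)) a x)

  Λ-D : ∀ p → Λ (λ r s → X :* Y :* p r s) ≐ D (Λ p)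
  Λ-D p = Ring.trans
    (lambert-cong (λ a x → value (X :* Y :* p (ρ a) (ρ x)) a x) (λ a x → ℤ.+ (a ℕ.* x) * value (p (ρ a) (ρ x)) a x)
      (λ i k → cong (_* value (p (ρ (suc i)) (ρ (suc k))) (suc i) (suc k)) (sym (ℤ.pos-* (suc i) (suc k)))))
    (lambert-D (λ a x → value (p (ρ a) (ρ x)) a x))

  Λ-cong : ∀ p q → (∀ r s m n → value (p r s) m n ≡ value (q r s) m n) → Λ p ≐ Λ q
  Λ-cong p q e = lambert-cong (λ a x → value (p (ρ a) (ρ x)) a x) (λ a x → value (q (ρ a) (ρ x)) a x) (λ i k → e _ _ (suc i) (suc k))

  ⊛-quadratic : ∀ c p q G → (∀ a b x y → c * (value (p (ρ a) (ρ x)) a x * value (q (ρ b) (ρ y)) b y) ≡ G a b x y) →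
    c • (Λ p ⊛ Λ q) ≐ quadratic G
  ⊛-quadratic c p q G e = Ring.trans (Ring.sym (·-• c (Λ p ⊛ Λ q))) (Ring.trans
    (pointwise (λ n → cong (c *_) (coeff (lambert-⊛ (λ a x → value (p (ρ a) (ρ x)) a x) (λ a x → value (q (ρ a) (ρ x)) a x)) n)))
    (Ring.trans (Ring.sym (quadratic-· c (λ a b x y → value (p (ρ a) (ρ x)) a x * value (q (ρ b) (ρ y)) b y)))
      (quadratic-cong (λ a b x y → c * (value (p (ρ a) (ρ x)) a x * value (q (ρ b) (ρ y)) b y)) G e)))

  Λ-• : ∀ c p → Λ (λ r s → con c :* p r s) ≐ c • Λ p
  Λ-• c p = Ring.trans (Λ-· c p) (·-• c (Λ p))

  -- The Lambert series of weights 1, 2, 3 and 5 and their quadratic relations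

  A Aˣ N S Sˣ S′ V K E F R : Ser
  A  = Λ (by-a χ₀)
  Aˣ = Λ (by-x χ₀)
  N  = Λ (by-x ν₁)
  S  = Λ (by-a ν₁)
  Sˣ = Λ (by-x ψ₁)
  S′ = Λ (by-a ψ₁)
  V  = Λ (by-x χ₂)
  K  = Λ (by-a χ₂)
  E  = Λ (by-x χ₄)
  F  = Λ (by-a χ₄)
  R  = Λ (λ _ _ → X)

  -- The weight contains no power of a, so exchanging a and x only moves the character. `A` can thus
  -- be multiplied with series whose residues sit on either variable.
  A-transpose : A ≐ Aˣ
  A-transpose = Ring.sym (lambert-transpose (λ a x → χ (ρ a)))

  infixl 6 _⊕ᵗ_
  infixr 8 _•ᵗ_
  infix 4 _represents_

  -- Pairs a series with a weight table for it, so that the Lambert series left over by Liouville's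
  -- method can be read as a combination of named series and their derivatives.
  record _represents_ (p : Table) (f : Ser) : Set where
    constructor representation
    field Λ≐ : Λ p ≐ f
  open _represents_

  itself : ∀ p → p represents Λ p
  itself p = representation Ring.refl

  _⊕ᵗ_ : ∀ {p q f g} → p represents f → q represents g → (λ r s → p r s :+ q r s) represents (f ⊕ g)
  _⊕ᵗ_ {p} {q} u v = representation (Ring.trans (Λ-⊕ p q) (Ring.+-cong (Λ≐ u) (Λ≐ v)))

  _•ᵗ_ : ∀ c {p f} → p represents f → (λ r s → con c :* p r s) represents (c • f)
  _•ᵗ_ c {p} u = representation (Ring.trans (Λ-• c p) (•-cong c (Λ≐ u)))

  Dᵗ : ∀ {p f} → p represents f → (λ r s → X :* Y :* p r s) represents D f
  Dᵗ {p} u = representation (Ring.trans (Λ-D p) (D-cong (Λ≐ u)))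

  Σ-multiples-of-3 : ∀ B (f : ℕ → ℤ) → Σℤ (3 ℕ.* B) (λ i → ζ (ρ (suc i)) * f (suc i)) ≡ Σℤ B (λ j → f (3 ℕ.* suc j))
  Σ-multiples-of-3 zero    f = refl
  Σ-multiples-of-3 (suc B) f = begin
    Σℤ (3 ℕ.* suc B) g
      ≡⟨ cong (λ m → Σℤ m g) (ℕ.*-suc 3 B) ⟩
    Σℤ (3 ℕ.* B) g + g (3 ℕ.* B) + g (1 ℕ.+ 3 ℕ.* B) + g (2 ℕ.+ 3 ℕ.* B)
      ≡⟨ cong (λ r → Σℤ (3 ℕ.* B) g + ζ (next r) * f (1 ℕ.+ 3 ℕ.* B) + ζ (next (next r)) * f (2 ℕ.+ 3 ℕ.* B)
           + ζ (next (next (next r))) * f (3 ℕ.+ 3 ℕ.* B)) (ρ-3 B) ⟩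
    Σℤ (3 ℕ.* B) g + 0ℤ + 0ℤ + 1ℤ * f (3 ℕ.+ 3 ℕ.* B)
      ≡⟨ simplify (Σℤ (3 ℕ.* B) g) (f (3 ℕ.+ 3 ℕ.* B)) ⟩
    Σℤ (3 ℕ.* B) g + f (3 ℕ.+ 3 ℕ.* B)
      ≡⟨ cong₂ _+_ (Σ-multiples-of-3 B f) (cong f (sym (ℕ.*-suc 3 B))) ⟩
    Σℤ (suc B) (λ j → f (3 ℕ.* suc j)) ∎
    where
    g : ℕ → ℤ
    g i = ζ (ρ (suc i)) * f (suc i)
    simplify : ∀ x y → x + 0ℤ + 0ℤ + 1ℤ * y ≡ x + y
    simplify = solve-∀
    ρ-3 : ∀ B → ρ (3 ℕ.* B) ≡ r0
    ρ-3 zero    = refl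
    ρ-3 (suc B) = trans (cong ρ (ℕ.*-suc 3 B)) (cong (λ r → next (next (next r))) (ρ-3 B))

  -- Σ 3j q^(3j k), the bridge between residues of a and of x: it has the weight a on multiples of 3
  -- among the a, and since (3a) x = a (3x), it is also three times the weight a on multiples of 3
  -- among the x.
  R₃ : Ser
  R₃ n = Σ² n (λ j k → δ (3 ℕ.* suc j ℕ.* suc k) n * ℤ.+ (3 ℕ.* suc j))

  Λ-3∣a : Λ (by-a ζ₁) ≐ R₃
  Λ-3∣a .coeff n = begin
    Σℤ n (λ i → Σℤ n (λ k → δ (suc i ℕ.* suc k) n * (ζ (ρ (suc i)) * ℤ.+ suc i)))
      ≡⟨ Σ-cong n (λ i → trans (Σ-cong n (λ k → pull (δ (suc i ℕ.* suc k) n) (ζ (ρ (suc i))) _)) (Σ-*ˡ n (ζ (ρ (suc i))) _)) ⟩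
    Σℤ n (λ i → ζ (ρ (suc i)) * f (suc i))
      ≡⟨ Σ-extend (ℕ.m≤n*m n 3) (λ i n≤i → trans (cong (ζ (ρ (suc i)) *_) (Σ-0 n (λ k →
           δ-> (ℕ.≤-trans (s≤s n≤i) (ℕ.m≤m*n (suc i) (suc k))) _))) (ℤ.*-zeroʳ (ζ (ρ (suc i))))) ⟨
    Σℤ (3 ℕ.* n) (λ i → ζ (ρ (suc i)) * f (suc i))
      ≡⟨ Σ-multiples-of-3 n f ⟩
    R₃ n ∎
    where
    f : ℕ → ℤ
    f a = Σℤ n (λ k → δ (a ℕ.* suc k) n * ℤ.+ a)
    pull : ∀ d z x → d * (z * x) ≡ z * (d * x)
    pull = solve-∀

  Λ-3∣x : (ℤ.+ 3) · Λ (by-x ζ₁) ≐ R₃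
  Λ-3∣x .coeff n = begin
    ℤ.+ 3 * Σ² n (λ i k → δ (suc i ℕ.* suc k) n * (ζ (ρ (suc k)) * ℤ.+ suc i))
      ≡⟨ cong (ℤ.+ 3 *_) (trans (Σ²-transpose n _) (Σ-cong n (λ k →
           trans (Σ-cong n (λ i → pull (δ (suc i ℕ.* suc k) n) (ζ (ρ (suc k))) _)) (Σ-*ˡ n (ζ (ρ (suc k))) _)))) ⟩
    ℤ.+ 3 * Σℤ n (λ k → ζ (ρ (suc k)) * f (suc k))
      ≡⟨ cong (ℤ.+ 3 *_) (Σ-extend (ℕ.m≤n*m n 3) (λ k n≤k → trans (cong (ζ (ρ (suc k)) *_) (Σ-0 n (λ i →
           δ-> (ℕ.≤-trans (s≤s n≤k) (ℕ.m≤n*m (suc k) (suc i))) _))) (ℤ.*-zeroʳ (ζ (ρ (suc k)))))) ⟨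
    ℤ.+ 3 * Σℤ (3 ℕ.* n) (λ k → ζ (ρ (suc k)) * f (suc k))
      ≡⟨ cong (ℤ.+ 3 *_) (trans (Σ-multiples-of-3 n f) (Σ²-transpose n _)) ⟩
    ℤ.+ 3 * Σ² n (λ i k → δ (suc i ℕ.* (3 ℕ.* suc k)) n * ℤ.+ suc i)
      ≡⟨ trans (sym (Σ-*ˡ n (ℤ.+ 3) _)) (Σ-cong n (λ i → trans (sym (Σ-*ˡ n (ℤ.+ 3) _)) (Σ-cong n (λ k →
           trans (sym (pull (δ (suc i ℕ.* (3 ℕ.* suc k)) n) (ℤ.+ 3) _))
             (cong₂ _*_ (cong (λ m → δ m n) (commute i k)) (sym (ℤ.pos-* 3 (suc i)))))))) ⟩
    R₃ n ∎
    where
    f : ℕ → ℤ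
    f x = Σℤ n (λ i → δ (suc i ℕ.* x) n * ℤ.+ suc i)
    pull : ∀ d z x → d * (z * x) ≡ z * (d * x)
    pull = solve-∀
    commute : ∀ i k → suc i ℕ.* (3 ℕ.* suc k) ≡ 3 ℕ.* suc i ℕ.* suc k
    commute i k = trans (sym (ℕ.*-assoc (suc i) 3 (suc k))) (cong (ℕ._* suc k) (ℕ.*-comm (suc i) 3))

  ν-ζ : ∀ r x → ν r * x ≡ x + - 1ℤ * (ζ r * x)
  ν-ζ r0 = solve-∀
  ν-ζ r1 = solve-∀
  ν-ζ r2 = solve-∀

  ψ-ζ : ∀ r x → ψ r * x ≡ x + - (ℤ.+ 3) * (ζ r * x)
  ψ-ζ r0 = solve-∀
  ψ-ζ r1 = solve-∀
  ψ-ζ r2 = solve-∀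

  Λ-linear : ∀ p c q → (∀ r s m n → value (p r s) m n ≡ ℤ.+ m + c * value (q r s) m n) → Λ p ≐ R ⊕ c · Λ q
  Λ-linear p c q e = Ring.trans (Λ-cong p (λ r s → X :+ con c :* q r s) e)
    (Ring.trans (Λ-⊕ (λ _ _ → X) (λ r s → con c :* q r s)) (⊕-congˡ R (Λ-· c q)))

  S≐ : S ≐ R ⊕ (- 1ℤ) · R₃
  S≐ = Ring.trans (Λ-linear (by-a ν₁) (- 1ℤ) (by-a ζ₁) (λ r _ m _ → ν-ζ r (ℤ.+ m)))
    (⊕-congˡ R (·-cong (- 1ℤ) Λ-3∣a))

  S′≐ : S′ ≐ R ⊕ (- (ℤ.+ 3)) · R₃
  S′≐ = Ring.trans (Λ-linear (by-a ψ₁) (- (ℤ.+ 3)) (by-a ζ₁) (λ r _ m _ → ψ-ζ r (ℤ.+ m)))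
    (⊕-congˡ R (·-cong (- (ℤ.+ 3)) Λ-3∣a))

  N≐ : N ≐ R ⊕ (- 1ℤ) · Λ (by-x ζ₁)
  N≐ = Λ-linear (by-x ν₁) (- 1ℤ) (by-x ζ₁) (λ _ s m _ → ν-ζ s (ℤ.+ m))

  -- Both sides are `R` minus `R₃`: omitting the a divisible by 3 removes `R₃`, and so does the
  -- weight 1 - 3 ζ on x.
  S-transpose : S ≐ Sˣ
  S-transpose .coeff n = begin
    S n
      ≡⟨ coeff S≐ n ⟩
    R n + - 1ℤ * R₃ n
      ≡⟨ cong (λ z → R n + - 1ℤ * z) (coeff Λ-3∣x n) ⟨
    R n + - 1ℤ * (ℤ.+ 3 * Λ (by-x ζ₁) n)
      ≡⟨ cong (R n +_) (ℤ.*-assoc (- 1ℤ) (ℤ.+ 3) (Λ (by-x ζ₁) n)) ⟨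
    R n + - (ℤ.+ 3) * Λ (by-x ζ₁) n
      ≡⟨ coeff (Λ-linear (by-x ψ₁) (- (ℤ.+ 3)) (by-x ζ₁) (λ _ s m _ → ψ-ζ s (ℤ.+ m))) n ⟨
    Sˣ n ∎

  -- All three are combinations of `R` and `R₃`. Hence `G ⊕ P`, which mixes residues of x and of a,
  -- equals 1 + 3 `S′` with residues of a alone.
  N-S-S′ : (- (ℤ.+ 9)) • N ⊕ (ℤ.+ 12) • S ≐ (ℤ.+ 3) • S′
  N-S-S′ = Ring.trans (Ring.sym (Ring.+-cong (·-• (- (ℤ.+ 9)) N) (·-• (ℤ.+ 12) S)))
    (Ring.trans (pointwise coefficients) (·-• (ℤ.+ 3) S′))
    where
    expand : ∀ t z y → - (ℤ.+ 9) * (t + - 1ℤ * z) + ℤ.+ 12 * (t + - 1ℤ * y) ≡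
      ℤ.+ 3 * t + ℤ.+ 3 * (ℤ.+ 3 * z) + - (ℤ.+ 12) * y
    expand = solve-∀
    collect : ∀ t y → ℤ.+ 3 * t + ℤ.+ 3 * y + - (ℤ.+ 12) * y ≡ ℤ.+ 3 * (t + - (ℤ.+ 3) * y)
    collect = solve-∀
    coefficients : ∀ n → - (ℤ.+ 9) * N n + ℤ.+ 12 * S n ≡ ℤ.+ 3 * S′ n
    coefficients n = begin
      - (ℤ.+ 9) * N n + ℤ.+ 12 * S n
        ≡⟨ cong₂ (λ x y → - (ℤ.+ 9) * x + ℤ.+ 12 * y) (coeff N≐ n) (coeff S≐ n) ⟩
      - (ℤ.+ 9) * (R n + - 1ℤ * Λ (by-x ζ₁) n) + ℤ.+ 12 * (R n + - 1ℤ * R₃ n)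
        ≡⟨ expand (R n) (Λ (by-x ζ₁) n) (R₃ n) ⟩
      ℤ.+ 3 * R n + ℤ.+ 3 * (ℤ.+ 3 * Λ (by-x ζ₁) n) + - (ℤ.+ 12) * R₃ n
        ≡⟨ cong (λ z → ℤ.+ 3 * R n + ℤ.+ 3 * z + - (ℤ.+ 12) * R₃ n) (coeff Λ-3∣x n) ⟩
      ℤ.+ 3 * R n + ℤ.+ 3 * R₃ n + - (ℤ.+ 12) * R₃ n
        ≡⟨ collect (R n) (R₃ n) ⟩
      ℤ.+ 3 * (R n + - (ℤ.+ 3) * R₃ n)
        ≡⟨ cong (ℤ.+ 3 *_) (coeff S′≐ n) ⟨
      ℤ.+ 3 * S′ n ∎

  -- h solves a linear system; Φ and Ψ are obtained from it by summation.
  A² : (ℤ.+ 3) • (A ⊛ A) ≐ S ⊕ (- 1ℤ) • A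
  A² = Ring.trans (⊛-quadratic (ℤ.+ 3) (by-a χ₀) (by-a χ₀) (λ a b x y → value (g (ρ a) (ρ b)) a b)
      (λ _ _ _ _ → refl))
    (Ring.trans (quadratic-a-table g h Ψ w _ _ _)
      (Λ≐ (itself (by-a ν₁) ⊕ᵗ (- 1ℤ) •ᵗ itself (by-a χ₀))))
    where
    g h Ψ : Table
    w : Residue → Polynomial 2
    g r s = ⌜ 3 ⌝ :* (χ₀ r :* χ₀ s)
    w r = ν₁ r :+ con (- 1ℤ) :* χ₀ r
    h = table ⌜ 0 ⌝ ⌜ 0 ⌝ ⌜ 0 ⌝
              ⌜ 0 ⌝ ⌜ 3 ⌝ ⌜ 0 ⌝
              ⌜ 0 ⌝ ⌜ 0 ⌝ ⌜ 3 ⌝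
    Ψ = table X X ⌜ 0 ⌝
              (X :+ ⌜ 2 ⌝) ⌜ 0 ⌝ (X :- ⌜ 1 ⌝)
              ⌜ 0 ⌝ (X :+ ⌜ 1 ⌝) (X :+ ⌜ 1 ⌝)

  -- Multiplied by -9 this is a G = 3 θa - 27 V: the constant term of `a` absorbs the term in `N`.
  AˣN : (ℤ.+ 6) • (Aˣ ⊛ N) ≐ (ℤ.+ 3) • V ⊕ (- 1ℤ) • N ⊕ (- (ℤ.+ 2)) • D Aˣ
  AˣN = Ring.trans (⊛-quadratic (ℤ.+ 6) (by-x χ₀) (by-x ν₁) (λ a b x y → value (g (ρ x) (ρ y)) a b)
      (λ _ _ _ _ → refl))
    (Ring.trans (quadratic-x-table g h Φ Ψ w _ _ _ _)
      (Λ≐ ((ℤ.+ 3) •ᵗ itself (by-x χ₂) ⊕ᵗ (- 1ℤ) •ᵗ itself (by-x ν₁) ⊕ᵗ (- (ℤ.+ 2)) •ᵗ Dᵗ (itself (by-x χ₀)))))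
    where
    g h Φ : Table
    Ψ w : Residue → Polynomial 2
    g r s = ⌜ 6 ⌝ :* (χ₀ r :* (con (ν s) :* Y))
    w r = ⌜ 3 ⌝ :* χ₂ r :+ con (- 1ℤ) :* ν₁ r :+ con (- (ℤ.+ 2)) :* (X :* Y :* χ₀ r)
    h = table ⌜ 0 ⌝ ⌜ 0 ⌝ (:- (⌜ 6 ⌝ :* Y))
              (⌜ 6 ⌝ :* X) (⌜ 6 ⌝ :* Y) ⌜ 0 ⌝
              ⌜ 0 ⌝ ⌜ 0 ⌝ (:- (⌜ 6 ⌝ :* Y))
    Φ = table (:- (⌜ 2 ⌝ :* X :* Y)) (⌜ 2 ⌝ :* X :* Y) ⌜ 0 ⌝
              (⌜ 2 ⌝ :* X :* Y :- ⌜ 2 ⌝ :* X) (⌜ 6 ⌝ :* X) (:- (⌜ 2 ⌝ :* X :* Y :+ ⌜ 4 ⌝ :* X))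
              ⌜ 0 ⌝ (:- (⌜ 2 ⌝ :* X :* Y :+ ⌜ 2 ⌝ :* X)) (⌜ 2 ⌝ :* X :* Y :- ⌜ 4 ⌝ :* X)
    Ψ = column ⌜ 0 ⌝
               (⌜ 3 ⌝ :* X² :+ ⌜ 6 ⌝ :* X :* Y :+ ⌜ 3 ⌝ :* X)
               (:- (⌜ 3 ⌝ :* X² :+ ⌜ 6 ⌝ :* X :* Y :+ ⌜ 3 ⌝ :* X))

  -- With constant terms restored it reads a (1 + 3 S′) = 3 θa + B. This second formula for θa,
  -- compared with the first, gives an algebraic relation.
  AS′ : (ℤ.+ 6) • (A ⊛ S′) ≐ (- (ℤ.+ 2)) • A ⊕ (- 1ℤ) • S′ ⊕ (ℤ.+ 6) • D A ⊕ (- (ℤ.+ 3)) • K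
  AS′ = Ring.trans (⊛-quadratic (ℤ.+ 6) (by-a χ₀) (by-a ψ₁) (λ a b x y → value (g (ρ a) (ρ b)) a b)
      (λ _ _ _ _ → refl))
    (Ring.trans (quadratic-a-table g h Ψ w _ _ _)
      (Λ≐ ((- (ℤ.+ 2)) •ᵗ itself (by-a χ₀) ⊕ᵗ (- 1ℤ) •ᵗ itself (by-a ψ₁) ⊕ᵗ
        (ℤ.+ 6) •ᵗ Dᵗ (itself (by-a χ₀)) ⊕ᵗ (- (ℤ.+ 3)) •ᵗ itself (by-a χ₂))))
    where
    g h Ψ : Table
    w : Residue → Polynomial 2
    g r s = ⌜ 6 ⌝ :* (χ₀ r :* (con (ψ s) :* Y))
    w r = con (- (ℤ.+ 2)) :* χ₀ r :+ con (- 1ℤ) :* ψ₁ r :+ ⌜ 6 ⌝ :* (X :* Y :* χ₀ r) :+ con (- (ℤ.+ 3)) :* χ₂ r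
    h = table ⌜ 0 ⌝ ⌜ 0 ⌝ ⌜ 0 ⌝
              (:- (⌜ 12 ⌝ :* X :+ ⌜ 6 ⌝ :* Y)) ⌜ 0 ⌝ (⌜ 6 ⌝ :* Y)
              (⌜ 12 ⌝ :* X :+ ⌜ 6 ⌝ :* Y) (:- (⌜ 6 ⌝ :* Y)) ⌜ 0 ⌝
    Ψ = table (:- (⌜ 3 ⌝ :* X² :+ ⌜ 2 ⌝ :* X :* Y :+ X)) (⌜ 3 ⌝ :* X² :+ ⌜ 2 ⌝ :* X :* Y :+ ⌜ 3 ⌝ :* X) (⌜ 2 ⌝ :* X)
              (⌜ 3 ⌝ :* X² :+ ⌜ 2 ⌝ :* X :* Y :- X :- ⌜ 2 ⌝ :* Y :- ⌜ 2 ⌝)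
              (⌜ 2 ⌝ :* X :+ ⌜ 6 ⌝ :* Y :+ ⌜ 4 ⌝)
              (:- (⌜ 3 ⌝ :* X² :+ ⌜ 2 ⌝ :* X :* Y :+ ⌜ 9 ⌝ :* X :+ ⌜ 4 ⌝ :* Y :+ ⌜ 6 ⌝))
              (⌜ 2 ⌝ :* X :+ ⌜ 2 ⌝)
              (:- (⌜ 3 ⌝ :* X² :+ ⌜ 2 ⌝ :* X :* Y :+ ⌜ 5 ⌝ :* X :+ ⌜ 2 ⌝ :* Y :+ ⌜ 2 ⌝))
              (⌜ 3 ⌝ :* X² :+ ⌜ 2 ⌝ :* X :* Y :+ ⌜ 7 ⌝ :* X :+ ⌜ 2 ⌝ :* Y :+ ⌜ 4 ⌝)

  -- One certificate serves both products together; in their combination only `V` and `D N` remain,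
  -- which is the equation for θG.
  N²-AˣV : (ℤ.+ 27) • (N ⊛ N) ⊕ (- (ℤ.+ 54)) • (Aˣ ⊛ V) ≐ (ℤ.+ 9) • V ⊕ (- (ℤ.+ 9)) • D N
  N²-AˣV = Ring.trans (Ring.trans (Ring.+-cong
        (⊛-quadratic (ℤ.+ 27) (by-x ν₁) (by-x ν₁) (λ a b x y → value (g₁ (ρ x) (ρ y)) a b) (λ _ _ _ _ → refl))
        (⊛-quadratic (- (ℤ.+ 54)) (by-x χ₀) (by-x χ₂) (λ a b x y → value (g₂ (ρ x) (ρ y)) a b) (λ _ _ _ _ → refl)))
      (Ring.sym (quadratic-⊕ (λ a b x y → value (g₁ (ρ x) (ρ y)) a b) (λ a b x y → value (g₂ (ρ x) (ρ y)) a b))))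
    (Ring.trans (quadratic-x-table g h Φ Ψ w _ _ _ _)
      (Λ≐ ((ℤ.+ 9) •ᵗ itself (by-x χ₂) ⊕ᵗ (- (ℤ.+ 9)) •ᵗ Dᵗ (itself (by-x ν₁)))))
    where
    g h g₁ g₂ Φ : Table
    Ψ w : Residue → Polynomial 2
    g₁ r s = ⌜ 27 ⌝ :* (ν₁ r :* (con (ν s) :* Y))
    g₂ r s = con (- (ℤ.+ 54)) :* (χ₀ r :* (con (χ s) :* Y²))
    g r s = g₁ r s :+ g₂ r s
    w r = ⌜ 9 ⌝ :* χ₂ r :+ con (- (ℤ.+ 9)) :* (X :* Y :* ν₁ r)
    h = table ⌜ 0 ⌝ ⌜ 0 ⌝ ⌜ 0 ⌝
              ⌜ 0 ⌝ ⌜ 0 ⌝ (⌜ 54 ⌝ :* Y²)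
              ⌜ 0 ⌝ (⌜ 54 ⌝ :* X :* Y :+ ⌜ 54 ⌝ :* Y²) ⌜ 0 ⌝
    Φ = table (:- (⌜ 9 ⌝ :* X² :* Y)) (:- (⌜ 9 ⌝ :* X² :* Y)) ⌜ 0 ⌝
              (:- (⌜ 9 ⌝ :* X² :* Y :+ ⌜ 18 ⌝ :* X²)) (⌜ 27 ⌝ :* X²) (⌜ 9 ⌝ :* X² :- ⌜ 9 ⌝ :* X² :* Y)
              ⌜ 0 ⌝ (:- (⌜ 9 ⌝ :* X² :* Y :+ ⌜ 9 ⌝ :* X²)) (:- (⌜ 9 ⌝ :* X² :* Y :+ ⌜ 9 ⌝ :* X²))
    -- `h` is zero at equal residues, so the diagonal x = y contributes nothing.
    Ψ = column ⌜ 0 ⌝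
               ⌜ 0 ⌝
               ⌜ 0 ⌝

  -- This says θV = G V + E; the evaluation of `E` as P V then completes the logarithmic derivative
  -- of `V`.
  VN : (ℤ.+ 9) • (V ⊛ N) ≐ E ⊕ (- 1ℤ) • D V
  VN = Ring.trans (⊛-quadratic (ℤ.+ 9) (by-x χ₂) (by-x ν₁) (λ a b x y → value (g (ρ x) (ρ y)) a b)
      (λ _ _ _ _ → refl))
    (Ring.trans (quadratic-x-table g h Φ Ψ w _ _ _ _)
      (Λ≐ (itself (by-x χ₄) ⊕ᵗ (- 1ℤ) •ᵗ Dᵗ (itself (by-x χ₂)))))
    where
    g h Φ : Table
    Ψ w : Residue → Polynomial 2
    g r s = ⌜ 9 ⌝ :* (χ₂ r :* (con (ν s) :* Y))
    w r = χ₄ r :+ con (- 1ℤ) :* (X :* Y :* χ₂ r)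
    h = table ⌜ 0 ⌝ ⌜ 0 ⌝ (:- (⌜ 2 ⌝ :* Y³))
              (⌜ 2 ⌝ :* X³) (⌜ 6 ⌝ :* X² :* Y :+ ⌜ 2 ⌝ :* Y³) (⌜ 2 ⌝ :* X³ :+ ⌜ 3 ⌝ :* X² :* Y :- ⌜ 2 ⌝ :* Y³)
              ⌜ 0 ⌝ (:- (⌜ 3 ⌝ :* X² :* Y)) (:- (⌜ 6 ⌝ :* X² :* Y :+ ⌜ 2 ⌝ :* Y³))
    Φ = table (:- (X³ :* Y)) (X³ :* Y) ⌜ 0 ⌝
              (X³ :* Y) (⌜ 6 ⌝ :* X³) (:- (X³ :* Y :+ X³))
              ⌜ 0 ⌝ (:- (X³ :* Y :+ X³)) (X³ :* Y :- X³)
    Ψ = column ⌜ 0 ⌝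
               (X⁴ :+ ⌜ 4 ⌝ :* X³ :* Y :+ ⌜ 3 ⌝ :* X² :* Y² :+ ⌜ 2 ⌝ :* X :* Y³ :+ ⌜ 3 ⌝ :* X³ :+ ⌜ 6 ⌝ :* X² :* Y :+ ⌜ 3 ⌝ :* X :* Y² :+ ⌜ 3 ⌝ :* X² :+ ⌜ 2 ⌝ :* X :* Y :+ X)
               (:- (X⁴ :+ ⌜ 4 ⌝ :* X³ :* Y :+ ⌜ 3 ⌝ :* X² :* Y² :+ ⌜ 2 ⌝ :* X :* Y³ :+ ⌜ 3 ⌝ :* X³ :+ ⌜ 6 ⌝ :* X² :* Y :+ ⌜ 3 ⌝ :* X :* Y² :+ ⌜ 3 ⌝ :* X² :+ ⌜ 2 ⌝ :* X :* Y :+ X))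

  -- The first weight 5 evaluation, P V = E. The form `Sˣ` is taken because the residues of `V` sit
  -- on x.
  VSˣ : (ℤ.+ 12) • (V ⊛ Sˣ) ≐ E ⊕ (- 1ℤ) • V
  VSˣ = Ring.trans (⊛-quadratic (ℤ.+ 12) (by-x χ₂) (by-x ψ₁) (λ a b x y → value (g (ρ x) (ρ y)) a b)
      (λ _ _ _ _ → refl))
    (Ring.trans (quadratic-x-table g h Φ Ψ w _ _ _ _)
      (Λ≐ (itself (by-x χ₄) ⊕ᵗ (- 1ℤ) •ᵗ itself (by-x χ₂))))
    where
    g h Φ : Table
    Ψ w : Residue → Polynomial 2
    g r s = ⌜ 12 ⌝ :* (χ₂ r :* (con (ψ s) :* Y))
    w r = χ₄ r :+ con (- 1ℤ) :* χ₂ r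
    h = table ⌜ 0 ⌝ ⌜ 0 ⌝ ⌜ 0 ⌝
              (:- (⌜ 12 ⌝ :* X² :* Y :+ ⌜ 12 ⌝ :* X :* Y²)) (⌜ 12 ⌝ :* X² :* Y) ⌜ 0 ⌝
              (⌜ 12 ⌝ :* X² :* Y :+ ⌜ 12 ⌝ :* X :* Y²) ⌜ 0 ⌝ (:- (⌜ 12 ⌝ :* X² :* Y))
    Φ = table ⌜ 0 ⌝ ⌜ 0 ⌝ ⌜ 0 ⌝
              ⌜ 0 ⌝ (⌜ 12 ⌝ :* X³) ⌜ 0 ⌝
              ⌜ 0 ⌝ ⌜ 0 ⌝ ⌜ 0 ⌝
    Ψ = column ⌜ 0 ⌝
               (X⁴ :+ ⌜ 4 ⌝ :* X³ :* Y :+ ⌜ 4 ⌝ :* X³ :+ ⌜ 6 ⌝ :* X² :* Y :+ ⌜ 5 ⌝ :* X² :+ ⌜ 2 ⌝ :* X :* Y :+ ⌜ 2 ⌝ :* X)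
               (:- (X⁴ :+ ⌜ 4 ⌝ :* X³ :* Y :+ ⌜ 4 ⌝ :* X³ :+ ⌜ 6 ⌝ :* X² :* Y :+ ⌜ 5 ⌝ :* X² :+ ⌜ 2 ⌝ :* X :* Y :+ ⌜ 2 ⌝ :* X))

  -- The second weight 5 evaluation, P B = 1 + 3 F, after the constant terms of `P` and `B` are
  -- restored.
  KS : (ℤ.+ 36) • (K ⊛ S) ≐ (ℤ.+ 4) • S ⊕ (- (ℤ.+ 3)) • K ⊕ (- 1ℤ) • F
  KS = Ring.trans (⊛-quadratic (ℤ.+ 36) (by-a χ₂) (by-a ν₁) (λ a b x y → value (g (ρ a) (ρ b)) a b)
      (λ _ _ _ _ → refl))
    (Ring.trans (quadratic-a-table g h Ψ w _ _ _)
      (Λ≐ ((ℤ.+ 4) •ᵗ itself (by-a ν₁) ⊕ᵗ (- (ℤ.+ 3)) •ᵗ itself (by-a χ₂) ⊕ᵗ (- 1ℤ) •ᵗ itself (by-a χ₄))))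
    where
    g h Ψ : Table
    w : Residue → Polynomial 2
    g r s = ⌜ 36 ⌝ :* (χ₂ r :* (con (ν s) :* Y))
    w r = ⌜ 4 ⌝ :* ν₁ r :+ con (- (ℤ.+ 3)) :* χ₂ r :+ con (- 1ℤ) :* χ₄ r
    h = table ⌜ 0 ⌝ ⌜ 0 ⌝ ⌜ 0 ⌝
              ⌜ 0 ⌝ (⌜ 36 ⌝ :* X² :* Y) ⌜ 0 ⌝
              ⌜ 0 ⌝ ⌜ 0 ⌝ (:- (⌜ 36 ⌝ :* X² :* Y))
    Ψ = table (⌜ 6 ⌝ :* X :* Y :- X⁴ :- ⌜ 4 ⌝ :* X³ :* Y :- ⌜ 4 ⌝ :* X³ :- ⌜ 6 ⌝ :* X² :* Y :- ⌜ 9 ⌝ :* X² :- ⌜ 6 ⌝ :* X)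
              (X⁴ :+ ⌜ 4 ⌝ :* X³ :* Y :+ ⌜ 4 ⌝ :* X³ :- ⌜ 6 ⌝ :* X² :* Y :- ⌜ 3 ⌝ :* X² :- ⌜ 6 ⌝ :* X :* Y :- ⌜ 18 ⌝ :* X)
              ⌜ 0 ⌝
              (X⁴ :+ ⌜ 4 ⌝ :* X³ :* Y :+ ⌜ 4 ⌝ :* X³ :+ ⌜ 18 ⌝ :* X² :* Y :+ ⌜ 9 ⌝ :* X² :+ ⌜ 18 ⌝ :* X :* Y :+ ⌜ 14 ⌝ :* X :+ ⌜ 8 ⌝ :- ⌜ 4 ⌝ :* Y)
              ⌜ 0 ⌝
              (⌜ 6 ⌝ :* X² :* Y :+ ⌜ 3 ⌝ :* X² :+ ⌜ 6 ⌝ :* X :* Y :+ ⌜ 10 ⌝ :* X :- X⁴ :- ⌜ 4 ⌝ :* X³ :* Y :- ⌜ 4 ⌝ :* X³ :- ⌜ 8 ⌝ :* Y :- ⌜ 8 ⌝)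
              ⌜ 0 ⌝
              (:- (X⁴ :+ ⌜ 4 ⌝ :* X³ :* Y :+ ⌜ 4 ⌝ :* X³ :+ ⌜ 18 ⌝ :* X² :* Y :+ ⌜ 9 ⌝ :* X² :+ ⌜ 18 ⌝ :* X :* Y :+ ⌜ 22 ⌝ :* X :+ ⌜ 4 ⌝ :* Y :+ ⌜ 16 ⌝))
              (X⁴ :+ ⌜ 4 ⌝ :* X³ :* Y :+ ⌜ 4 ⌝ :* X³ :+ ⌜ 6 ⌝ :* X² :* Y :+ ⌜ 9 ⌝ :* X² :- ⌜ 6 ⌝ :* X :* Y :- ⌜ 2 ⌝ :* X :- ⌜ 8 ⌝ :* Y :- ⌜ 8 ⌝)

-- Consequences of the Lambert series identities

-- Polynomial consequences of equations between given series: x ≈ y follows from l ≈ r as soon as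
-- x + r and y + l have the same normal form.
module Consequences {n} (series : Vec Ser n) where
  open Solver public using (Polynomial; con; var; _:+_; _:*_; _:-_; :-_; ⟦_⟧)
  open Solver using (normalise; _≟N_; ⟦_⟧N-cong; correct)

  infix 4 _≈_
  record _≈_ (l r : Polynomial n) : Set where
    constructor holds
    field equation : ⟦ l ⟧ series ≐ ⟦ r ⟧ series
  open _≈_ public

  infixl 5 _⊹_
  infix  6 _⋆_

  _⊹_ : ∀ {l r l′ r′} → l ≈ r → l′ ≈ r′ → l :+ l′ ≈ r :+ r′
  holds p ⊹ holds q = holds (Ring.+-cong p q)

  _⋆_ : ∀ k {l r} → l ≈ r → k :* l ≈ k :* r
  k ⋆ holds p = holds (⊛-congˡ (⟦ k ⟧ series) p)

  flip : ∀ {l r} → l ≈ r → r ≈ l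
  flip (holds p) = holds (Ring.sym p)

  infix 4 _≟≟_
  record _≟≟_ (p q : Polynomial n) : Set where
    constructor decided
    field same-normal-form : T (is-just (normalise p ≟N normalise q))

  sound : ∀ {p q} → p ≟≟ q → p ≈ q
  sound {p} {q} (decided eq) with normalise p ≟N normalise q
  ... | just e = holds (Ring.trans (Ring.sym (correct p series)) (Ring.trans (⟦ e ⟧N-cong series) (correct q series)))

  by : ∀ {l r x y} → l ≈ r → x :+ r ≟≟ y :+ l → x ≈ y
  by {l} {r} {x} {y} (holds p) eq = holds (∙-cancelʳ (⟦ r ⟧ series) (⟦ x ⟧ series) (⟦ y ⟧ series)
    (Ring.trans (equation (sound eq)) (⊕-congˡ (⟦ y ⟧ series) p)))
    where open Algebra.Properties.Group Ring.+-group

  ⟨_⟩ : ℕ → Polynomial n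
  ⟨ m ⟩ = con (ℤ.+ m)

D-κ : ∀ c → D (κ c) ≐ zeroS
D-κ c .coeff zero    = refl
D-κ c .coeff (suc n) = trans (cong (ℤ.+ suc n *_) (ℤ.*-zeroʳ c)) (ℤ.*-zeroʳ (ℤ.+ suc n))

D-• : ∀ c f → D (c • f) ≐ c • D f
D-• c f = Ring.trans (D-cong (Ring.sym (·-• c f))) (Ring.trans (D-· c f) (·-• c (D f)))

D-affine : ∀ c d f → D (κ c ⊕ d • f) ≐ d • D f
D-affine c d f = Ring.trans (D-⊕ (κ c) (d • f))
  (Ring.trans (Ring.+-cong (D-κ c) (D-• d f)) (Ring.+-identityˡ (d • D f)))

-- In terms of the cubic theta functions of the Borweins, a = a(q), B = b(q)³ and 27 V = c(q)³; moreover P is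
-- θu/u and G is θB/B, where θ = q d/dq, and C_mix = 1 + 3 F - 27 E.
a P G B : Ser
a = κ 1ℤ ⊕ (ℤ.+ 6) • A
P = κ 1ℤ ⊕ (ℤ.+ 12) • S
G = (- (ℤ.+ 9)) • N
B = κ 1ℤ ⊕ (- (ℤ.+ 9)) • K


module Lambert-identities where
  open Consequences (A ∷ N ∷ S ∷ S′ ∷ V ∷ K ∷ E ∷ F ∷ D A ∷ D N ∷ D V ∷ D a ∷ D G ∷ [])

  A̲ N̲ S̲ S̲′ V̲ K̲ E̲ F̲ A′ N′ V′ a′ G′ a̲ P̲ G̲ B̲ : Polynomial 13
  A̲ = var (# 0)
  N̲ = var (# 1)
  S̲ = var (# 2)
  S̲′ = var (# 3)
  V̲ = var (# 4)
  K̲ = var (# 5)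
  E̲ = var (# 6)
  F̲ = var (# 7)
  A′ = var (# 8)
  N′ = var (# 9)
  V′ = var (# 10)
  a′ = var (# 11)
  G′ = var (# 12)
  a̲ = con 1ℤ :+ con (ℤ.+ 6) :* A̲
  P̲ = con 1ℤ :+ con (ℤ.+ 12) :* S̲
  G̲ = con (- (ℤ.+ 9)) :* N̲
  B̲ = con 1ℤ :+ con (- (ℤ.+ 9)) :* K̲

  a²≈ : a̲ :* a̲ ≈ P̲
  a²≈ = by (⟨ 12 ⟩ ⋆ h) _
    where
    h : ⟨ 3 ⟩ :* (A̲ :* A̲) ≈ S̲ :+ con (- 1ℤ) :* A̲
    h = holds A²

  a′≈ : a′ ≈ ⟨ 6 ⟩ :* A′
  a′≈ = holds (D-affine 1ℤ (ℤ.+ 6) A)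

  G′-N′≈ : G′ ≈ con (- (ℤ.+ 9)) :* N′
  G′-N′≈ = holds (D-• (- (ℤ.+ 9)) N)

  aG≈ : a̲ :* G̲ ≈ ⟨ 3 ⟩ :* a′ :- ⟨ 27 ⟩ :* V̲
  aG≈ = by (:- ⟨ 9 ⟩ ⋆ h ⊹ :- ⟨ 3 ⟩ ⋆ a′≈) _
    where
    h : ⟨ 6 ⟩ :* (A̲ :* N̲) ≈ ⟨ 3 ⟩ :* V̲ :+ con (- 1ℤ) :* N̲ :+ con (- (ℤ.+ 2)) :* A′
    h = holds (Ring.trans (•-cong (ℤ.+ 6) (⊛-congʳ N A-transpose)) (Ring.trans AˣN
      (⊕-congˡ ((ℤ.+ 3) • V ⊕ (- 1ℤ) • N) (•-cong (- (ℤ.+ 2)) (D-cong (Ring.sym A-transpose))))))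

  a[G+P]≈ : a̲ :* (G̲ :+ P̲) ≈ ⟨ 3 ⟩ :* a′ :+ B̲
  a[G+P]≈ = by (a̲ ⋆ h ⊹ ⟨ 3 ⟩ ⋆ h′ ⊹ :- ⟨ 3 ⟩ ⋆ a′≈) _
    where
    h : con (- (ℤ.+ 9)) :* N̲ :+ ⟨ 12 ⟩ :* S̲ ≈ ⟨ 3 ⟩ :* S̲′
    h = holds N-S-S′
    h′ : ⟨ 6 ⟩ :* (A̲ :* S̲′) ≈ con (- (ℤ.+ 2)) :* A̲ :+ con (- 1ℤ) :* S̲′ :+ ⟨ 6 ⟩ :* A′ :+ con (- (ℤ.+ 3)) :* K̲
    h′ = holds AS′

  G′≈ : ⟨ 3 ⟩ :* G′ ≈ G̲ :* G̲ :- ⟨ 27 ⟩ :* (a̲ :* V̲)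
  G′≈ = by (:- ⟨ 3 ⟩ ⋆ h ⊹ ⟨ 3 ⟩ ⋆ G′-N′≈) _
    where
    h : ⟨ 27 ⟩ :* (N̲ :* N̲) :+ con (- (ℤ.+ 54)) :* (A̲ :* V̲) ≈ ⟨ 9 ⟩ :* V̲ :+ con (- (ℤ.+ 9)) :* N′
    h = holds (Ring.trans (⊕-congˡ ((ℤ.+ 27) • (N ⊛ N)) (•-cong (- (ℤ.+ 54)) (⊛-congʳ V A-transpose))) N²-AˣV)

  GV≈ : G̲ :* V̲ ≈ V′ :- E̲
  GV≈ = by (:- ⟨ 1 ⟩ ⋆ h) _
    where
    h : ⟨ 9 ⟩ :* (V̲ :* N̲) ≈ E̲ :+ con (- 1ℤ) :* V′
    h = holds VN

  PV≈ : P̲ :* V̲ ≈ E̲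
  PV≈ = by (⟨ 1 ⟩ ⋆ h) _
    where
    h : ⟨ 12 ⟩ :* (V̲ :* S̲) ≈ E̲ :+ con (- 1ℤ) :* V̲
    h = holds (Ring.trans (•-cong (ℤ.+ 12) (⊛-congˡ V S-transpose)) VSˣ)

  PB≈ : P̲ :* B̲ ≈ ⟨ 1 ⟩ :+ ⟨ 3 ⟩ :* F̲
  PB≈ = by (:- ⟨ 3 ⟩ ⋆ h) _
    where
    h : ⟨ 36 ⟩ :* (K̲ :* S̲) ≈ ⟨ 4 ⟩ :* S̲ :+ con (- (ℤ.+ 3)) :* K̲ :+ con (- 1ℤ) :* F̲
    h = holds KS

D-cube : ∀ f → D (f ⊛ f ⊛ f) ≐ (ℤ.+ 3) • (f ⊛ f ⊛ D f)
D-cube f = Ring.trans (D-⊛ (f ⊛ f) f) (Ring.trans (Ring.+-cong (⊛-congʳ f (D-⊛ f f)) (Ring.refl {x = f ⊛ f ⊛ D f}))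
  (solve 2 (λ f f′ → (f′ :* f :+ f :* f′) :* f :+ f :* f :* f′ := con (ℤ.+ 3) :* (f :* f :* f′)) Ring.refl f (D f)))
  where open Solver

-- The relations are reread with `a`, `G`, `P`, `B` as indeterminates, so that normalisation does
-- not expand them in `A`, `N`, `S`, `K`.
module Differential-system where
  private module L = Lambert-identities
  open Consequences (a ∷ G ∷ P ∷ B ∷ V ∷ E ∷ D a ∷ D (D a) ∷ D G ∷ D V ∷ D B ∷ [])

  a̲ G̲ P̲ B̲ V̲ E̲ a′ a″ G′ V′ B′ : Polynomial 11
  a̲ = var (# 0)
  G̲ = var (# 1)
  P̲ = var (# 2)
  B̲ = var (# 3)
  V̲ = var (# 4)
  E̲ = var (# 5)
  a′ = var (# 6)
  a″ = var (# 7)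
  G′ = var (# 8)
  V′ = var (# 9)
  B′ = var (# 10)

  a²≈ : a̲ :* a̲ ≈ P̲
  a²≈ = holds (Consequences.equation L.a²≈)

  aG≈ : a̲ :* G̲ ≈ ⟨ 3 ⟩ :* a′ :- ⟨ 27 ⟩ :* V̲
  aG≈ = holds (Consequences.equation L.aG≈)

  a[G+P]≈ : a̲ :* (G̲ :+ P̲) ≈ ⟨ 3 ⟩ :* a′ :+ B̲
  a[G+P]≈ = holds (Consequences.equation L.a[G+P]≈)

  G′≈ : ⟨ 3 ⟩ :* G′ ≈ G̲ :* G̲ :- ⟨ 27 ⟩ :* (a̲ :* V̲)
  G′≈ = holds (Consequences.equation L.G′≈)

  V′≈ : V′ ≈ (G̲ :+ P̲) :* V̲
  V′≈ = by (:- ⟨ 1 ⟩ ⋆ GV≈ ⊹ :- ⟨ 1 ⟩ ⋆ PV≈) _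
    where
    GV≈ : G̲ :* V̲ ≈ V′ :- E̲
    GV≈ = holds (Consequences.equation L.GV≈)
    PV≈ : P̲ :* V̲ ≈ E̲
    PV≈ = holds (Consequences.equation L.PV≈)

  -- The difference of the two formulas for 3 θa, from which both θa and G drop out.
  aP≈ : a̲ :* P̲ ≈ B̲ :+ ⟨ 27 ⟩ :* V̲
  aP≈ = by (⟨ 1 ⟩ ⋆ a[G+P]≈ ⊹ :- ⟨ 1 ⟩ ⋆ aG≈) _

  -- The Borweins' cubic identity a(q)³ = b(q)³ + c(q)³.
  a³≈ : a̲ :* a̲ :* a̲ ≈ B̲ :+ ⟨ 27 ⟩ :* V̲
  a³≈ = by (a̲ ⋆ a²≈ ⊹ ⟨ 1 ⟩ ⋆ aP≈) _

  -- Differentiate the cubic identity: 3 a² θa = a³ G + 27 a² V, and subtracting 27 θV = 27 (G + a²)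
  -- V leaves (a³ - 27 V) G.
  B′≈ : B′ ≈ G̲ :* B̲
  B′≈ = by (:- ⟨ 1 ⟩ ⋆ 3a²a′≈ ⊹ a̲ :* a̲ ⋆ flip aG≈ ⊹ :- ⟨ 27 ⟩ ⋆ V′≈ ⊹
            ⟨ 27 ⟩ :* V̲ ⋆ a²≈ ⊹ G̲ ⋆ a³≈) _
    where
    3a²a′≈ : ⟨ 3 ⟩ :* (a̲ :* a̲ :* a′) ≈ B′ :+ ⟨ 27 ⟩ :* V′
    3a²a′≈ = holds (Ring.trans (Ring.sym (D-cube a)) (Ring.trans (D-cong (equation a³≈))
      (Ring.trans (D-⊕ B ((ℤ.+ 27) • V)) (⊕-congˡ (D B) (D-• (ℤ.+ 27) V)))))

  -- Up to the factor 9 the left side is a³ θ(θa/a²). It is wanted because θt/t is a² times a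
  -- function of u. The factor 9 avoids division, as the relations determine 3 θa and 3 θG.
  9W≈ : ⟨ 9 ⟩ :* (a̲ :* a″ :- ⟨ 2 ⟩ :* (a′ :* a′)) ≈ ⟨ 9 ⟩ :* (⟨ 6 ⟩ :* (V̲ :* B̲))
  9W≈ = by (⟨ 3 ⟩ :* a̲ ⋆ flip [aG]′≈ ⊹ ⟨ 81 ⟩ :* a̲ ⋆ V′≈ ⊹ a̲ :* a̲ ⋆ G′≈ ⊹
            (a̲ :* G̲ :- ⟨ 2 ⟩ :* (⟨ 3 ⟩ :* a′ :+ (a̲ :* G̲ :+ ⟨ 27 ⟩ :* V̲))) ⋆ flip aG≈ ⊹
            ⟨ 81 ⟩ :* V̲ ⋆ aP≈ ⊹ :- (⟨ 27 ⟩ :* V̲) ⋆ a³≈) _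
    where
    [aG]′≈ : a′ :* G̲ :+ a̲ :* G′ ≈ ⟨ 3 ⟩ :* a″ :+ con (- (ℤ.+ 27)) :* V′
    [aG]′≈ = holds (Ring.trans (Ring.sym (D-⊛ a G)) (Ring.trans (D-cong (equation aG≈₊))
      (Ring.trans (D-⊕ ((ℤ.+ 3) • D a) ((- (ℤ.+ 27)) • V)) (Ring.+-cong (D-• (ℤ.+ 3) (D a)) (D-• (- (ℤ.+ 27)) V)))))
      where
      aG≈₊ : a̲ :* G̲ ≈ ⟨ 3 ⟩ :* a′ :+ con (- (ℤ.+ 27)) :* V̲
      aG≈₊ = by (⟨ 1 ⟩ ⋆ aG≈) _

-- Logarithmic derivatives

qS-⊛-zero : ∀ f → (qS ⊛ f) 0 ≡ 0ℤ
qS-⊛-zero f = refl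

qS-⊛-suc : ∀ f n → (qS ⊛ f) (suc n) ≡ f n
qS-⊛-suc f n = trans (⊛-suc qS f n) (trans (ℤ.+-identityˡ _)
  (trans (anti-cong (λ i j → cong (_* f j) (δ-suc i 0)) n) (coeff (⊛-identityˡ f) n)))

D-qS : D qS ≐ qS
D-qS .coeff zero          = refl
D-qS .coeff (suc zero)    = refl
D-qS .coeff (suc (suc n)) = ℤ.*-zeroʳ (ℤ.+ suc (suc n))

⊛-last : ∀ f g n → (∀ k → k ℕ.< n → f k ≡ 0ℤ) → (f ⊛ g) n ≡ f n * g 0
⊛-last f g n f≡0 = trans
  (cong₂ _+_ (trans (Σ-cong< n (λ k k<n → cong (_* g (n ∸ k)) (f≡0 k k<n))) (Σ-0 n (λ _ → refl)))
             (cong (λ m → f n * g m) (ℕ.n∸n≡0 n)))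
  (ℤ.+-identityˡ _)

-- The n-th coefficient of D f = f g reads (n - g₀) fₙ = (terms in f₀, …, fₙ₋₁).
D-vanish : ∀ f g n → D f ≐ f ⊛ g → (∀ k → k ℕ.< n → f k ≡ 0ℤ) → ℤ.+ n ≢ g 0 → f n ≡ 0ℤ
D-vanish f g n Df f≡0 n≢ = [ (λ e → contradiction (ℤ.i-j≡0⇒i≡j (ℤ.+ n) (g 0) e) n≢) , (λ e → e) ]′
  (ℤ.i*j≡0⇒i≡0∨j≡0 (ℤ.+ n - g 0) {f n} (begin
    (ℤ.+ n - g 0) * f n            ≡⟨ expand (ℤ.+ n) (g 0) (f n) ⟩
    ℤ.+ n * f n - f n * g 0        ≡⟨ cong (_- f n * g 0) (trans (coeff Df n) (⊛-last f g n f≡0)) ⟩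
    f n * g 0 - f n * g 0          ≡⟨ ℤ.+-inverseʳ (f n * g 0) ⟩
    0ℤ ∎))
  where
  expand : ∀ n g f → (n - g) * f ≡ n * f - f * g
  expand = solve-∀

infix 4 _hasLogDerivative_
-- θf/f = g, written as a product so that it also applies to series without constant term, such as
-- `qS` and `uS`.
record _hasLogDerivative_ (f g : Ser) : Set where
  constructor logDerivative
  field D≐ : D f ≐ f ⊛ g
open _hasLogDerivative_ public

≐-logDerivative : ∀ {f g h} → f hasLogDerivative g → g ≐ h → f hasLogDerivative h
≐-logDerivative {f} p e = logDerivative (Ring.trans (D≐ p) (⊛-congˡ f e))

⊛-logDerivative : ∀ {f g f′ g′} → f hasLogDerivative f′ → g hasLogDerivative g′ → (f ⊛ g) hasLogDerivative (f′ ⊕ g′)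
⊛-logDerivative {f} {g} {f′} {g′} p q = logDerivative
  (Ring.trans (D-⊛ f g) (Ring.trans (Ring.+-cong (⊛-congʳ g (D≐ p)) (⊛-congˡ f (D≐ q)))
    (solve 4 (λ f g f′ g′ → f :* f′ :* g :+ f :* (g :* g′) := f :* g :* (f′ :+ g′)) Ring.refl f g f′ g′)))
  where open Solver

D-oneS : D oneS ≐ zeroS
D-oneS .coeff zero    = refl
D-oneS .coeff (suc n) = ℤ.*-zeroʳ (ℤ.+ suc n)

oneS-logDerivative : oneS hasLogDerivative zeroS
oneS-logDerivative = logDerivative (Ring.trans D-oneS (Ring.sym (⊛-identityˡ zeroS)))

^-logDerivative : ∀ {f g} m → f hasLogDerivative g → (f ^S m) hasLogDerivative ((ℤ.+ m) · g)
^-logDerivative zero    p = ≐-logDerivative oneS-logDerivative (pointwise (λ _ → refl))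
^-logDerivative {g = g} (suc m) p = ≐-logDerivative (⊛-logDerivative p (^-logDerivative m p))
  (pointwise (λ n → sym (ℤ.suc-* (ℤ.+ m) (g n))))

inv1-logDerivative : ∀ {f g} → f 0 ≡ 1ℤ → f hasLogDerivative g → inv1 f hasLogDerivative (⊖ g)
inv1-logDerivative {f} {g} f₀ p = logDerivative (⊛-cancelˡ f f₀ (equation cancelled))
  where
  open Consequences (f ∷ inv1 f ∷ g ∷ D f ∷ D (inv1 f) ∷ [])
  Df : var (# 3) ≈ var (# 0) :* var (# 2)
  Df = holds (D≐ p)
  D-product : var (# 3) :* var (# 1) :+ var (# 0) :* var (# 4) ≈ con 0ℤ
  D-product = holds (Ring.trans (Ring.sym (D-⊛ f (inv1 f))) (Ring.trans (D-cong (inv1-inverse f f₀))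
    (Ring.trans D-oneS (pointwise (λ n → refl)))))
  cancelled : var (# 0) :* var (# 4) ≈ var (# 0) :* (var (# 1) :* :- var (# 2))
  cancelled = by (⟨ 1 ⟩ ⋆ D-product ⊹ :- var (# 1) ⋆ Df) _

^S-0 : ∀ f m → f 0 ≡ 1ℤ → (f ^S m) 0 ≡ 1ℤ
^S-0 f zero    f₀ = refl
^S-0 f (suc m) f₀ = trans (⊛-zero f (f ^S m)) (cong₂ _*_ f₀ (^S-0 f m f₀))

-- The logarithmic derivative of the eta quotient

geometric : ℕ → Ser
geometric j n = Σℤ n (λ k → δ (j ℕ.* suc k) n)

-- For positive j, `geometric j` is q^j/(1 - q^j): multiplication by 1 - q^j leaves only its first
-- term.
oneMinusQ-geometric : ∀ j → oneMinusQ (suc j) ⊛ geometric (suc j) ≐ δ (suc j)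
oneMinusQ-geometric j .coeff n = begin
  (oneMinusQ (suc j) ⊛ geometric (suc j)) n
    ≡⟨ anti-cong (λ m r → split m (geometric (suc j) r)) n ⟩
  anti (λ m r → oneS m * geometric (suc j) r + - 1ℤ * (δ (suc j) m * geometric (suc j) r)) n
    ≡⟨ Σ-+ (suc n) _ _ ⟩
  (oneS ⊛ geometric (suc j)) n + anti (λ m r → - 1ℤ * (δ (suc j) m * geometric (suc j) r)) n
    ≡⟨ cong₂ _+_ (coeff (⊛-identityˡ (geometric (suc j))) n) (Σ-*ˡ (suc n) (- 1ℤ) _) ⟩
  geometric (suc j) n + - 1ℤ * anti (λ m r → δ (suc j) m * geometric (suc j) r) n
    ≡⟨ cong (λ z → geometric (suc j) n + - 1ℤ * z) shifted ⟩
  geometric (suc j) n + - 1ℤ * Σℤ n (λ k → δ (suc j ℕ.* suc (suc k)) n)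
    ≡⟨ cong (_+ - 1ℤ * Σℤ n (λ k → δ (suc j ℕ.* suc (suc k)) n)) peel ⟩
  δ (suc j) n + Σℤ n (λ k → δ (suc j ℕ.* suc (suc k)) n) + - 1ℤ * Σℤ n (λ k → δ (suc j ℕ.* suc (suc k)) n)
    ≡⟨ cancel (δ (suc j) n) _ ⟩
  δ (suc j) n ∎
  where
  cancel : ∀ x y → x + y + - 1ℤ * y ≡ x
  cancel = solve-∀
  distribute : ∀ x y z → (x - y) * z ≡ x * z + - 1ℤ * (y * z)
  distribute = solve-∀
  split : ∀ m z → oneMinusQ (suc j) m * z ≡ oneS m * z + - 1ℤ * (δ (suc j) m * z)
  split m z = trans (cong (λ d → (δ m 0 - d) * z) (δ-sym m (suc j))) (distribute (δ m 0) (δ (suc j) m) z)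
  beyond : ∀ {m n} → n ℕ.≤ m → δ (suc j ℕ.* suc m) n ≡ 0ℤ
  beyond {m} {n} n≤m = δ-distinct (λ e → ℕ.<⇒≢ (ℕ.≤-trans (s≤s n≤m) (ℕ.m≤n*m (suc m) (suc j))) (sym e))
  shifted : anti (λ m r → δ (suc j) m * geometric (suc j) r) n ≡ Σℤ n (λ k → δ (suc j ℕ.* suc (suc k)) n)
  shifted = begin
    anti (λ m r → δ (suc j) m * geometric (suc j) r) n
      ≡⟨ Σ-cong (suc n) (λ m → trans (cong (δ (suc j) m *_)
           (sym (Σ-extend {m = n} (ℕ.m∸n≤m n m) (λ i → beyond)))) (sym (Σ-*ˡ n (δ (suc j) m) _))) ⟩
    anti (λ m r → Σℤ n (λ k → δ (suc j) m * δ (suc j ℕ.* suc k) r)) n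
      ≡⟨ Σ-swap (suc n) n _ ⟩
    Σℤ n (λ k → anti (λ m r → δ (suc j) m * δ (suc j ℕ.* suc k) r) n)
      ≡⟨ Σ-cong n (λ k → trans (δ-⊛ (suc j) (suc j ℕ.* suc k) n) (cong (λ m → δ m n) (sym (ℕ.*-suc (suc j) (suc k))))) ⟩
    Σℤ n (λ k → δ (suc j ℕ.* suc (suc k)) n) ∎
  peel : geometric (suc j) n ≡ δ (suc j) n + Σℤ n (λ k → δ (suc j ℕ.* suc (suc k)) n)
  peel = begin
    Σℤ n (λ k → δ (suc j ℕ.* suc k) n)
      ≡⟨ trans (cong (geometric (suc j) n +_) (beyond ℕ.≤-refl)) (ℤ.+-identityʳ _) ⟨
    Σℤ (suc n) (λ k → δ (suc j ℕ.* suc k) n)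
      ≡⟨ Σ-first n _ ⟩
    δ (suc j ℕ.* 1) n + Σℤ n (λ k → δ (suc j ℕ.* suc (suc k)) n)
      ≡⟨ cong (λ m → δ m n + Σℤ n (λ k → δ (suc j ℕ.* suc (suc k)) n)) (ℕ.*-identityʳ (suc j)) ⟩
    δ (suc j) n + Σℤ n (λ k → δ (suc j ℕ.* suc (suc k)) n) ∎

oneMinusQ-logDerivative : ∀ j → oneMinusQ (suc j) hasLogDerivative ((- (ℤ.+ suc j)) · geometric (suc j))
oneMinusQ-logDerivative j = logDerivative (Ring.trans (pointwise derivative) (Ring.trans
  (pointwise (λ n → cong (- (ℤ.+ suc j) *_) (sym (coeff (oneMinusQ-geometric j) n))))
  (Ring.trans (pointwise (λ n → cong (- (ℤ.+ suc j) *_) (coeff (⊛-comm ω γ) n)))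
  (Ring.trans (Ring.sym (·-⊛ (- (ℤ.+ suc j)) γ ω)) (⊛-comm ((- (ℤ.+ suc j)) · γ) ω)))))
  where
  ω γ : Ser
  ω = oneMinusQ (suc j)
  γ = geometric (suc j)
  expand : ∀ n x y → n * (x - y) ≡ n * x + - (n * y)
  expand = solve-∀
  derivative : ∀ n → ℤ.+ n * (δ n 0 - δ n (suc j)) ≡ - (ℤ.+ suc j) * δ (suc j) n
  derivative n = begin
    ℤ.+ n * (δ n 0 - δ n (suc j))
      ≡⟨ expand (ℤ.+ n) (δ n 0) (δ n (suc j)) ⟩
    ℤ.+ n * δ n 0 + - (ℤ.+ n * δ n (suc j))
      ≡⟨ cong₂ (λ x y → x + - y) (coeff D-oneS n)
           (cong (ℤ.+ n *_) (δ-sym n (suc j))) ⟩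
    0ℤ + - (ℤ.+ n * δ (suc j) n)
      ≡⟨ trans (ℤ.+-identityˡ _) (cong -_ (begin
           ℤ.+ n * δ (suc j) n             ≡⟨ cong (ℤ.+ n *_) (ℤ.*-identityʳ _) ⟨
           ℤ.+ n * (δ (suc j) n * 1ℤ)      ≡⟨ δ-weight (suc j) n ℤ.+_ 1ℤ ⟨
           δ (suc j) n * (ℤ.+ suc j * 1ℤ)  ≡⟨ ℤ.*-comm (δ (suc j) n) _ ⟩
           ℤ.+ suc j * 1ℤ * δ (suc j) n    ≡⟨ cong (_* δ (suc j) n) (ℤ.*-identityʳ (ℤ.+ suc j)) ⟩
           ℤ.+ suc j * δ (suc j) n         ∎)) ⟩
    - (ℤ.+ suc j * δ (suc j) n)
      ≡⟨ ℤ.neg-distribˡ-* (ℤ.+ suc j) (δ (suc j) n) ⟩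
    - (ℤ.+ suc j) * δ (suc j) n ∎

oneMinusQ-logDerivative⁺ : ∀ j .{{_ : ℕ.NonZero j}} → oneMinusQ j hasLogDerivative ((- (ℤ.+ j)) · geometric j)
oneMinusQ-logDerivative⁺ (suc j) = oneMinusQ-logDerivative j

etaTerm : ℕ → Ser
etaTerm i n = ℤ.+ 12 * (ℤ.+ suc i * geometric (suc i) n + - 1ℤ * (ℤ.+ (3 ℕ.* suc i) * geometric (3 ℕ.* suc i) n))

etaFactor-logDerivative : ∀ i → etaFactor i hasLogDerivative etaTerm i
etaFactor-logDerivative i = ≐-logDerivative
  (⊛-logDerivative (power (3 ℕ.* suc i)) (inv1-logDerivative (^S-0 (oneMinusQ (suc i)) 12 refl) (power (suc i))))
  (pointwise (λ n → rearrange (ℤ.+ suc i) (ℤ.+ (3 ℕ.* suc i)) (geometric (suc i) n) (geometric (3 ℕ.* suc i) n)))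
  where
  rearrange : ∀ j j₃ g g₃ → ℤ.+ 12 * (- j₃ * g₃) + - (ℤ.+ 12 * (- j * g)) ≡ ℤ.+ 12 * (j * g + - 1ℤ * (j₃ * g₃))
  rearrange = solve-∀
  power : ∀ j .{{_ : ℕ.NonZero j}} → (oneMinusQ j ^S 12) hasLogDerivative ((ℤ.+ 12) · (- (ℤ.+ j)) · geometric j)
  power j = ^-logDerivative 12 (oneMinusQ-logDerivative⁺ j)

geometric-small : ∀ j n → n ℕ.< j → geometric j n ≡ 0ℤ
geometric-small j n n<j = Σ-0 n (λ k → δ-distinct (λ e → ℕ.<⇒≢ (ℕ.≤-trans n<j (ℕ.m≤m*n j (suc k))) (sym e)))

etaTerm-small : ∀ i n → n ℕ.≤ i → etaTerm i n ≡ 0ℤ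
etaTerm-small i n n≤i = cong (ℤ.+ 12 *_) (cong₂ (λ x y → x + - 1ℤ * y)
  (zero-product (ℤ.+ suc i) (geometric-small (suc i) n (s≤s n≤i)))
  (zero-product (ℤ.+ (3 ℕ.* suc i)) (geometric-small (3 ℕ.* suc i) n (ℕ.≤-trans (s≤s n≤i) (ℕ.m≤n*m (suc i) 3)))))
  where
  zero-product : ∀ c {x} → x ≡ 0ℤ → c * x ≡ 0ℤ
  zero-product c refl = ℤ.*-zeroʳ c

etaFactor-0 : ∀ i → etaFactor i 0 ≡ 1ℤ
etaFactor-0 i = trans (⊛-zero (oneMinusQ (3 ℕ.* suc i) ^S 12) (inv1 (oneMinusQ (suc i) ^S 12))) (cong (_* 1ℤ) (^S-0 (oneMinusQ (3 ℕ.* suc i)) 12 refl))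

⊛-cong-≤ : ∀ f g h n → (∀ m → m ℕ.≤ n → g m ≡ h m) → (f ⊛ g) n ≡ (f ⊛ h) n
⊛-cong-≤ f g h n e = Σ-cong (suc n) (λ k → cong (f k *_) (e (n ∸ k) (ℕ.m∸n≤m n k)))

-- For n > 0, n times the coefficient is a sum of products with coefficients of `etaTerm i` up to n,
-- and these vanish for n ≤ i.
etaFactor-small : ∀ i n → n ℕ.≤ i → etaFactor i n ≡ oneS n
etaFactor-small i = <-rec _ go
  where
  go : ∀ n → (∀ {m} → m ℕ.< n → m ℕ.≤ i → etaFactor i m ≡ oneS m) → n ℕ.≤ i → etaFactor i n ≡ oneS n
  go zero    rec n≤i = etaFactor-0 i
  go (suc n) rec n≤i = ℤ.*-cancelˡ-≡ (ℤ.+ suc n) (etaFactor i (suc n)) 0ℤ (begin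
    ℤ.+ suc n * etaFactor i (suc n)     ≡⟨ coeff (D≐ (etaFactor-logDerivative i)) (suc n) ⟩
    (etaFactor i ⊛ etaTerm i) (suc n)   ≡⟨ ⊛-cong-≤ (etaFactor i) (etaTerm i) zeroS (suc n)
                                             (λ m m≤ → etaTerm-small i m (ℕ.≤-trans m≤ n≤i)) ⟩
    (etaFactor i ⊛ zeroS) (suc n)       ≡⟨ anti-0 (λ k _ → ℤ.*-zeroʳ (etaFactor i k)) (suc n) ⟩
    0ℤ                                  ≡⟨ ℤ.*-zeroʳ (ℤ.+ suc n) ⟨
    ℤ.+ suc n * 0ℤ                      ∎)

-- Each coefficient of `uOverQ` comes from a different partial product. Stability lets all
-- coefficients up to n be read off the n-th one, to which the finite product rule applies.
ΠS-stable : ∀ n d → ΠS (d ℕ.+ n) etaFactor n ≡ uOverQ n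
ΠS-stable n zero    = refl
ΠS-stable n (suc d) = begin
  (ΠS (d ℕ.+ n) etaFactor ⊛ etaFactor (d ℕ.+ n)) n
    ≡⟨ ⊛-cong-≤ (ΠS (d ℕ.+ n) etaFactor) (etaFactor (d ℕ.+ n)) oneS n
         (λ m m≤n → etaFactor-small (d ℕ.+ n) m (ℕ.≤-trans m≤n (ℕ.m≤n+m n d))) ⟩
  (ΠS (d ℕ.+ n) etaFactor ⊛ oneS) n
    ≡⟨ coeff (Ring.*-identityʳ (ΠS (d ℕ.+ n) etaFactor)) n ⟩
  ΠS (d ℕ.+ n) etaFactor n
    ≡⟨ ΠS-stable n d ⟩
  uOverQ n ∎

ΣS : ℕ → (ℕ → Ser) → Ser
ΣS N f n = Σℤ N (λ i → f i n)

ΠS-logDerivative : ∀ N {f g} → (∀ i → f i hasLogDerivative g i) → ΠS N f hasLogDerivative ΣS N g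
ΠS-logDerivative zero    p = oneS-logDerivative
ΠS-logDerivative (suc N) p = ⊛-logDerivative (ΠS-logDerivative N p) (p N)

-- The terms i q^i/(1 - q^i) add up to `R` and those for 3 i to `R₃`, and `S` is the difference of
-- the two.
etaTerm-sum : ∀ n r → r ℕ.≤ n → ΣS n etaTerm r ≡ ((ℤ.+ 12) · S) r
etaTerm-sum n r r≤n = begin
  Σℤ n (λ i → etaTerm i r)
    ≡⟨ Σ-extend r≤n (λ i → etaTerm-small i r) ⟩
  Σℤ r (λ i → etaTerm i r)
    ≡⟨ Σ-*ˡ r (ℤ.+ 12) _ ⟩
  ℤ.+ 12 * Σℤ r (λ i → ℤ.+ suc i * geometric (suc i) r + - 1ℤ * (ℤ.+ (3 ℕ.* suc i) * geometric (3 ℕ.* suc i) r))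
    ≡⟨ cong (ℤ.+ 12 *_) (trans (Σ-+ r _ _) (cong₂ _+_
         (Σ-cong r (λ i → row (ℤ.+ suc i) (λ k → δ (suc i ℕ.* suc k) r)))
         (trans (Σ-*ˡ r (- 1ℤ) _) (cong (- 1ℤ *_) (Σ-cong r (λ i → row (ℤ.+ (3 ℕ.* suc i)) (λ k → δ (3 ℕ.* suc i ℕ.* suc k) r))))))) ⟩
  ℤ.+ 12 * (R r + - 1ℤ * R₃ r)
    ≡⟨ cong (ℤ.+ 12 *_) (coeff S≐ r) ⟨
  ℤ.+ 12 * S r ∎
  where
  row : ∀ c (f : ℕ → ℤ) → c * Σℤ r f ≡ Σℤ r (λ k → f k * c)
  row c f = trans (ℤ.*-comm c (Σℤ r f)) (sym (Σ-*ʳ r c f))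

uOverQ-logDerivative : uOverQ hasLogDerivative ((ℤ.+ 12) · S)
uOverQ-logDerivative = logDerivative (pointwise (λ n → begin
  ℤ.+ n * uOverQ n
    ≡⟨ coeff (D≐ (ΠS-logDerivative n etaFactor-logDerivative)) n ⟩
  (ΠS n etaFactor ⊛ ΣS n etaTerm) n
    ≡⟨ Σ-cong< (suc n) (λ k k≤n → cong₂ _*_
         (trans (cong (λ N → ΠS N etaFactor k) (sym (ℕ.m∸n+n≡m (ℕ.s≤s⁻¹ k≤n)))) (ΠS-stable k (n ∸ k)))
         (etaTerm-sum n (n ∸ k) (ℕ.m∸n≤m n k))) ⟩
  (uOverQ ⊛ ((ℤ.+ 12) · S)) n ∎))

qS-logDerivative : qS hasLogDerivative oneS
qS-logDerivative = logDerivative (Ring.trans D-qS (Ring.sym (Ring.*-identityʳ qS)))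

uS-logDerivative : uS hasLogDerivative P
uS-logDerivative = ≐-logDerivative (⊛-logDerivative qS-logDerivative uOverQ-logDerivative)
  (Ring.+-cong (pointwise (λ n → sym (ℤ.*-identityˡ (oneS n)))) (·-• (ℤ.+ 12) S))

uS-0 : uS 0 ≡ 0ℤ
uS-0 = qS-⊛-zero uOverQ

uS-1 : uS 1 ≡ 1ℤ
uS-1 = qS-⊛-suc uOverQ 0

-- Identification of V with u B

module V-uB where
  open Differential-system using (V′≈; B′≈)
  open Consequences (V ∷ uS ∷ B ∷ G ∷ P ∷ D V ∷ D uS ∷ D B ∷ D (uS ⊛ B) ∷ D (V ⊕ ⊖ (uS ⊛ B)) ∷ [])

  V̲ u̲ B̲ G̲ P̲ V′ u′ B′ [uB]′ difference′ : Polynomial 10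
  V̲ = var (# 0)
  u̲ = var (# 1)
  B̲ = var (# 2)
  G̲ = var (# 3)
  P̲ = var (# 4)
  V′ = var (# 5)
  u′ = var (# 6)
  B′ = var (# 7)
  [uB]′ = var (# 8)
  difference′ = var (# 9)

  difference : Ser
  difference = V ⊕ ⊖ (uS ⊛ B)

  difference-D : difference′ ≈ (V̲ :- u̲ :* B̲) :* (G̲ :+ P̲)
  difference-D = by (⟨ 1 ⟩ ⋆ h ⊹ ⟨ 1 ⟩ ⋆ h₁ ⊹ :- ⟨ 1 ⟩ ⋆ h₂ ⊹ :- B̲ ⋆ h₃ ⊹ :- u̲ ⋆ h₄) _
    where
    h : difference′ ≈ V′ :- [uB]′
    h = holds (pointwise (λ n → trans (ℤ.*-distribˡ-+ (ℤ.+ n) (V n) _) (cong (ℤ.+ n * V n +_) (sym (ℤ.neg-distribʳ-* (ℤ.+ n) _)))))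
    h₁ : V′ ≈ (G̲ :+ P̲) :* V̲
    h₁ = holds (Consequences.equation V′≈)
    h₂ : [uB]′ ≈ u′ :* B̲ :+ u̲ :* B′
    h₂ = holds (D-⊛ uS B)
    h₃ : u′ ≈ u̲ :* P̲
    h₃ = holds (D≐ uS-logDerivative)
    h₄ : B′ ≈ G̲ :* B̲
    h₄ = holds (Consequences.equation B′≈)

  vanishes : ∀ n → difference n ≡ 0ℤ
  vanishes = <-rec _ go
    where
    go : ∀ n → (∀ {m} → m ℕ.< n → difference m ≡ 0ℤ) → difference n ≡ 0ℤ
    go zero          rec = cong (λ x → 0ℤ + - x) (trans (⊛-zero uS B) (cong (_* 1ℤ) uS-0))
    go (suc zero)    rec = cong (λ x → 1ℤ + - x) (trans (⊛-suc uS B 0)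
      (cong₂ _+_ (cong (_* B 1) uS-0) (trans (⊛-zero (shift uS) B) (cong (_* 1ℤ) uS-1))))
    -- `G ⊕ P` has constant term 1, so the equation determines the coefficients from the second on
    -- but says nothing about that of q, which is compared directly.
    go (suc (suc n)) rec = D-vanish difference (G ⊕ P) (suc (suc n)) (equation difference-D) (λ k → rec) (λ ())

V≐uB : V ≐ uS ⊛ B
V≐uB .coeff n = ℤ.i-j≡0⇒i≡j (V n) ((uS ⊛ B) n) (V-uB.vanishes n)

-- The differential equation

s : Ser
s = shift tS

νS : Ser
νS = oneS ⊕ (ℤ.+ 27) · uS

νS-0 : νS 0 ≡ 1ℤ
νS-0 = cong (λ x → 1ℤ + ℤ.+ 27 * x) uS-0

1+27u 1-27u : Ser
1+27u = κ 1ℤ ⊕ (ℤ.+ 27) • uS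
1-27u = κ 1ℤ ⊕ (- (ℤ.+ 27)) • uS

νS-affine : νS ≐ 1+27u
νS-affine = Ring.+-cong (pointwise (λ n → sym (ℤ.*-identityˡ (oneS n)))) (·-• (ℤ.+ 27) uS)

tS-0 : tS 0 ≡ 0ℤ
tS-0 = trans (⊛-zero uS (inv1 (νS ^S 2))) (cong (_* 1ℤ) uS-0)

s-0 : s 0 ≡ 1ℤ
s-0 = trans (⊛-suc uS (inv1 (νS ^S 2)) 0) (cong₂ _+_ (cong (_* inv1 (νS ^S 2) 1) uS-0)
  (trans (⊛-zero (shift uS) (inv1 (νS ^S 2))) (cong (_* 1ℤ) uS-1)))

tS≐qs : tS ≐ qS ⊛ s
tS≐qs .coeff zero    = tS-0
tS≐qs .coeff (suc n) = sym (qS-⊛-suc s n)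

sH : s ⊛ Hmix ≐ oneS
sH = inv1-inverse s s-0

shift-tS-⊛ : ∀ f → shift (tS ⊛ f) ≐ s ⊛ f
shift-tS-⊛ f .coeff n = trans (⊛-suc tS f n) (trans (cong (λ x → x * f (suc n) + (s ⊛ f) n) tS-0) (ℤ.+-identityˡ _))

-- t has no constant term, but without its factor q it becomes `s`, which starts with 1.
tS-cancelˡ : ∀ {f g} → tS ⊛ f ≐ tS ⊛ g → f ≐ g
tS-cancelˡ {f} {g} e = ⊛-cancelˡ s s-0 (Ring.trans (Ring.sym (shift-tS-⊛ f))
  (Ring.trans (pointwise (λ n → coeff e (suc n))) (shift-tS-⊛ g)))

-- θt/t
λS : Ser
λS = oneS ⊕ D s ⊛ Hmix

λS-0 : λS 0 ≡ 1ℤ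
λS-0 = cong (1ℤ +_) (⊛-zero (D s) Hmix)

s-logDerivative : s hasLogDerivative (D s ⊛ Hmix)
s-logDerivative = logDerivative (Ring.sym (Ring.trans rearrange (Ring.trans (⊛-congˡ (D s) sH) (Ring.*-identityʳ (D s)))))
  where
  open Solver
  rearrange : s ⊛ (D s ⊛ Hmix) ≐ D s ⊛ (s ⊛ Hmix)
  rearrange = solve 3 (λ s s′ h → s :* (s′ :* h) := s′ :* (s :* h)) Ring.refl s (D s) Hmix

tS-logDerivative : tS hasLogDerivative λS
tS-logDerivative = logDerivative (Ring.trans (D-cong tS≐qs)
  (Ring.trans (D≐ (⊛-logDerivative qS-logDerivative s-logDerivative)) (⊛-congʳ λS (Ring.sym tS≐qs))))

-- Since θt = λ t, the chain rule reads θf = λ t df/dt; dividing by λ therefore gives t d/dt.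
ϑ : Ser → Ser
ϑ f = inv1 λS ⊛ D f

λϑ : ∀ f → λS ⊛ ϑ f ≐ D f
λϑ f = Ring.trans (Ring.sym (⊛-assoc λS (inv1 λS) (D f)))
  (Ring.trans (⊛-congʳ (D f) (inv1-inverse λS λS-0)) (⊛-identityˡ (D f)))

-- Eliminating θ in favour of ϑ = t d/dt turns the differential system into the equation of ₂F₁(1/6,1/3;1;108t).
module Hypergeometric-equation where
  private module S = Differential-system
  open Consequences (a ∷ P ∷ B ∷ V ∷ uS ∷ tS ∷ λS ∷ ϑ a ∷ ϑ (ϑ a) ∷ D a ∷ D (D a) ∷ D P ∷ D uS ∷ D tS ∷ D (ϑ a) ∷ E ∷ F ∷ [])

  a̲ P̲ B̲ V̲ u̲ t̲ λ̲ X̲ Y̲ a′ a″ P′ u′ t′ X′ E̲ F̲ ν̲ μ̲ : Polynomial 17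
  a̲ = var (# 0)
  P̲ = var (# 1)
  B̲ = var (# 2)
  V̲ = var (# 3)
  u̲ = var (# 4)
  t̲ = var (# 5)
  λ̲ = var (# 6)
  X̲ = var (# 7)
  Y̲ = var (# 8)
  a′ = var (# 9)
  a″ = var (# 10)
  P′ = var (# 11)
  u′ = var (# 12)
  t′ = var (# 13)
  X′ = var (# 14)
  E̲ = var (# 15)
  F̲ = var (# 16)
  ν̲ = con 1ℤ :+ con (ℤ.+ 27) :* u̲
  μ̲ = con 1ℤ :+ con (- (ℤ.+ 27)) :* u̲

  a²≈ : a̲ :* a̲ ≈ P̲
  a²≈ = holds (Consequences.equation S.a²≈)

  V≈ : V̲ ≈ u̲ :* B̲
  V≈ = holds V≐uB

  a³≈ : a̲ :* a̲ :* a̲ ≈ B̲ :* ν̲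
  a³≈ = by (⟨ 1 ⟩ ⋆ h ⊹ ⟨ 27 ⟩ ⋆ V≈) _
    where
    h : a̲ :* a̲ :* a̲ ≈ B̲ :+ ⟨ 27 ⟩ :* V̲
    h = holds (Consequences.equation S.a³≈)

  u′≈ : u′ ≈ u̲ :* P̲
  u′≈ = holds (D≐ uS-logDerivative)

  t′≈ : t′ ≈ t̲ :* λ̲
  t′≈ = holds (D≐ tS-logDerivative)

  tν²≈ : t̲ :* (ν̲ :* ν̲) ≈ u̲
  tν²≈ = holds (Ring.trans (⊛-congˡ tS (Ring.sym square)) quotient)
    where
    square : νS ^S 2 ≐ 1+27u ⊛ 1+27u
    square = ⊛-cong νS-affine (Ring.trans (Ring.*-identityʳ νS) νS-affine)
    w : Ser
    w = inv1 (νS ^S 2)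
    quotient : tS ⊛ (νS ^S 2) ≐ uS
    quotient = Ring.trans (⊛-assoc uS w (νS ^S 2)) (Ring.trans (⊛-congˡ uS (Ring.trans (⊛-comm w (νS ^S 2))
      (inv1-inverse (νS ^S 2) (^S-0 νS 2 νS-0)))) (Ring.*-identityʳ uS))

  -- Logarithmic differentiation of t ν² = u gives λ + 54 u P/ν = P, where ν = 1 + 27 u and ν - 54 u
  -- = μ.
  νλ≈ : ν̲ :* λ̲ ≈ P̲ :* μ̲
  νλ≈ = holds (⊛-cancelˡ 1+27u (trans (sym (coeff νS-affine 0)) νS-0) (tS-cancelˡ (equation cancelled)))
    where
    D-ν : D 1+27u ≐ (ℤ.+ 27) • D uS
    D-ν = D-affine 1ℤ (ℤ.+ 27) uS
    [tν²]′≈ : t′ :* (ν̲ :* ν̲) :+ t̲ :* ((⟨ 27 ⟩ :* u′) :* ν̲ :+ ν̲ :* (⟨ 27 ⟩ :* u′)) ≈ u′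
    [tν²]′≈ = holds (Ring.trans (Ring.sym (Ring.trans (D-⊛ tS (1+27u ⊛ 1+27u)) (⊕-congˡ (D tS ⊛ (1+27u ⊛ 1+27u))
      (⊛-congˡ tS (Ring.trans (D-⊛ 1+27u 1+27u) (Ring.+-cong (⊛-congʳ 1+27u D-ν) (⊛-congˡ 1+27u D-ν)))))))
      (D-cong (equation tν²≈)))
    cancelled : t̲ :* (ν̲ :* (ν̲ :* λ̲)) ≈ t̲ :* (ν̲ :* (P̲ :* μ̲))
    cancelled = by (⟨ 1 ⟩ ⋆ [tν²]′≈ ⊹ :- (ν̲ :* ν̲) ⋆ t′≈ ⊹ (⟨ 1 ⟩ :- ⟨ 54 ⟩ :* (t̲ :* ν̲)) ⋆ u′≈ ⊹ :- P̲ ⋆ tν²≈) _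

  λX≈ : λ̲ :* X̲ ≈ a′
  λX≈ = holds (λϑ a)

  λY≈ : λ̲ :* Y̲ ≈ X′
  λY≈ = holds (λϑ (ϑ a))

  P′≈ : P′ ≈ ⟨ 2 ⟩ :* (a̲ :* a′)
  P′≈ = by (:- ⟨ 1 ⟩ ⋆ h) _
    where
    h : a′ :* a̲ :+ a̲ :* a′ ≈ P′
    h = holds (Ring.trans (Ring.sym (D-⊛ a a)) (D-cong (equation a²≈)))

  PμX≈ : P̲ :* μ̲ :* X̲ ≈ ν̲ :* a′
  PμX≈ = by (:- X̲ ⋆ νλ≈ ⊹ ν̲ ⋆ λX≈) _

  W≈ : a̲ :* a″ :- ⟨ 2 ⟩ :* (a′ :* a′) ≈ ⟨ 6 ⟩ :* (V̲ :* B̲)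
  W≈ = holds (•-cancel 9 W 6VB (Consequences.equation S.9W≈))
    where
    W 6VB : Ser
    W = a ⊛ D (D a) ⊕ ⊖ ((ℤ.+ 2) • (D a ⊛ D a))
    6VB = (ℤ.+ 6) • (V ⊛ B)

  [PμX]′≈ : (P′ :* μ̲ :+ P̲ :* (con (- (ℤ.+ 27)) :* u′)) :* X̲ :+ P̲ :* μ̲ :* X′ ≈ ⟨ 27 ⟩ :* u′ :* a′ :+ ν̲ :* a″
  [PμX]′≈ = holds (Ring.trans (Ring.sym left) (Ring.trans (D-cong (equation PμX≈)) right))
    where
    left : D (P ⊛ 1-27u ⊛ ϑ a) ≐ (D P ⊛ 1-27u ⊕ P ⊛ ((- (ℤ.+ 27)) • D uS)) ⊛ ϑ a ⊕ P ⊛ 1-27u ⊛ D (ϑ a)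
    left = Ring.trans (D-⊛ (P ⊛ 1-27u) (ϑ a)) (⊕-congʳ (P ⊛ 1-27u ⊛ D (ϑ a)) (⊛-congʳ (ϑ a)
      (Ring.trans (D-⊛ P 1-27u) (⊕-congˡ (D P ⊛ 1-27u) (⊛-congˡ P (D-affine 1ℤ (- (ℤ.+ 27)) uS))))))
    right : D (1+27u ⊛ D a) ≐ (ℤ.+ 27) • D uS ⊛ D a ⊕ 1+27u ⊛ D (D a)
    right = Ring.trans (D-⊛ 1+27u (D a)) (⊕-congʳ (1+27u ⊛ D (D a)) (⊛-congʳ (D a) (D-affine 1ℤ (ℤ.+ 27) uS)))

  -- Differentiate P μ X = ν θa and multiply by a ν. After `W≈` replaces a θ²a, the terms 2 ν² (θa)²
  -- cancel; ν B = a³ turns 6 ν² V B into 6 u a⁶, and the two terms with 27 combine to 54 by ν + μ =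
  -- 2.
  aP²μ²Y≈ : a̲ :* (P̲ :* P̲) :* (μ̲ :* μ̲ :* Y̲) ≈ a̲ :* (P̲ :* P̲) :* (u̲ :* (⟨ 54 ⟩ :* X̲ :+ ⟨ 6 ⟩ :* a̲))
  aP²μ²Y≈ = by (:- (a̲ :* P̲ :* μ̲ :* Y̲) ⋆ νλ≈ ⊹ a̲ :* P̲ :* μ̲ :* ν̲ ⋆ λY≈ ⊹ a̲ :* ν̲ ⋆ [PμX]′≈
                ⊹ :- (a̲ :* ν̲ :* μ̲ :* X̲) ⋆ P′≈ ⊹ ⟨ 27 ⟩ :* (a̲ :* ν̲) :* (P̲ :* X̲ :+ a′) ⋆ u′≈
                ⊹ ⟨ 6 ⟩ :* (u̲ :* a̲ :* a̲ :* (a̲ :* a̲ :+ P̲)) :- ⟨ 2 ⟩ :* (ν̲ :* μ̲ :* X̲ :* a′) ⋆ a²≈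
                ⊹ :- (⟨ 27 ⟩ :* (a̲ :* u̲ :* P̲) :+ ⟨ 2 ⟩ :* (ν̲ :* a′)) ⋆ PμX≈
                ⊹ ν̲ :* ν̲ ⋆ W≈ ⊹ ⟨ 6 ⟩ :* (ν̲ :* ν̲ :* B̲) ⋆ V≈
                ⊹ :- (⟨ 6 ⟩ :* (u̲ :* (a̲ :* a̲ :* a̲ :+ B̲ :* ν̲))) ⋆ a³≈) _

  μ²Y≈ : μ̲ :* μ̲ :* Y̲ ≈ u̲ :* (⟨ 54 ⟩ :* X̲ :+ ⟨ 6 ⟩ :* a̲)
  μ²Y≈ = holds (⊛-cancelˡ (a ⊛ (P ⊛ P)) refl (equation aP²μ²Y≈))

  -- The origin of 108: μ² = ν² - 108 u with u = t ν², so that μ² = ν² (1 - 108 t). The operator on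
  -- the right is 108 (ϑ + 1/6)(ϑ + 1/3).
  Y≈ : Y̲ ≈ t̲ :* (⟨ 108 ⟩ :* Y̲ :+ ⟨ 54 ⟩ :* X̲ :+ ⟨ 6 ⟩ :* a̲)
  Y≈ = holds (⊛-cancelˡ (1+27u ⊛ 1+27u) ν²-0 (equation cancelled))
    where
    ν²-0 : (1+27u ⊛ 1+27u) 0 ≡ 1ℤ
    ν²-0 = trans (⊛-zero 1+27u 1+27u) (cong (λ x → x * x) (trans (sym (coeff νS-affine 0)) νS-0))
    cancelled : ν̲ :* ν̲ :* Y̲ ≈ ν̲ :* ν̲ :* (t̲ :* (⟨ 108 ⟩ :* Y̲ :+ ⟨ 54 ⟩ :* X̲ :+ ⟨ 6 ⟩ :* a̲))
    cancelled = by (⟨ 1 ⟩ ⋆ μ²Y≈ ⊹ :- (⟨ 108 ⟩ :* Y̲ :+ ⟨ 54 ⟩ :* X̲ :+ ⟨ 6 ⟩ :* a̲) ⋆ tν²≈) _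

  -- The weight 5 evaluations make the left side P B - 27 P V = P B (1 - 27 u), which is B ν λ.
  a³λ≈ : ⟨ 1 ⟩ :+ con (ℤ.+ 3) :* F̲ :+ con (- (ℤ.+ 27)) :* E̲ ≈ a̲ :* a̲ :* a̲ :* λ̲
  a³λ≈ = by (:- ⟨ 1 ⟩ ⋆ PB≈ ⊹ ⟨ 27 ⟩ ⋆ PV≈ ⊹ :- (⟨ 27 ⟩ :* P̲) ⋆ V≈ ⊹ :- B̲ ⋆ νλ≈ ⊹ :- λ̲ ⋆ a³≈) _
    where
    PB≈ : P̲ :* B̲ ≈ ⟨ 1 ⟩ :+ ⟨ 3 ⟩ :* F̲
    PB≈ = holds (Consequences.equation Lambert-identities.PB≈)
    PV≈ : P̲ :* V̲ ≈ E̲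
    PV≈ = holds (Consequences.equation Lambert-identities.PV≈)

-- The coefficients of C_mix as Lambert coefficients

Σ-single : ∀ {n} k (f : ℕ → ℤ) → k ℕ.< n → (∀ i → i ≢ k → f i ≡ 0ℤ) → Σℤ n f ≡ f k
Σ-single {suc n} k f k<n e with k ℕ.≟ n
... | yes refl = trans (cong (_+ f n) (trans (Σ-cong< n (λ i i<n → e i (ℕ.<⇒≢ i<n))) (Σ-0 n (λ _ → refl)))) (ℤ.+-identityˡ (f n))
... | no k≢n = trans (cong₂ _+_ (Σ-single k f (ℕ.≤∧≢⇒< (ℕ.s≤s⁻¹ k<n) k≢n) e) (e n (λ e → k≢n (sym e)))) (ℤ.+-identityʳ (f k))

-- The summand of divSum is local to its definition; unification names it.
mutual
  divSum-term : ℕ → (ℕ → ℕ → ℤ) → ℕ → ℤ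
  divSum-term = _

  divSum-unfold : ∀ n g → divSum n g ≡ Σℤ n (divSum-term n g)
  divSum-unfold n g = refl

-- A divisor has exactly one cofactor, so each row of the Lambert sum has at most one nonzero term.
divSum-lambert : ∀ n g → divSum (suc n) g ≡ lambert g (suc n)
divSum-lambert n g = Σ-cong (suc n) row
  where
  n⁺ : ℕ
  n⁺ = suc n
  row : ∀ i → divSum-term n⁺ g i ≡ Σℤ n⁺ (λ k → δ (suc i ℕ.* suc k) n⁺ * g (suc i) (suc k))
  row i with suc i ∣? n⁺
  ... | no ∤ = sym (Σ-0 n⁺ (λ k → cong (_* g (suc i) (suc k)) (δ-distinct (λ e →
          ∤ (divides (suc k) (trans (sym e) (ℕ.*-comm (suc i) (suc k))))))))
  ... | yes (divides (suc k) e) = sym (begin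
      Σℤ n⁺ (λ k → δ (suc i ℕ.* suc k) n⁺ * g (suc i) (suc k))
        ≡⟨ Σ-single k _ k<n⁺ (λ k′ k′≢k → cong (_* g (suc i) (suc k′)) (δ-distinct (λ e′ →
             k′≢k (ℕ.suc-injective (ℕ.*-cancelˡ-≡ (suc k′) (suc k) (suc i) (trans e′ n⁺≡)))))) ⟩
      δ (suc i ℕ.* suc k) n⁺ * g (suc i) (suc k)
        ≡⟨ cong₂ (λ m j → δ m n⁺ * g (suc i) j) (sym n⁺≡) (sym quotient) ⟩
      δ n⁺ n⁺ * g (suc i) (n⁺ ℕ./ suc i)
        ≡⟨ trans (cong (_* g (suc i) (n⁺ ℕ./ suc i)) (δ-same n⁺)) (ℤ.*-identityˡ _) ⟩
      g (suc i) (n⁺ ℕ./ suc i) ∎)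
    where
    n⁺≡ : n⁺ ≡ suc i ℕ.* suc k
    n⁺≡ = trans e (ℕ.*-comm (suc k) (suc i))
    k<n⁺ : k ℕ.< n⁺
    k<n⁺ = subst (suc k ℕ.≤_) (sym n⁺≡) (ℕ.m≤n*m (suc k) (suc i))
    quotient : n⁺ ℕ./ suc i ≡ suc k
    quotient = trans (cong (ℕ._/ suc i) e) (ℕ.m*n/n≡m (suc k) (suc i))

χ₃-% : ∀ m n → m ℕ.% 3 ≡ n ℕ.% 3 → χ₃ m ≡ χ₃ n
χ₃-% m n e with m ℕ.% 3 | n ℕ.% 3 | e
... | _ | _ | refl = refl

χ₃-χ : ∀ n → χ₃ n ≡ χ (ρ n)
χ₃-χ 0 = refl
χ₃-χ 1 = refl
χ₃-χ 2 = refl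
χ₃-χ (suc (suc (suc n))) = begin
  χ₃ (3 ℕ.+ n)                       ≡⟨ χ₃-% (3 ℕ.+ n) n (trans (cong (ℕ._% 3) (ℕ.+-comm 3 n)) (ℕ.[m+n]%n≡m%n n 3)) ⟩
  χ₃ n                               ≡⟨ χ₃-χ n ⟩
  χ (ρ n)                            ≡⟨ cong χ (period (ρ n)) ⟨
  χ (next (next (next (ρ n))))       ∎
  where
  period : ∀ r → next (next (next r)) ≡ r
  period r0 = refl
  period r1 = refl
  period r2 = refl

pos-^4 : ∀ d → ℤ.+ (d ℕ.^ 4) ≡ ℤ.+ d * ℤ.+ d * ℤ.+ d * ℤ.+ d
pos-^4 d = trans (ℤ.pos-* d (d ℕ.^ 3)) (trans (cong (ℤ.+ d *_) (trans (ℤ.pos-* d (d ℕ.^ 2))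
  (cong (ℤ.+ d *_) (trans (ℤ.pos-* d (d ℕ.^ 1)) (cong (ℤ.+ d *_) (ℤ.pos-* d 1)))))) (associate (ℤ.+ d)))
  where
  associate : ∀ x → x * (x * (x * (x * 1ℤ))) ≡ x * x * x * x
  associate = solve-∀

Cmix≐a³λ : Cmix ≐ a ⊛ a ⊛ a ⊛ λS
Cmix≐a³λ = Ring.trans (pointwise coefficients) (Consequences.equation Hypergeometric-equation.a³λ≈)
  where
  g₁ g₂ : ℕ → ℕ → ℤ
  g₁ d e = χ₃ d * ℤ.+ (d ℕ.^ 4)
  g₂ d e = χ₃ e * ℤ.+ (d ℕ.^ 4)
  F≐ : lambert g₁ ≐ F
  F≐ = lambert-cong g₁ (λ d e → value (χ₄ (ρ d)) d e) (λ i k → cong₂ _*_ (χ₃-χ (suc i)) (pos-^4 (suc i)))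
  E≐ : lambert g₂ ≐ E
  E≐ = lambert-cong g₂ (λ d e → value (χ₄ (ρ e)) d e) (λ i k → cong₂ _*_ (χ₃-χ (suc k)) (pos-^4 (suc i)))
  rearrange : ∀ x y → ℤ.+ 3 * x - ℤ.+ 27 * y ≡ 0ℤ + ℤ.+ 3 * x + - (ℤ.+ 27) * y
  rearrange = solve-∀
  coefficients : ∀ n → Cmix n ≡ (κ 1ℤ ⊕ (ℤ.+ 3) • F ⊕ (- (ℤ.+ 27)) • E) n
  coefficients zero = refl
  coefficients (suc n) = begin
    ℤ.+ 3 * divSum (suc n) g₁ - ℤ.+ 27 * divSum (suc n) g₂
      ≡⟨ cong₂ (λ x y → ℤ.+ 3 * x - ℤ.+ 27 * y) (trans (divSum-lambert n g₁) (coeff F≐ (suc n)))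
           (trans (divSum-lambert n g₂) (coeff E≐ (suc n))) ⟩
    ℤ.+ 3 * F (suc n) - ℤ.+ 27 * E (suc n)
      ≡⟨ rearrange (F (suc n)) (E (suc n)) ⟩
    0ℤ + ℤ.+ 3 * F (suc n) + - (ℤ.+ 27) * E (suc n)
      ≡⟨ cong₂ (λ x y → 0ℤ + x + y) (coeff (·-• (ℤ.+ 3) F) (suc n)) (coeff (·-• (- (ℤ.+ 27)) E) (suc n)) ⟩
    (κ 1ℤ ⊕ (ℤ.+ 3) • F ⊕ (- (ℤ.+ 27)) • E) (suc n) ∎

-- digits f are the coefficients of f in powers of t, since f = f₀ + t · step f.

step : Ser → Ser
step f = Hmix ⊛ shift f

digits : Ser → Ser
digits f zero    = f 0
digits f (suc k) = digits (step f) k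

shift-cong : ∀ {f g} → f ≐ g → shift f ≐ shift g
shift-cong e .coeff n = coeff e (suc n)

step-cong : ∀ {f g} → f ≐ g → step f ≐ step g
step-cong e = ⊛-congˡ Hmix (shift-cong e)

digits-cong : ∀ {f g} → f ≐ g → digits f ≐ digits g
digits-cong e .coeff zero    = coeff e 0
digits-cong e .coeff (suc k) = coeff (digits-cong (step-cong e)) k

digits-⊕ : ∀ f g → digits (f ⊕ g) ≐ digits f ⊕ digits g
digits-⊕ f g .coeff zero    = refl
digits-⊕ f g .coeff (suc k) = trans (coeff (digits-cong (⊛-distribˡ Hmix (shift f) (shift g))) k)
  (coeff (digits-⊕ (step f) (step g)) k)

digits-· : ∀ c f → digits (c · f) ≐ c · digits f
digits-· c f .coeff zero    = refl
digits-· c f .coeff (suc k) = trans (coeff (digits-cong step-·) k) (coeff (digits-· c (step f)) k)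
  where
  step-· : step (c · f) ≐ c · step f
  step-· = Ring.trans (⊛-comm Hmix (c · shift f)) (Ring.trans (·-⊛ c (shift f) Hmix) (·-cong c (⊛-comm (shift f) Hmix)))

-- `step` obeys the same product rule as `shift`, so the recursion of the Cauchy product carries
-- over to powers of t.
digits-⊛ : ∀ f g → digits (f ⊛ g) ≐ digits f ⊛ digits g
digits-⊛ f g .coeff zero    = trans (⊛-zero f g) (sym (⊛-zero (digits f) (digits g)))
digits-⊛ f g .coeff (suc k) = begin
  digits (step (f ⊛ g)) k
    ≡⟨ coeff (digits-cong step-⊛) k ⟩
  digits (f 0 · step g ⊕ step f ⊛ g) k
    ≡⟨ coeff (digits-⊕ (f 0 · step g) (step f ⊛ g)) k ⟩
  digits (f 0 · step g) k + digits (step f ⊛ g) k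
    ≡⟨ cong₂ _+_ (coeff (digits-· (f 0) (step g)) k) (coeff (digits-⊛ (step f) g) k) ⟩
  f 0 * digits (step g) k + (digits (step f) ⊛ digits g) k
    ≡⟨ ⊛-suc (digits f) (digits g) k ⟨
  (digits f ⊛ digits g) (suc k) ∎
  where
  step-⊛ : step (f ⊛ g) ≐ f 0 · step g ⊕ step f ⊛ g
  step-⊛ = Ring.trans (⊛-congˡ Hmix (pointwise (⊛-suc f g))) (Ring.trans (⊛-distribˡ Hmix (f 0 · shift g) (shift f ⊛ g))
    (Ring.+-cong (Ring.trans (⊛-comm Hmix (f 0 · shift g)) (Ring.trans (·-⊛ (f 0) (shift g) Hmix)
        (·-cong (f 0) (⊛-comm (shift g) Hmix))))
      (Ring.sym (⊛-assoc Hmix (shift f) g))))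

Hs-cancel : ∀ f → Hmix ⊛ (s ⊛ f) ≐ f
Hs-cancel f = Ring.trans (Ring.sym (⊛-assoc Hmix s f)) (Ring.trans (⊛-congʳ f (Ring.trans (⊛-comm Hmix s) sH)) (⊛-identityˡ f))

step-tS : ∀ f → step (tS ⊛ f) ≐ f
step-tS f = Ring.trans (⊛-congˡ Hmix (shift-tS-⊛ f)) (Hs-cancel f)

tS-H : ∀ f → tS ⊛ (Hmix ⊛ f) ≐ qS ⊛ f
tS-H f = Ring.trans (⊛-congʳ (Hmix ⊛ f) tS≐qs) (Ring.trans (⊛-assoc qS s (Hmix ⊛ f)) (⊛-congˡ qS
  (Ring.trans (Ring.sym (⊛-assoc s Hmix f)) (Ring.trans (⊛-congʳ f sH) (⊛-identityˡ f)))))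

step-decomposition : ∀ f → f ≐ κ (f 0) ⊕ tS ⊛ step f
step-decomposition f = Ring.sym (Ring.trans (⊕-congˡ (κ (f 0)) (tS-H (shift f))) (pointwise recompose))
  where
  recompose : ∀ n → f 0 * oneS n + (qS ⊛ shift f) n ≡ f n
  recompose zero    = trans (ℤ.+-identityʳ _) (ℤ.*-identityʳ (f 0))
  recompose (suc n) = trans (cong₂ _+_ (ℤ.*-zeroʳ (f 0)) (qS-⊛-suc (shift f) n)) (ℤ.+-identityˡ _)

-- From f = f₀ + t g with g = `step f` one gets ϑf = t (g + ϑg), because ϑt = t; each removal of a
-- factor t thus adds 1 to the multiplier.
digits-ϑ : ∀ f k → digits (ϑ f) k ≡ ℤ.+ k * digits f k
digits-ϑ f zero    = ⊛-zero (inv1 λS) (D f)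
digits-ϑ f (suc k) = begin
  digits (step (ϑ f)) k
    ≡⟨ coeff (digits-cong (Ring.trans (step-cong ϑ-decomposition) (step-tS (step f ⊕ ϑ (step f))))) k ⟩
  digits (step f ⊕ ϑ (step f)) k
    ≡⟨ coeff (digits-⊕ (step f) (ϑ (step f))) k ⟩
  digits (step f) k + digits (ϑ (step f)) k
    ≡⟨ cong (digits (step f) k +_) (digits-ϑ (step f) k) ⟩
  digits (step f) k + ℤ.+ k * digits (step f) k
    ≡⟨ ℤ.suc-* (ℤ.+ k) (digits (step f) k) ⟨
  ℤ.+ suc k * digits (step f) k ∎
  where
  open Solver
  factor : tS ⊛ λS ⊛ step f ⊕ tS ⊛ (λS ⊛ ϑ (step f)) ≐ λS ⊛ (tS ⊛ (step f ⊕ ϑ (step f)))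
  factor = solve 4 (λ t l f g → t :* l :* f :+ t :* (l :* g) := l :* (t :* (f :+ g))) Ring.refl tS λS (step f) (ϑ (step f))
  ϑ-decomposition : ϑ f ≐ tS ⊛ (step f ⊕ ϑ (step f))
  ϑ-decomposition = ⊛-cancelˡ λS λS-0 (Ring.trans (λϑ f) (Ring.trans (D-cong (step-decomposition f))
    (Ring.trans (D-⊕ (κ (f 0)) (tS ⊛ step f)) (Ring.trans (Ring.+-cong (D-κ (f 0)) (D-⊛ tS (step f)))
    (Ring.trans (Ring.+-identityˡ (D tS ⊛ step f ⊕ tS ⊛ D (step f)))
    (Ring.trans (Ring.+-cong (⊛-congʳ (step f) (D≐ tS-logDerivative)) (⊛-congˡ tS (Ring.sym (λϑ (step f))))) factor))))))

-- With M = m + 1, λ H^M = q^M θt/t^(M+1) = -(q^M/M) θ(t^(-M)), and a derivative θ has no constant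
-- term. Multiplying by M keeps this within power series: M λ H^M = M H^M - θ(H^M).
λH^-diagonal : ∀ m → (λS ⊛ Hmix ^S suc m) (suc m) ≡ 0ℤ
λH^-diagonal m = ℤ.*-cancelˡ-≡ (ℤ.+ M) _ 0ℤ (begin
  ℤ.+ M * (λS ⊛ h) M
    ≡⟨ cong (ℤ.+ M *_) (trans (coeff (⊛-distribʳ h oneS (D s ⊛ Hmix)) M)
         (cong₂ _+_ (coeff (⊛-identityˡ h) M) (coeff (⊛-comm (D s ⊛ Hmix) h) M))) ⟩
  ℤ.+ M * (h M + (h ⊛ (D s ⊛ Hmix)) M)
    ≡⟨ ℤ.*-distribˡ-+ (ℤ.+ M) (h M) _ ⟩
  ℤ.+ M * h M + ℤ.+ M * (h ⊛ (D s ⊛ Hmix)) M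
    ≡⟨ cong (_+ ℤ.+ M * (h ⊛ (D s ⊛ Hmix)) M) (trans (coeff (D≐ h-logDerivative) M) (trans (Σ-cong (suc M) (λ k →
         pull (ℤ.+ M) (h k) ((D s ⊛ Hmix) (M ∸ k)))) (Σ-*ˡ (suc M) (- (ℤ.+ M)) _))) ⟩
  - (ℤ.+ M) * (h ⊛ (D s ⊛ Hmix)) M + ℤ.+ M * (h ⊛ (D s ⊛ Hmix)) M
    ≡⟨ cancel (ℤ.+ M) ((h ⊛ (D s ⊛ Hmix)) M) ⟩
  ℤ.+ M * 0ℤ ∎)
  where
  M : ℕ
  M = suc m
  h : Ser
  h = Hmix ^S M
  h-logDerivative : h hasLogDerivative ((ℤ.+ M) · ⊖ (D s ⊛ Hmix))
  h-logDerivative = ^-logDerivative M (inv1-logDerivative s-0 s-logDerivative)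
  pull : ∀ m x y → x * (m * - y) ≡ - m * (x * y)
  pull = solve-∀
  cancel : ∀ m x → - m * x + m * x ≡ m * 0ℤ
  cancel = solve-∀

-- Write f = f₀ + t g with g = `step f`. The constant f₀ contributes nothing on the diagonal of
-- positive index, and in the rest t H = q lowers the exponent and the power of H together.
lagrange : ∀ m f → (f ⊛ λS ⊛ Hmix ^S m) m ≡ digits f m
lagrange zero f = begin
  (f ⊛ λS ⊛ oneS) 0    ≡⟨ coeff (Ring.*-identityʳ (f ⊛ λS)) 0 ⟩
  (f ⊛ λS) 0           ≡⟨ trans (⊛-zero f λS) (trans (cong (f 0 *_) λS-0) (ℤ.*-identityʳ (f 0))) ⟩
  f 0                  ∎
lagrange (suc m) f = begin
  (f ⊛ λS ⊛ Hmix ^S suc m) (suc m)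
    ≡⟨ coeff (Ring.trans (⊛-congʳ (Hmix ^S suc m) (⊛-congʳ λS (step-decomposition f))) expand) (suc m) ⟩
  (κ (f 0) ⊛ (λS ⊛ Hmix ^S suc m) ⊕ tS ⊛ (Hmix ⊛ (step f ⊛ λS ⊛ Hmix ^S m))) (suc m)
    ≡⟨ cong₂ _+_ (trans (sym (coeff (·-• (f 0) (λS ⊛ Hmix ^S suc m)) (suc m)))
           (trans (cong (f 0 *_) (λH^-diagonal m)) (ℤ.*-zeroʳ (f 0))))
         (trans (coeff (tS-H (step f ⊛ λS ⊛ Hmix ^S m)) (suc m)) (qS-⊛-suc (step f ⊛ λS ⊛ Hmix ^S m) m)) ⟩
  0ℤ + (step f ⊛ λS ⊛ Hmix ^S m) m
    ≡⟨ ℤ.+-identityˡ _ ⟩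
  (step f ⊛ λS ⊛ Hmix ^S m) m
    ≡⟨ lagrange m (step f) ⟩
  digits f (suc m) ∎
  where
  open Solver
  expand : (κ (f 0) ⊕ tS ⊛ step f) ⊛ λS ⊛ (Hmix ⊛ Hmix ^S m) ≐
    κ (f 0) ⊛ (λS ⊛ (Hmix ⊛ Hmix ^S m)) ⊕ tS ⊛ (Hmix ⊛ (step f ⊛ λS ⊛ Hmix ^S m))
  expand = solve 6 (λ c t f l h hᵐ → (c :+ t :* f) :* l :* (h :* hᵐ) := c :* (l :* (h :* hᵐ)) :+ t :* (h :* (f :* l :* hᵐ)))
    Ring.refl (κ (f 0)) tS (step f) λS Hmix (Hmix ^S m)

b : Ser
b = digits a

Cmix-H^-diagonal : ∀ m → (Cmix ⊛ Hmix ^S m) m ≡ (b ⊛ (b ⊛ b)) m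
Cmix-H^-diagonal m = begin
  (Cmix ⊛ Hmix ^S m) m              ≡⟨ coeff (⊛-congʳ (Hmix ^S m) Cmix≐a³λ) m ⟩
  (a ⊛ a ⊛ a ⊛ λS ⊛ Hmix ^S m) m    ≡⟨ lagrange m (a ⊛ a ⊛ a) ⟩
  digits (a ⊛ a ⊛ a) m              ≡⟨ coeff (digits-cong (⊛-assoc a a a)) m ⟩
  digits (a ⊛ (a ⊛ a)) m            ≡⟨ coeff (Ring.trans (digits-⊛ a (a ⊛ a)) (⊛-congˡ b (digits-⊛ a a))) m ⟩
  (b ⊛ (b ⊛ b)) m                   ∎

b-recurrence : ∀ k → ℤ.+ suc k * ℤ.+ suc k * b (suc k) ≡ (ℤ.+ 108 * ℤ.+ k * ℤ.+ k + ℤ.+ 54 * ℤ.+ k + ℤ.+ 6) * b k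
b-recurrence k = begin
  ℤ.+ suc k * ℤ.+ suc k * b (suc k)
    ≡⟨ second (suc k) ⟨
  -- The digit of index k + 1 is by definition the digit k of `step`, which strips the factor t from
  -- the right side of the differential equation.
  digits (step (ϑ (ϑ a))) k
    ≡⟨ coeff (digits-cong (Ring.trans (step-cong (Consequences.equation Hypergeometric-equation.Y≈)) (step-tS rhs))) k ⟩
  digits ((ℤ.+ 108) • ϑ (ϑ a) ⊕ (ℤ.+ 54) • ϑ a ⊕ (ℤ.+ 6) • a) k
    ≡⟨ trans (coeff (digits-⊕ ((ℤ.+ 108) • ϑ (ϑ a) ⊕ (ℤ.+ 54) • ϑ a) ((ℤ.+ 6) • a)) k)
         (cong (_+ digits ((ℤ.+ 6) • a) k) (coeff (digits-⊕ ((ℤ.+ 108) • ϑ (ϑ a)) ((ℤ.+ 54) • ϑ a)) k)) ⟩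
  digits ((ℤ.+ 108) • ϑ (ϑ a)) k + digits ((ℤ.+ 54) • ϑ a) k + digits ((ℤ.+ 6) • a) k
    ≡⟨ cong₂ _+_ (cong₂ _+_ (trans (digits-• (ℤ.+ 108) (ϑ (ϑ a))) (cong (ℤ.+ 108 *_) (second k)))
         (trans (digits-• (ℤ.+ 54) (ϑ a)) (cong (ℤ.+ 54 *_) (digits-ϑ a k)))) (digits-• (ℤ.+ 6) a) ⟩
  ℤ.+ 108 * (ℤ.+ k * ℤ.+ k * b k) + ℤ.+ 54 * (ℤ.+ k * b k) + ℤ.+ 6 * b k
    ≡⟨ collect (ℤ.+ k) (b k) ⟩
  (ℤ.+ 108 * ℤ.+ k * ℤ.+ k + ℤ.+ 54 * ℤ.+ k + ℤ.+ 6) * b k ∎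
  where
  rhs : Ser
  rhs = (ℤ.+ 108) • ϑ (ϑ a) ⊕ (ℤ.+ 54) • ϑ a ⊕ (ℤ.+ 6) • a
  second : ∀ k → digits (ϑ (ϑ a)) k ≡ ℤ.+ k * ℤ.+ k * b k
  second k = trans (digits-ϑ (ϑ a) k) (trans (cong (ℤ.+ k *_) (digits-ϑ a k)) (sym (ℤ.*-assoc (ℤ.+ k) (ℤ.+ k) (b k))))
  digits-• : ∀ c f → digits (c • f) k ≡ c * digits f k
  digits-• c f = trans (coeff (digits-cong (Ring.sym (·-• c f))) k) (coeff (digits-· c f) k)
  collect : ∀ k x → ℤ.+ 108 * (k * k * x) + ℤ.+ 54 * (k * x) + ℤ.+ 6 * x ≡ (ℤ.+ 108 * k * k + ℤ.+ 54 * k + ℤ.+ 6) * x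
  collect = solve-∀

-- Passage to ℚ

ι : ℤ → ℚ
ι i = i / 1

toℚᵘ-/ : ∀ i d → toℚᵘ (i / suc d) ℚᵘ.≃ mkℚᵘ i d
toℚᵘ-/ i d = ℚ.toℚᵘ-fromℚᵘ (mkℚᵘ i d)

ι-+ : ∀ i j → ι (i + j) ≡ ι i ℚ.+ ι j
ι-+ i j = ℚ.toℚᵘ-injective (ℚᵘ.≃-trans (toℚᵘ-/ (i + j) 0) (ℚᵘ.≃-trans (*≡* (common-denominator i j))
  (ℚᵘ.≃-sym (ℚᵘ.≃-trans (ℚ.toℚᵘ-homo-+ (ι i) (ι j)) (ℚᵘ.+-cong (toℚᵘ-/ i 0) (toℚᵘ-/ j 0))))))
  where
  common-denominator : ∀ i j → (i + j) * 1ℤ ≡ (i * 1ℤ + j * 1ℤ) * 1ℤ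
  common-denominator = solve-∀

ι-* : ∀ i j → ι (i * j) ≡ ι i ℚ.* ι j
ι-* i j = ℚ.toℚᵘ-injective (ℚᵘ.≃-trans (toℚᵘ-/ (i * j) 0)
  (ℚᵘ.≃-sym (ℚᵘ.≃-trans (ℚ.toℚᵘ-homo-* (ι i) (ι j)) (ℚᵘ.*-cong (toℚᵘ-/ i 0) (toℚᵘ-/ j 0)))))

/-ι : ∀ i n .{{_ : ℕ.NonZero n}} → (i / n) ℚ.* ι (ℤ.+ n) ≡ ι i
/-ι i (suc d) = ℚ.toℚᵘ-injective (ℚᵘ.≃-trans (ℚ.toℚᵘ-homo-* (i / suc d) (ι (ℤ.+ suc d)))
  (ℚᵘ.≃-trans (ℚᵘ.*-cong (toℚᵘ-/ i d) (toℚᵘ-/ (ℤ.+ suc d) 0))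
  (ℚᵘ.≃-trans (*≡* (trans (ℤ.*-assoc i (ℤ.+ suc d) 1ℤ) (cong (λ e → i * e) (sym (ℤ.pos-* (suc d) 1)))))
    (ℚᵘ.≃-sym (toℚᵘ-/ i 0)))))

ι-cancelˡ : ∀ n .{{_ : ℕ.NonZero n}} {p q} → ι (ℤ.+ n) ℚ.* p ≡ ι (ℤ.+ n) ℚ.* q → p ≡ q
ι-cancelˡ n {p} {q} e = trans (sym (retract p)) (trans (cong ((1ℤ / n) ℚ.*_) e) (retract q))
  where
  retract : ∀ p → (1ℤ / n) ℚ.* (ι (ℤ.+ n) ℚ.* p) ≡ p
  retract p = trans (sym (ℚ.*-assoc (1ℤ / n) (ι (ℤ.+ n)) p)) (trans (cong (ℚ._* p) (/-ι 1ℤ n)) (ℚ.*-identityˡ p))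

ι-Σ : ∀ n f → ι (Σℤ n f) ≡ Σℚ n (λ k → ι (f k))
ι-Σ zero    f = refl
ι-Σ (suc n) f = trans (ι-+ (Σℤ n f) (f n)) (cong (ℚ._+ ι (f n)) (ι-Σ n f))

Σℚ-cong< : ∀ n {f g : ℕ → ℚ} → (∀ k → k ℕ.< n → f k ≡ g k) → Σℚ n f ≡ Σℚ n g
Σℚ-cong< zero    e = refl
Σℚ-cong< (suc n) e = cong₂ ℚ._+_ (Σℚ-cong< n (λ k k<n → e k (ℕ.m<n⇒m<1+n k<n))) (e n ℕ.≤-refl)

Σℚ-*ˡ : ∀ n c f → Σℚ n (λ k → c ℚ.* f k) ≡ c ℚ.* Σℚ n f
Σℚ-*ˡ zero    c f = sym (ℚ.*-zeroʳ c)
Σℚ-*ˡ (suc n) c f = trans (cong (ℚ._+ c ℚ.* f n) (Σℚ-*ˡ n c f)) (sym (ℚ.*-distribˡ-+ c (Σℚ n f) (f n)))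

module ℚ-Solver = Data.Rational.Solver.+-*-Solver

scale : ℕ → ℚ
scale n = ι (ℤ.+ (108 ℕ.^ n))

scale-+ : ∀ m n → scale (m ℕ.+ n) ≡ scale m ℚ.* scale n
scale-+ m n = trans (cong (λ k → ι (ℤ.+ k)) (ℕ.^-distribˡ-+-* 108 m n))
  (trans (cong ι (ℤ.pos-* (108 ℕ.^ m) (108 ℕ.^ n))) (ι-* (ℤ.+ (108 ℕ.^ m)) (ℤ.+ (108 ℕ.^ n))))

infix 4 _scalesTo_
-- g(z) = f(108 z), coefficient by coefficient.
_scalesTo_ : SerQ → Ser → Set
f scalesTo g = ∀ n → ι (g n) ≡ scale n ℚ.* f n

⊛-scalesTo : ∀ f g f′ g′ → f scalesTo f′ → g scalesTo g′ → f ⊛Q g scalesTo f′ ⊛ g′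
⊛-scalesTo f g f′ g′ p q n = trans (ι-Σ (suc n) _) (trans (Σℚ-cong< (suc n) term) (Σℚ-*ˡ (suc n) (scale n) _))
  where
  open ℚ-Solver
  term : ∀ k → k ℕ.< suc n → ι (f′ k * g′ (n ∸ k)) ≡ scale n ℚ.* (f k ℚ.* g (n ∸ k))
  term k k≤n = begin
    ι (f′ k * g′ (n ∸ k))
      ≡⟨ trans (ι-* (f′ k) (g′ (n ∸ k))) (cong₂ ℚ._*_ (p k) (q (n ∸ k))) ⟩
    scale k ℚ.* f k ℚ.* (scale (n ∸ k) ℚ.* g (n ∸ k))
      ≡⟨ solve 4 (λ s x s′ y → s :* x :* (s′ :* y) := s :* s′ :* (x :* y)) refl (scale k) (f k) (scale (n ∸ k)) (g (n ∸ k)) ⟩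
    scale k ℚ.* scale (n ∸ k) ℚ.* (f k ℚ.* g (n ∸ k))
      ≡⟨ cong (ℚ._* (f k ℚ.* g (n ∸ k))) (scale-+ k (n ∸ k)) ⟨
    scale (k ℕ.+ (n ∸ k)) ℚ.* (f k ℚ.* g (n ∸ k))
      ≡⟨ cong (λ m → scale m ℚ.* (f k ℚ.* g (n ∸ k))) (ℕ.m+[n∸m]≡n (ℕ.s≤s⁻¹ k≤n)) ⟩
    scale n ℚ.* (f k ℚ.* g (n ∸ k)) ∎

1/k!² : ℕ → ℚ
1/k!² k = (1ℤ / (k ! ℕ.* k !)) {{k ℕ.!* k !≢0}}

1/k!²-suc : ∀ k → ι (ℤ.+ (suc k ℕ.* suc k)) ℚ.* 1/k!² (suc k) ≡ 1/k!² k
1/k!²-suc k = begin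
  ι k⁺² ℚ.* w′
    ≡⟨ trans (cong (ℚ._* (ι k⁺² ℚ.* w′)) (/-ι 1ℤ (k ! ℕ.* k !) {{k ℕ.!* k !≢0}})) (ℚ.*-identityˡ _) ⟨
  w ℚ.* ι k!² ℚ.* (ι k⁺² ℚ.* w′)
    ≡⟨ solve 4 (λ w x y z → w :* x :* (y :* z) := w :* (z :* (y :* x))) refl w (ι k!²) (ι k⁺²) w′ ⟩
  w ℚ.* (w′ ℚ.* (ι k⁺² ℚ.* ι k!²))
    ≡⟨ cong (λ x → w ℚ.* (w′ ℚ.* x)) (trans (cong ι square) (ι-* k⁺² k!²)) ⟨
  w ℚ.* (w′ ℚ.* ι (ℤ.+ (suc k ! ℕ.* suc k !)))
    ≡⟨ cong (w ℚ.*_) (/-ι 1ℤ (suc k ! ℕ.* suc k !) {{suc k ℕ.!* suc k !≢0}}) ⟩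
  w ℚ.* 1ℚ
    ≡⟨ ℚ.*-identityʳ w ⟩
  w ∎
  where
  open ℚ-Solver
  k⁺² k!² : ℤ
  k⁺² = ℤ.+ (suc k ℕ.* suc k)
  k!² = ℤ.+ (k ! ℕ.* k !)
  w w′ : ℚ
  w = 1/k!² k
  w′ = 1/k!² (suc k)
  interchange : ∀ m n → m ℕ.* n ℕ.* (m ℕ.* n) ≡ m ℕ.* m ℕ.* (n ℕ.* n)
  interchange = ℕ-Solver.solve-∀
  square : ℤ.+ (suc k ! ℕ.* suc k !) ≡ k⁺² * k!²
  square = trans (cong ℤ.+_ (interchange (suc k) (k !))) (ℤ.pos-* (suc k ℕ.* suc k) (k ! ℕ.* k !))

recurrence-coefficient : ℕ → ℤ
recurrence-coefficient k = ℤ.+ 108 * ℤ.+ k * ℤ.+ k + ℤ.+ 54 * ℤ.+ k + ℤ.+ 6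

-- Of 108 = 6 · 6 · 3, one 6 and the 3 clear the denominators of 1/6 + k and 1/3 + k; what remains
-- is 6 (6k + 1)(3k + 1), the polynomial of `b-recurrence`.
Fmix-recurrence : ∀ k → ι (ℤ.+ (suc k ℕ.* suc k)) ℚ.* (ι (ℤ.+ 108) ℚ.* Fmix (suc k)) ≡ ι (recurrence-coefficient k) ℚ.* Fmix k
Fmix-recurrence k = begin
  ι (ℤ.+ (suc k ℕ.* suc k)) ℚ.* (ι (ℤ.+ 108) ℚ.* (p ℚ.* x ℚ.* (p′ ℚ.* x′) ℚ.* 1/k!² (suc k)))
    ≡⟨ cong (λ c → ι (ℤ.+ (suc k ℕ.* suc k)) ℚ.* (c ℚ.* (p ℚ.* x ℚ.* (p′ ℚ.* x′) ℚ.* 1/k!² (suc k)))) 108≡ ⟩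
  ι (ℤ.+ (suc k ℕ.* suc k)) ℚ.* (ι (ℤ.+ 6) ℚ.* ι (ℤ.+ 6) ℚ.* ι (ℤ.+ 3) ℚ.* (p ℚ.* x ℚ.* (p′ ℚ.* x′) ℚ.* 1/k!² (suc k)))
    ≡⟨ solve 8 (λ k⁺² six three p x p′ x′ w → k⁺² :* (six :* six :* three :* (p :* x :* (p′ :* x′) :* w)) :=
         six :* (x :* six) :* (x′ :* three) :* (p :* p′ :* (k⁺² :* w))) refl
         (ι (ℤ.+ (suc k ℕ.* suc k))) (ι (ℤ.+ 6)) (ι (ℤ.+ 3)) p x p′ x′ (1/k!² (suc k)) ⟩
  ι (ℤ.+ 6) ℚ.* (x ℚ.* ι (ℤ.+ 6)) ℚ.* (x′ ℚ.* ι (ℤ.+ 3)) ℚ.* (p ℚ.* p′ ℚ.* (ι (ℤ.+ (suc k ℕ.* suc k)) ℚ.* 1/k!² (suc k)))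
    ≡⟨ cong₂ ℚ._*_ coefficient (cong (p ℚ.* p′ ℚ.*_) (1/k!²-suc k)) ⟩
  ι (recurrence-coefficient k) ℚ.* (p ℚ.* p′ ℚ.* 1/k!² k) ∎
  where
  open ℚ-Solver
  p x p′ x′ : ℚ
  p = poch (1ℤ / 6) k
  x = (1ℤ / 6) ℚ.+ ι (ℤ.+ k)
  p′ = poch (1ℤ / 3) k
  x′ = (1ℤ / 3) ℚ.+ ι (ℤ.+ k)
  108≡ : ι (ℤ.+ 108) ≡ ι (ℤ.+ 6) ℚ.* ι (ℤ.+ 6) ℚ.* ι (ℤ.+ 3)
  108≡ = refl
  clear : ∀ n .{{_ : ℕ.NonZero n}} → ((1ℤ / n) ℚ.+ ι (ℤ.+ k)) ℚ.* ι (ℤ.+ n) ≡ ι (1ℤ + ℤ.+ k * ℤ.+ n)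
  clear n = trans (ℚ.*-distribʳ-+ (ι (ℤ.+ n)) (1ℤ / n) (ι (ℤ.+ k)))
    (trans (cong₂ ℚ._+_ (/-ι 1ℤ n) (sym (ι-* (ℤ.+ k) (ℤ.+ n)))) (sym (ι-+ 1ℤ (ℤ.+ k * ℤ.+ n))))
  expand : ∀ k → ℤ.+ 6 * (1ℤ + k * ℤ.+ 6) * (1ℤ + k * ℤ.+ 3) ≡ ℤ.+ 108 * k * k + ℤ.+ 54 * k + ℤ.+ 6
  expand = solve-∀
  coefficient : ι (ℤ.+ 6) ℚ.* (x ℚ.* ι (ℤ.+ 6)) ℚ.* (x′ ℚ.* ι (ℤ.+ 3)) ≡ ι (recurrence-coefficient k)
  coefficient = begin
    ι (ℤ.+ 6) ℚ.* (x ℚ.* ι (ℤ.+ 6)) ℚ.* (x′ ℚ.* ι (ℤ.+ 3))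
      ≡⟨ cong₂ (λ y z → ι (ℤ.+ 6) ℚ.* y ℚ.* z) (clear 6) (clear 3) ⟩
    ι (ℤ.+ 6) ℚ.* ι (1ℤ + ℤ.+ k * ℤ.+ 6) ℚ.* ι (1ℤ + ℤ.+ k * ℤ.+ 3)
      ≡⟨ trans (ι-* (ℤ.+ 6 * (1ℤ + ℤ.+ k * ℤ.+ 6)) (1ℤ + ℤ.+ k * ℤ.+ 3))
           (cong (ℚ._* ι (1ℤ + ℤ.+ k * ℤ.+ 3)) (ι-* (ℤ.+ 6) (1ℤ + ℤ.+ k * ℤ.+ 6))) ⟨
    ι (ℤ.+ 6 * (1ℤ + ℤ.+ k * ℤ.+ 6) * (1ℤ + ℤ.+ k * ℤ.+ 3))
      ≡⟨ cong ι (expand (ℤ.+ k)) ⟩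
    ι (recurrence-coefficient k) ∎

-- Both sides start at 1 and satisfy the same first-order recurrence, whose leading coefficient (k +
-- 1)² can be cancelled.
Fmix-scalesTo-b : Fmix scalesTo b
Fmix-scalesTo-b zero    = refl
Fmix-scalesTo-b (suc k) = ι-cancelˡ (suc k ℕ.* suc k) (begin
  ι k⁺² ℚ.* ι (b (suc k))
    ≡⟨ ι-* k⁺² (b (suc k)) ⟨
  ι (k⁺² * b (suc k))
    ≡⟨ cong ι (trans (cong (_* b (suc k)) (ℤ.pos-* (suc k) (suc k))) (b-recurrence k)) ⟩
  ι (recurrence-coefficient k * b k)
    ≡⟨ trans (ι-* (recurrence-coefficient k) (b k)) (cong (ι (recurrence-coefficient k) ℚ.*_) (Fmix-scalesTo-b k)) ⟩
  ι (recurrence-coefficient k) ℚ.* (scale k ℚ.* Fmix k)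
    ≡⟨ solve 3 (λ c s f → c :* (s :* f) := s :* (c :* f)) refl (ι (recurrence-coefficient k)) (scale k) (Fmix k) ⟩
  scale k ℚ.* (ι (recurrence-coefficient k) ℚ.* Fmix k)
    ≡⟨ cong (scale k ℚ.*_) (Fmix-recurrence k) ⟨
  scale k ℚ.* (ι k⁺² ℚ.* (ι (ℤ.+ 108) ℚ.* Fmix (suc k)))
    ≡⟨ solve 4 (λ s c d f → s :* (c :* (d :* f)) := c :* ((d :* s) :* f)) refl (scale k) (ι k⁺²) (ι (ℤ.+ 108)) (Fmix (suc k)) ⟩
  ι k⁺² ℚ.* (ι (ℤ.+ 108) ℚ.* scale k ℚ.* Fmix (suc k))
    ≡⟨ cong (λ c → ι k⁺² ℚ.* (c ℚ.* Fmix (suc k))) (scale-+ 1 k) ⟨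
  ι k⁺² ℚ.* (scale (suc k) ℚ.* Fmix (suc k)) ∎)
  where
  open ℚ-Solver
  k⁺² : ℤ
  k⁺² = ℤ.+ (suc k ℕ.* suc k)

theorem2p5 : (m : ℕ) → Amix m ≡ ((Cmix ⊛ (Hmix ^S m)) m / 1)
theorem2p5 m = sym (trans (cong ι (Cmix-H^-diagonal m))
  (⊛-scalesTo Fmix (Fmix ⊛Q Fmix) b (b ⊛ b) Fmix-scalesTo-b
    (⊛-scalesTo Fmix Fmix b b Fmix-scalesTo-b Fmix-scalesTo-b) m))
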